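{- Let $n>2$ and $l<n$ be positive integers of the same parity. Then \[ \sum_{\substack{a_1+\dots+a_l=n\\ a_i \text{ odd},\ a_1>1}}\zeta^{\frac12}(a_1,\dots,a_l)=\frac{n-1}{n-l}\binom{\frac{n+l}{2}-2}{l-1}\frac{\zeta(n)}{2^{l-1}}=\frac{n-1}{\frac{n+l}2-1}\binom{\frac{n+l}2-1}{l-1}\frac{\zeta(n)}{2^l}, \] the sum being over positive odd integers $a_1,\dots,a_l$.
   Context: For positive integers $i_1,\dots,i_k$ with $i_1>1$, $\zeta(i_1,\dots,i_k)=\sum_{n_1>\dots>n_k\ge1}n_1^{ -i_1}\cdots n_k^{ -i_k}$. For $r\in\mathbb{Q}$ the interpolated multiple zeta value is $\zeta^r(i_1,\dots,i_k)=\sum_{J}r^{k-m}\zeta(J[i])$, where $J=(j_1,\dots,j_m)$ runs over compositions of $k$ and $J[i]=(i_1+\dots+i_{j_1},\,i_{j_1+1}+\dots+i_{j_1+j_2},\dots)$ is the sequence of block sums; $\zeta^{\frac12}$ is the case $r=\tfrac12$. -}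

module Defs where

open import Data.Nat as ℕ using (ℕ; zero; suc; _∸_; _≤ᵇ_)
open import Data.Nat.Combinatorics using (_C_)
open import Data.Nat.Base using (⌊_/2⌋)
open import Data.Integer using (+_)
open import Data.Rational using (ℚ; 0ℚ; 1ℚ; _+_; _*_; _-_; _/_)
open import Data.List using (List; []; _∷_; [_]; map; concatMap; upTo; take; drop; length; foldr)
open import Data.Bool using (Bool; true; false; _∧_; if_then_else_)
open import Relation.Nullary.Decidable using (does)
open import Data.Nat.Properties using (_≟_)

ℕ→ℚ : ℕ → ℚ
ℕ→ℚ m = + m / 1

_^ℚ_ : ℚ → ℕ → ℚ
p ^ℚ zero = 1ℚ
p ^ℚ suc k = p * (p ^ℚ k)

sum1to : ℕ → (ℕ → ℚ) → ℚ
sum1to zero f = 0ℚ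
sum1to (suc N) f = sum1to N f + f (suc N)

sumℚ : List ℚ → ℚ
sumℚ = foldr _+_ 0ℚ

-- Truncated multiple zeta value:
-- ζ_N(i₁,…,i_k) = Σ_{N ≥ n₁ > … > n_k ≥ 1} n₁^{-i₁} ⋯ n_k^{-i_k}
ζtr : ℕ → List ℕ → ℚ
ζtr N [] = 1ℚ
ζtr N (i ∷ is) = sum1to N (λ m → ((+ 1 / suc (m ∸ 1))) ^ℚ i * ζtr (m ∸ 1) is)
-- (for m ≥ 1 in the sum, suc (m ∸ 1) = m, so the term is m^{-i} ζ_{m-1}(is))

-- Compositions of k: lists of positive integers summing to k (first argument is fuel)
compsF : ℕ → ℕ → List (List ℕ)
compsF _ zero = [ [] ]
compsF zero (suc k) = []
compsF (suc f) (suc k) =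
  concatMap (λ j → map (suc j ∷_) (compsF f (k ∸ j))) (upTo (suc k))

compositions : ℕ → List (List ℕ)
compositions k = compsF k k

sumℕ : List ℕ → ℕ
sumℕ = foldr ℕ._+_ 0

blockSums : List ℕ → List ℕ → List ℕ
blockSums [] _ = []
blockSums (j ∷ J) is = sumℕ (take j is) ∷ blockSums J (drop j is)

ζrtr : ℚ → ℕ → List ℕ → ℚ
ζrtr r N is =
  sumℚ (map (λ J → (r ^ℚ (length is ∸ length J)) * ζtr N (blockSums J is))
            (compositions (length is)))

half : ℚ
half = + 1 / 2

isOdd : ℕ → Bool
isOdd zero = false
isOdd (suc zero) = true
isOdd (suc (suc m)) = isOdd m

allOdd : List ℕ → Bool
allOdd = foldr (λ a b → isOdd a ∧ b) true

headGt1 : List ℕ → Bool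
headGt1 [] = false
headGt1 (a ∷ _) = 2 ≤ᵇ a

filterB : {A : Set} → (A → Bool) → List A → List A
filterB p [] = []
filterB p (x ∷ xs) = if p x then x ∷ filterB p xs else filterB p xs

hasLength : ℕ → List ℕ → Bool
hasLength l a = does (length a ≟ l)

admissible : ℕ → ℕ → List (List ℕ)
admissible n l = filterB (λ a → hasLength l a ∧ allOdd a ∧ headGt1 a) (compositions n)

lhsTr : ℕ → ℕ → ℕ → ℚ
lhsTr n l N = sumℚ (map (ζrtr half N) (admissible n l))

-- 1/d for d ≥ 1 (the value at d = 0 is an irrelevant junk value; never used under the hypotheses)
invℕ : ℕ → ℚ
invℕ zero = 0ℚ
invℕ (suc d) = + 1 / suc d

coeff1 : ℕ → ℕ → ℚ
coeff1 n l = ℕ→ℚ (n ∸ 1) * invℕ (n ∸ l) * ℕ→ℚ ((⌊ n ℕ.+ l /2⌋ ∸ 2) C (l ∸ 1)) * (half ^ℚ (l ∸ 1))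

coeff2 : ℕ → ℕ → ℚ
coeff2 n l = ℕ→ℚ (n ∸ 1) * invℕ (⌊ n ℕ.+ l /2⌋ ∸ 1) * ℕ→ℚ ((⌊ n ℕ.+ l /2⌋ ∸ 1) C (l ∸ 1)) * (half ^ℚ l)

{-# OPTIONS --safe #-}
module Submission where

-- Index the sum by the largest summation index m and collect the odd parts in a generating series: with
-- a - 1/a = y/2, b = ax and c = -x/a, the sums weighted by x^n y^l form the power series -2(b+c) Z_N, where
--   Z_N = Σ_{m≤N} (1/m) Π_{k<m} (k+b)(k+c) / ((k+1-b)(k+1-c)).
-- In the limit Z_N is the t-derivative at t = 0 of Dixon's well-poised ₃F₂(t,b,c), namely
--   ½ Σ_m (1/m + 1/(m-b-c) - 1/(m-b) - 1/(m-c)).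
-- To see this with finite sums, replace c by c - n: the resulting terms form a WZ pair (F, G). Telescoping over
-- the square 1 ≤ m ≤ N, 0 ≤ n < N and subtracting the same identity at c = 0 gives the limit truncated at N
-- plus error series, whose ℓ¹ coefficient norm is O(N^{-1/2}) once x is rescaled so that b and c are small.
-- The coefficients b^{n-1} + c^{n-1} are Lucas polynomials in b + c, whose coefficients are the stated binomials.
-- Finally the coefficient of each y^l is recovered from the values at the points y = 2(a - 1/a) by interpolation.

open import Defs
open import Data.Nat as ℕ using (ℕ; zero; suc; z≤n; s≤s; _<_; _≤_; _%_; ⌊_/2⌋)
import Data.Nat.Properties as ℕP
import Data.Nat.DivMod as DM
open import Data.Nat.Combinatorics using (_C_; nCn≡1; nCk+nC[k+1]≡[n+1]C[k+1]; k>n⇒nCk≡0; nCk≡nC[n∸k])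
import Data.Integer as ℤ
import Data.Integer.Properties as ℤP
open import Data.Rational using (ℚ; mkℚ; 0ℚ; 1ℚ; _+_; _*_; _-_; -_; 1/_; ∣_∣; _/_; *≤*; *<*; toℚᵘ; NonZero; Positive; positive; nonNegative)
  renaming (_<_ to _<ℚ_; _≤_ to _≤ℚ_)
open import Data.Rational.Properties
import Data.Rational.Unnormalised as ℚᵘ
import Data.Rational.Unnormalised.Properties as ℚᵘP
open import Data.Rational.Solver
open +-*-Solver using (solve; _:=_; _:+_; _:*_; _:-_; :-_; con)
open import Data.Bool using (Bool; true; false; _∧_; if_then_else_)
open import Data.List using (List; []; _∷_; [_]; map; concatMap; upTo; applyUpTo; take; drop; length; _++_)
open import Data.List.Properties using (map-∘)
open import Data.Maybe using (Maybe; just; nothing)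
open import Data.Product using (_×_; _,_; ∃-syntax; proj₁; proj₂)
open import Data.Sum using ([_,_]′)
open import Data.Empty using (⊥-elim)
open import Function using (_∘_)
open import Relation.Nullary using (yes; no)
open import Relation.Nullary.Decidable using (does; dec-false)
open import Relation.Binary using (IsEquivalence)
open import Relation.Binary.PropositionalEquality hiding (J; [_])
open import Algebra.Bundles using (CommutativeRing)
import Algebra.Solver.Ring
import Algebra.Solver.Ring.AlmostCommutativeRing as ACR
open import Level using (0ℓ)

-- Null sequences and polynomial interpolation

-- Why these values of y: b and c come from the roots of `X² - (ρy/2)X - ρ²`, which are irrational
-- for most rational y. At `y = 2(a - 1/a)` they are `ρa` and `-ρ/a`, so all series stay over ℚ. For
-- fixed n and N the sums in question are the coefficients of a polynomial in y of degree at most n,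
-- hence such values determine them. Why subtract at c = 0: once c is replaced by c - n, the term of
-- index m tends, as n grows, to `(-1)^m A_m / m` and not to 0, where A_m is the part of the product
-- in b; the row n = N of the square does not die out. That limit is the same for every c, and at c
-- = 0, n = 0 all terms vanish through the factor k = 0. The subtraction thus costs nothing on the
-- left and removes the limit. Why 1/8: a coefficient bound 1/8 on b makes the products in b grow in
-- norm at most like the product of `(k + 1/8)/(k - 1/8)`, of order N^(1/4), and the error is of the
-- order of its square over N. Being submultiplicative, the ℓ¹ norm bounds every coefficient of the
-- error at once, so no convergence in x enters.

/1-homo : ∀ m → toℚᵘ (ℕ→ℚ m) ℚᵘ.≃ ℚᵘ.mkℚᵘ (ℤ.+ m) 0
/1-homo m = toℚᵘ-fromℚᵘ (ℚᵘ.mkℚᵘ (ℤ.+ m) 0)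

ℕ→ℚ-+ : ∀ m n → ℕ→ℚ (m ℕ.+ n) ≡ ℕ→ℚ m + ℕ→ℚ n
ℕ→ℚ-+ m n = toℚᵘ-injective (begin
  toℚᵘ (ℕ→ℚ (m ℕ.+ n))                        ≈⟨ /1-homo (m ℕ.+ n) ⟩
  ℚᵘ.mkℚᵘ (ℤ.+ (m ℕ.+ n)) 0                     ≈⟨ ℚᵘ.*≡* (cong (ℤ._* (ℤ.+ 1)) (sym (cong₂ ℤ._+_ (ℤP.*-identityʳ (ℤ.+ m)) (ℤP.*-identityʳ (ℤ.+ n))))) ⟩
  ℚᵘ.mkℚᵘ (ℤ.+ m) 0 ℚᵘ.+ ℚᵘ.mkℚᵘ (ℤ.+ n) 0        ≈⟨ ℚᵘP.+-cong (/1-homo m) (/1-homo n) ⟨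
  toℚᵘ (ℕ→ℚ m) ℚᵘ.+ toℚᵘ (ℕ→ℚ n)              ≈⟨ toℚᵘ-homo-+ (ℕ→ℚ m) (ℕ→ℚ n) ⟨
  toℚᵘ (ℕ→ℚ m + ℕ→ℚ n) ∎)
  where open ℚᵘP.≃-Reasoning

ℕ→ℚ-* : ∀ m n → ℕ→ℚ (m ℕ.* n) ≡ ℕ→ℚ m * ℕ→ℚ n
ℕ→ℚ-* zero n = sym (*-zeroˡ (ℕ→ℚ n))
ℕ→ℚ-* (suc m) n = begin
  ℕ→ℚ (n ℕ.+ m ℕ.* n)         ≡⟨ ℕ→ℚ-+ n (m ℕ.* n) ⟩
  ℕ→ℚ n + ℕ→ℚ (m ℕ.* n)       ≡⟨ cong (ℕ→ℚ n +_) (ℕ→ℚ-* m n) ⟩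
  ℕ→ℚ n + ℕ→ℚ m * ℕ→ℚ n       ≡⟨ solve 2 (λ x y → y :+ x :* y := (con 1ℚ :+ x) :* y) refl (ℕ→ℚ m) (ℕ→ℚ n) ⟩
  (1ℚ + ℕ→ℚ m) * ℕ→ℚ n        ≡⟨ cong (_* ℕ→ℚ n) (sym (ℕ→ℚ-+ 1 m)) ⟩
  ℕ→ℚ (suc m) * ℕ→ℚ n ∎
  where open ≡-Reasoning

ℕ→ℚ-mono : ∀ {m n} → m ≤ n → ℕ→ℚ m ≤ℚ ℕ→ℚ n
ℕ→ℚ-mono {m} {n} m≤n = toℚᵘ-cancel-≤ (ℚᵘP.≤-respʳ-≃ (ℚᵘP.≃-sym (/1-homo n)) (ℚᵘP.≤-respˡ-≃ (ℚᵘP.≃-sym (/1-homo m))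
  (ℚᵘ.*≤* (ℤP.*-monoʳ-≤-nonNeg (ℤ.+ 1) (ℤ.+≤+ m≤n)))))

ℕ→ℚ-<-suc : ∀ m → ℕ→ℚ m <ℚ ℕ→ℚ (suc m)
ℕ→ℚ-<-suc m = subst (_<ℚ ℕ→ℚ (suc m)) (+-identityˡ (ℕ→ℚ m))
  (subst (0ℚ + ℕ→ℚ m <ℚ_) (sym (ℕ→ℚ-+ 1 m)) (+-monoˡ-< (ℕ→ℚ m) (positive⁻¹ 1ℚ)))

0≤ℕ→ℚ : ∀ m → 0ℚ ≤ℚ ℕ→ℚ m
0≤ℕ→ℚ m = ℕ→ℚ-mono {0} {m} z≤n

ℕ→ℚ-mono-< : ∀ {m n} → m < n → ℕ→ℚ m <ℚ ℕ→ℚ n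
ℕ→ℚ-mono-< {m} m<n = <-≤-trans (ℕ→ℚ-<-suc m) (ℕ→ℚ-mono m<n)

recip : ℕ → ℚ
recip k = ℤ.+ 1 / suc k

recip-inverse : ∀ k → ℕ→ℚ (suc k) * recip k ≡ 1ℚ
recip-inverse k = toℚᵘ-injective (begin
  toℚᵘ (ℕ→ℚ (suc k) * recip k)                ≈⟨ toℚᵘ-homo-* (ℕ→ℚ (suc k)) (recip k) ⟩
  toℚᵘ (ℕ→ℚ (suc k)) ℚᵘ.* toℚᵘ (recip k)      ≈⟨ ℚᵘP.*-cong (/1-homo (suc k)) (toℚᵘ-fromℚᵘ (ℚᵘ.mkℚᵘ (ℤ.+ 1) k)) ⟩
  ℚᵘ.mkℚᵘ (ℤ.+ suc k) 0 ℚᵘ.* ℚᵘ.mkℚᵘ (ℤ.+ 1) k    ≈⟨ ℚᵘ.*≡* (trans (ℤP.*-identityʳ _) (trans (ℤP.*-identityʳ _) (trans (cong ℤ.+_ (sym (ℕP.+-identityʳ (suc k)))) (sym (ℤP.*-identityˡ _)) ))) ⟩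
  ℚᵘ.mkℚᵘ (ℤ.+ 1) 0 ∎)
  where open ℚᵘP.≃-Reasoning

recip-pos : ∀ k → Positive (recip k)
recip-pos k = normalize-pos 1 (suc k)

*-mono-≤-nn : ∀ {p q r s} → 0ℚ ≤ℚ q → 0ℚ ≤ℚ r → p ≤ℚ q → r ≤ℚ s → p * r ≤ℚ q * s
*-mono-≤-nn {p} {q} {r} {s} 0≤q 0≤r p≤q r≤s =
  ≤-trans (*-monoʳ-≤-nonNeg r {{nonNegative 0≤r}} p≤q) (*-monoˡ-≤-nonNeg q {{nonNegative 0≤q}} r≤s)

0≤* : ∀ {p q} → 0ℚ ≤ℚ p → 0ℚ ≤ℚ q → 0ℚ ≤ℚ p * q
0≤* {p} {q} a b = nonNegative⁻¹ (p * q) {{nonNeg*nonNeg⇒nonNeg p {{nonNegative a}} q {{nonNegative b}}}}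

0≤+ : ∀ {p q} → 0ℚ ≤ℚ p → 0ℚ ≤ℚ q → 0ℚ ≤ℚ p + q
0≤+ {p} {q} a b = nonNegative⁻¹ (p + q) {{nonNeg+nonNeg⇒nonNeg p {{nonNegative a}} q {{nonNegative b}}}}

≤-from-diff : ∀ {p q} → 0ℚ ≤ℚ q - p → p ≤ℚ q
≤-from-diff {p} {q} h = subst₂ _≤ℚ_ (+-identityˡ p) (solve 2 (λ p q → q :- p :+ p := q) refl p q) (+-monoˡ-≤ p h)

<⇒0<diff : ∀ {p q} → p <ℚ q → 0ℚ <ℚ q - p
<⇒0<diff {p} {q} h = subst (_<ℚ q - p) (+-inverseʳ p) (+-monoˡ-< (- p) h)

Small : (ℕ → ℚ) → Set
Small f = (ε : ℚ) → 0ℚ <ℚ ε → ∃[ N₀ ] ((N : ℕ) → N₀ ≤ N → ∣ f N ∣ <ℚ ε)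

Small-cong : ∀ {f g} → (∀ N → f N ≡ g N) → Small f → Small g
Small-cong eq sm ε 0<ε with sm ε 0<ε
... | N₀ , h = N₀ , λ N le → subst (λ x → ∣ x ∣ <ℚ ε) (eq N) (h N le)

0<½* : ∀ {ε} → 0ℚ <ℚ ε → 0ℚ <ℚ half * ε
0<½* {ε} h = positive⁻¹ (half * ε) {{pos*pos⇒pos half ε {{positive h}}}}

Small-+ : ∀ {f g} → Small f → Small g → Small (λ N → f N + g N)
Small-+ {f} {g} sf sg ε 0<ε with sf (half * ε) (0<½* 0<ε) | sg (half * ε) (0<½* 0<ε)
... | N₁ , h₁ | N₂ , h₂ = N₁ ℕ.⊔ N₂ , λ N le →
  ≤-<-trans (∣p+q∣≤∣p∣+∣q∣ (f N) (g N))
    (subst (∣ f N ∣ + ∣ g N ∣ <ℚ_) (solve 1 (λ e → con half :* e :+ con half :* e := e) refl ε)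
      (+-mono-< (h₁ N (ℕP.m⊔n≤o⇒m≤o N₁ N₂ le)) (h₂ N (ℕP.m⊔n≤o⇒n≤o N₁ N₂ le))))

Small-* : ∀ c {f} → Small f → Small (λ N → c * f N)
Small-* c {f} sf ε 0<ε = N₀ , bound
  where
  d : ℚ
  -- Adding 1 keeps `d` positive when `c` is zero, so one choice of `δ` serves every `c`.
  d = 1ℚ + ∣ c ∣
  d-pos : Positive d
  d-pos = pos+nonNeg⇒pos 1ℚ ∣ c ∣ {{∣-∣-nonNeg c}}
  instance
    d≢0 : NonZero d
    d≢0 = pos⇒nonZero d {{d-pos}}
  δ : ℚ
  δ = ε * 1/ d
  0<δ : 0ℚ <ℚ δ
  0<δ = positive⁻¹ δ {{pos*pos⇒pos ε {{positive 0<ε}} (1/ d) {{1/pos⇒pos d {{d-pos}}}}}}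
  N₀ : ℕ
  N₀ = proj₁ (sf δ 0<δ)
  bound : ∀ N → N₀ ≤ N → ∣ c * f N ∣ <ℚ ε
  bound N le = begin-strict
    ∣ c * f N ∣      ≡⟨ ∣p*q∣≡∣p∣*∣q∣ c (f N) ⟩
    ∣ c ∣ * ∣ f N ∣  ≤⟨ *-monoʳ-≤-nonNeg ∣ f N ∣ {{∣-∣-nonNeg (f N)}} (≤-from-diff {∣ c ∣} {d} (subst (0ℚ ≤ℚ_) (solve 1 (λ x → con 1ℚ := con 1ℚ :+ x :- x) refl ∣ c ∣) (nonNegative⁻¹ 1ℚ))) ⟩
    d * ∣ f N ∣      <⟨ *-monoʳ-<-pos d {{d-pos}} (proj₂ (sf δ 0<δ) N le) ⟩
    d * δ            ≡⟨ solve 3 (λ d e i → d :* (e :* i) := e :* (d :* i)) refl d ε (1/ d) ⟩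
    ε * (d * 1/ d)   ≡⟨ cong (ε *_) (*-inverseʳ d) ⟩
    ε * 1ℚ           ≡⟨ *-identityʳ ε ⟩
    ε ∎
    where open ≤-Reasoning

Small-neg : ∀ {f} → Small f → Small (λ N → - f N)
Small-neg {f} sf = Small-cong (λ N → solve 1 (λ x → con (- 1ℚ) :* x := :- x) refl (f N)) (Small-* (- 1ℚ) sf)

Small-div : ∀ c {f} → .{{NonZero c}} → Small (λ N → c * f N) → Small f
Small-div c {f} s = Small-cong (λ N → trans (sym (*-assoc (1/ c) c (f N))) (trans (cong (_* f N) (*-inverseˡ c)) (*-identityˡ (f N)))) (Small-* (1/ c) s)

eval : ℕ → (ℕ → ℚ) → ℚ → ℚ
eval zero    p t = 0ℚ
eval (suc d) p t = p 0 + t * eval d (λ i → p (suc i)) t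

-- The i-th coefficient of (p(t) - p(t₀)) / (t - t₀), where p has d + 1 coefficients.
quo : ℕ → (ℕ → ℚ) → ℚ → ℕ → ℚ
quo zero    p t₀ i       = 0ℚ
quo (suc d) p t₀ zero    = eval (suc d) (λ i → p (suc i)) t₀
quo (suc d) p t₀ (suc i) = quo d (λ i → p (suc i)) t₀ i

eval-quo : ∀ d p t₀ t → eval (suc d) p t - eval (suc d) p t₀ ≡ (t - t₀) * eval d (quo d p t₀) t
eval-quo zero p t₀ t = solve 3 (λ p t t₀ → p :+ t :* con 0ℚ :- (p :+ t₀ :* con 0ℚ) := (t :- t₀) :* con 0ℚ) refl (p 0) t t₀
eval-quo (suc d) p t₀ t = begin
  (p 0 + t * e) - (p 0 + t₀ * e₀)            ≡⟨ solve 5 (λ p t t₀ e e₀ → p :+ t :* e :- (p :+ t₀ :* e₀) := (t :- t₀) :* e₀ :+ t :* (e :- e₀)) refl (p 0) t t₀ e e₀ ⟩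
  (t - t₀) * e₀ + t * (e - e₀)               ≡⟨ cong (λ x → (t - t₀) * e₀ + t * x) (eval-quo d p′ t₀ t) ⟩
  (t - t₀) * e₀ + t * ((t - t₀) * r)         ≡⟨ solve 4 (λ t t₀ e₀ r → (t :- t₀) :* e₀ :+ t :* ((t :- t₀) :* r) := (t :- t₀) :* (e₀ :+ t :* r)) refl t t₀ e₀ r ⟩
  (t - t₀) * (e₀ + t * r) ∎
  where
  open ≡-Reasoning
  p′ : ℕ → ℚ
  p′ i = p (suc i)
  e e₀ r : ℚ
  e = eval (suc d) p′ t
  e₀ = eval (suc d) p′ t₀
  r = eval d (quo d p′ t₀) t

quo-step : ∀ d p t₀ i → i < d → quo (suc d) p t₀ i ≡ p (suc i) + t₀ * quo (suc d) p t₀ (suc i)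
quo-step (suc d) p t₀ zero    _         = refl
quo-step (suc d) p t₀ (suc i) (s≤s lt) = quo-step d (λ i → p (suc i)) t₀ i lt

quo-top : ∀ d p t₀ → quo (suc d) p t₀ d ≡ p (suc d)
quo-top zero p t₀ = solve 2 (λ p t → p :+ t :* con 0ℚ := p) refl (p 1) t₀
quo-top (suc d) p t₀ = quo-top d (λ i → p (suc i)) t₀

-- Induction on the degree by synthetic division at the first node. The quotients are null at the
-- remaining nodes, hence have null coefficients, and those of `p N` are recovered through
-- `p (i+1) = q i - t₀ q (i+1)`. This takes the place of inverting a Vandermonde matrix.
interpolation : ∀ d (p : ℕ → ℕ → ℚ) (t : ℕ → ℚ) → (∀ {i j} → i < j → t i <ℚ t j) →
  (∀ k → Small (λ N → eval (suc d) (p N) (t k))) → ∀ i → i < suc d → Small (λ N → p N i)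
interpolation zero p t t-mono sm zero _ =
  Small-cong (λ N → solve 2 (λ p t → p :+ t :* con 0ℚ := p) refl (p N 0) (t 0)) (sm 0)
interpolation zero p t t-mono sm (suc i) (s≤s ())
interpolation (suc d) p t t-mono sm = coeff
  where
  t₀ : ℚ
  t₀ = t 0
  q : ℕ → ℕ → ℚ
  q N = quo (suc d) (p N) t₀
  sm-q : ∀ k → Small (λ N → eval (suc d) (q N) (t (suc k)))
  sm-q k = Small-div (t (suc k) - t₀) {{pos⇒nonZero (t (suc k) - t₀) {{positive (<⇒0<diff (t-mono (s≤s z≤n)))}}}}
    (Small-cong (λ N → eval-quo (suc d) (p N) t₀ (t (suc k))) (Small-+ (sm (suc k)) (Small-neg (sm 0))))
  coeff-q : ∀ i → i < suc d → Small (λ N → q N i)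
  coeff-q = interpolation d q (λ k → t (suc k)) (λ lt → t-mono (s≤s lt)) sm-q
  coeff-suc : ∀ i → i < suc d → Small (λ N → p N (suc i))
  coeff-suc i lt = [ lower , top ]′ (ℕP.m<1+n⇒m<n∨m≡n lt)
    where
    top : i ≡ d → Small (λ N → p N (suc i))
    top i≡d = Small-cong (λ N → trans (cong (q N) i≡d) (trans (quo-top d (p N) t₀) (cong (λ j → p N (suc j)) (sym i≡d)))) (coeff-q i lt)
    lower : i < d → Small (λ N → p N (suc i))
    lower i<d = Small-cong
      (λ N → trans (cong (_+ - (t₀ * q N (suc i))) (quo-step d (p N) t₀ i i<d))
        (solve 3 (λ p t q → p :+ t :* q :+ :- (t :* q) := p) refl (p N (suc i)) t₀ (q N (suc i))))
      (Small-+ (coeff-q i lt) (Small-neg (Small-* t₀ (coeff-q (suc i) (s≤s i<d)))))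
  coeff : ∀ i → i < suc (suc d) → Small (λ N → p N i)
  coeff (suc i) (s≤s lt) = coeff-suc i lt
  coeff zero _ = Small-cong
    (λ N → trans (cong (λ x → eval (suc (suc d)) (p N) t₀ + - (t₀ * x)) refl)
      (solve 3 (λ p t q → p :+ t :* q :+ :- (t :* q) := p) refl (p N 0) t₀ (q N 0)))
    (Small-+ (sm 0) (Small-neg (Small-* t₀ (coeff-q 0 (s≤s z≤n)))))

-- Formal power series over ℚ

Series : Set
Series = ℕ → ℚ

infix 4 _≈_
record _≈_ (f g : Series) : Set where
  constructor pointwise
  field at : ∀ n → f n ≡ g n
open _≈_

infixl 6 _⊕_ _⊖_
infixl 7 _⊛_ _·_
infix 8 ⊝_

tail : Series → Series
tail f n = f (suc n)

≈-refl : ∀ {f} → f ≈ f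
≈-refl = pointwise λ _ → refl

≈-sym : ∀ {f g} → f ≈ g → g ≈ f
≈-sym h = pointwise λ n → sym (at h n)

≈-trans : ∀ {f g h} → f ≈ g → g ≈ h → f ≈ h
≈-trans p q = pointwise λ n → trans (at p n) (at q n)

opaque
  const : ℚ → Series
  const p zero    = p
  const p (suc n) = 0ℚ

  -- linear β is the series βx.
  linear : ℚ → Series
  linear β zero    = 0ℚ
  linear β (suc n) = const β n

  _⊕_ : Series → Series → Series
  (f ⊕ g) n = f n + g n

  ⊝_ : Series → Series
  (⊝ f) n = - f n

  _·_ : ℚ → Series → Series
  (p · f) n = p * f n

  _⊛_ : Series → Series → Series
  (f ⊛ g) zero    = f 0 * g 0
  (f ⊛ g) (suc n) = f 0 * g (suc n) + (tail f ⊛ g) n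

  ⊕-cong : ∀ {f f′ g g′} → f ≈ f′ → g ≈ g′ → f ⊕ g ≈ f′ ⊕ g′
  ⊕-cong p q = pointwise λ n → cong₂ _+_ (at p n) (at q n)

  ⊝-cong : ∀ {f g} → f ≈ g → ⊝ f ≈ ⊝ g
  ⊝-cong p = pointwise λ n → cong -_ (at p n)

  tail-cong : ∀ {f g} → f ≈ g → tail f ≈ tail g
  tail-cong p = pointwise λ n → at p (suc n)

  ⊛-cong-at : ∀ n {f f′ g g′} → f ≈ f′ → g ≈ g′ → (f ⊛ g) n ≡ (f′ ⊛ g′) n
  ⊛-cong-at zero p q    = cong₂ _*_ (at p 0) (at q 0)
  ⊛-cong-at (suc n) p q = cong₂ _+_ (cong₂ _*_ (at p 0) (at q (suc n))) (⊛-cong-at n (tail-cong p) q)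

  ⊛-cong : ∀ {f f′ g g′} → f ≈ f′ → g ≈ g′ → f ⊛ g ≈ f′ ⊛ g′
  ⊛-cong p q = pointwise λ n → ⊛-cong-at n p q

  -- The product is defined by recursion on the first factor; this is the recursion on the second,
  -- and the two together give commutativity.
  ⊛-last : ∀ n f g → (f ⊛ g) (suc n) ≡ f (suc n) * g 0 + (f ⊛ tail g) n
  ⊛-last zero f g = +-comm (f 0 * g 1) (f 1 * g 0)
  ⊛-last (suc n) f g = begin
    f 0 * g (suc (suc n)) + (tail f ⊛ g) (suc n)
      ≡⟨ cong (f 0 * g (suc (suc n)) +_) (⊛-last n (tail f) g) ⟩
    f 0 * g (suc (suc n)) + (f (suc (suc n)) * g 0 + (tail f ⊛ tail g) n)
      ≡⟨ solve 3 (λ x y z → x :+ (y :+ z) := y :+ (x :+ z)) refl (f 0 * g (suc (suc n))) (f (suc (suc n)) * g 0) ((tail f ⊛ tail g) n) ⟩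
    f (suc (suc n)) * g 0 + (f ⊛ tail g) (suc n) ∎
    where open ≡-Reasoning

  ⊛-comm-at : ∀ n f g → (f ⊛ g) n ≡ (g ⊛ f) n
  ⊛-comm-at zero f g    = *-comm (f 0) (g 0)
  ⊛-comm-at (suc n) f g = trans (cong₂ _+_ (*-comm (f 0) (g (suc n))) (⊛-comm-at n (tail f) g)) (sym (⊛-last n g f))

  ⊛-comm : ∀ f g → f ⊛ g ≈ g ⊛ f
  ⊛-comm f g = pointwise λ n → ⊛-comm-at n f g

  ⊛-distribʳ-at : ∀ n h f g → ((f ⊕ g) ⊛ h) n ≡ (f ⊛ h) n + (g ⊛ h) n
  ⊛-distribʳ-at zero h f g    = *-distribʳ-+ (h 0) (f 0) (g 0)
  ⊛-distribʳ-at (suc n) h f g = trans (cong ((f 0 + g 0) * h (suc n) +_) (⊛-distribʳ-at n h (tail f) (tail g)))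
    (solve 5 (λ a b c x y → (a :+ b) :* c :+ (x :+ y) := a :* c :+ x :+ (b :* c :+ y)) refl
      (f 0) (g 0) (h (suc n)) ((tail f ⊛ h) n) ((tail g ⊛ h) n))

  ⊛-distribʳ : ∀ h f g → (f ⊕ g) ⊛ h ≈ f ⊛ h ⊕ g ⊛ h
  ⊛-distribʳ h f g = pointwise λ n → ⊛-distribʳ-at n h f g

  ⊛-scale-at : ∀ n p f g → ((p · f) ⊛ g) n ≡ p * (f ⊛ g) n
  ⊛-scale-at zero p f g    = *-assoc p (f 0) (g 0)
  ⊛-scale-at (suc n) p f g = trans (cong (p * f 0 * g (suc n) +_) (⊛-scale-at n p (tail f) g))
    (solve 4 (λ p a b c → p :* a :* b :+ p :* c := p :* (a :* b :+ c)) refl p (f 0) (g (suc n)) ((tail f ⊛ g) n))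

  ⊛-assoc-at : ∀ n f g h → ((f ⊛ g) ⊛ h) n ≡ (f ⊛ (g ⊛ h)) n
  ⊛-assoc-at zero f g h    = *-assoc (f 0) (g 0) (h 0)
  ⊛-assoc-at (suc n) f g h = begin
    f 0 * g 0 * h (suc n) + ((f 0 · tail g ⊕ tail f ⊛ g) ⊛ h) n
      ≡⟨ cong (f 0 * g 0 * h (suc n) +_) (trans (⊛-distribʳ-at n h (f 0 · tail g) (tail f ⊛ g))
           (cong₂ _+_ (⊛-scale-at n (f 0) (tail g) h) (⊛-assoc-at n (tail f) g h))) ⟩
    f 0 * g 0 * h (suc n) + (f 0 * (tail g ⊛ h) n + (tail f ⊛ (g ⊛ h)) n)
      ≡⟨ solve 5 (λ a b c x y → a :* b :* c :+ (a :* x :+ y) := a :* (b :* c :+ x) :+ y) refl (f 0) (g 0) (h (suc n)) ((tail g ⊛ h) n) ((tail f ⊛ (g ⊛ h)) n) ⟩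
    f 0 * (g 0 * h (suc n) + (tail g ⊛ h) n) + (tail f ⊛ (g ⊛ h)) n ∎
    where open ≡-Reasoning

  ⊛-zeroˡ-at : ∀ n f → ((λ _ → 0ℚ) ⊛ f) n ≡ 0ℚ
  ⊛-zeroˡ-at zero f    = *-zeroˡ (f 0)
  ⊛-zeroˡ-at (suc n) f = trans (cong₂ _+_ (*-zeroˡ (f (suc n))) (⊛-zeroˡ-at n f)) (+-identityˡ 0ℚ)

  const-⊛ : ∀ p f → const p ⊛ f ≈ p · f
  const-⊛ p f = pointwise λ { zero → refl
    ; (suc n) → trans (cong (p * f (suc n) +_) (⊛-zeroˡ-at n f)) (+-identityʳ (p * f (suc n))) }

  linear-⊛-suc : ∀ β f n → (linear β ⊛ f) (suc n) ≡ β * f n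
  linear-⊛-suc β f n = trans (cong₂ _+_ (*-zeroˡ (f (suc n))) (at (const-⊛ β f) n)) (+-identityˡ (β * f n))

  const-0 : ∀ n → const 0ℚ n ≡ 0ℚ
  const-0 zero    = refl
  const-0 (suc n) = refl

  ⊕-identityˡ : ∀ f → const 0ℚ ⊕ f ≈ f
  ⊕-identityˡ f = pointwise λ n → trans (cong (_+ f n) (const-0 n)) (+-identityˡ (f n))

  ⊕-assoc : ∀ f g h → f ⊕ g ⊕ h ≈ f ⊕ (g ⊕ h)
  ⊕-assoc f g h = pointwise λ n → +-assoc (f n) (g n) (h n)

  ⊕-comm : ∀ f g → f ⊕ g ≈ g ⊕ f
  ⊕-comm f g = pointwise λ n → +-comm (f n) (g n)

  ⊕-inverseˡ : ∀ f → ⊝ f ⊕ f ≈ const 0ℚ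
  ⊕-inverseˡ f = pointwise λ n → trans (+-inverseˡ (f n)) (sym (const-0 n))

  ⊛-assoc : ∀ f g h → f ⊛ g ⊛ h ≈ f ⊛ (g ⊛ h)
  ⊛-assoc f g h = pointwise λ n → ⊛-assoc-at n f g h

  ⊛-identityˡ : ∀ f → const 1ℚ ⊛ f ≈ f
  ⊛-identityˡ f = ≈-trans (const-⊛ 1ℚ f) (pointwise λ n → *-identityˡ (f n))

  const-neg : ∀ p → const (- p) ≈ ⊝ const p
  const-neg p = pointwise λ { zero → refl ; (suc n) → refl }

  const-zero : ∀ p → const p 0 ≡ p
  const-zero p = refl

  const-suc : ∀ p n → const p (suc n) ≡ 0ℚ
  const-suc p n = refl

  linear-zero : ∀ β → linear β 0 ≡ 0ℚ
  linear-zero β = refl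

  linear-suc : ∀ β n → linear β (suc n) ≡ const β n
  linear-suc β n = refl

  ⊕-at : ∀ f g n → (f ⊕ g) n ≡ f n + g n
  ⊕-at f g n = refl

  ⊝-at : ∀ f n → (⊝ f) n ≡ - f n
  ⊝-at f n = refl

  ⊛-zero : ∀ f g → (f ⊛ g) 0 ≡ f 0 * g 0
  ⊛-zero f g = refl

  ⊛-suc : ∀ f g n → (f ⊛ g) (suc n) ≡ f 0 * g (suc n) + (tail f ⊛ g) n
  ⊛-suc f g n = refl

  const-⊛-at : ∀ p f n → (const p ⊛ f) n ≡ p * f n
  const-⊛-at p f n = at (const-⊛ p f) n

  linear-⊛-zero : ∀ β f → (linear β ⊛ f) 0 ≡ 0ℚ
  linear-⊛-zero β f = *-zeroˡ (f 0)

  const-⊕ : ∀ p q → const (p + q) ≈ const p ⊕ const q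
  const-⊕ p q = pointwise λ { zero → refl ; (suc n) → refl }

  const-⊛-const : ∀ p q → const (p * q) ≈ const p ⊛ const q
  const-⊛-const p q = ≈-sym (≈-trans (const-⊛ p (const q)) (pointwise λ { zero → refl ; (suc n) → *-zeroʳ p }))

_⊖_ : Series → Series → Series
f ⊖ g = f ⊕ ⊝ g

≈-isEquivalence : IsEquivalence _≈_
≈-isEquivalence = record { refl = ≈-refl ; sym = ≈-sym ; trans = ≈-trans }

seriesRing : CommutativeRing 0ℓ 0ℓ
seriesRing = record
  { Carrier = Series ; _≈_ = _≈_ ; _+_ = _⊕_ ; _*_ = _⊛_ ; -_ = ⊝_ ; 0# = const 0ℚ ; 1# = const 1ℚ
  ; isCommutativeRing = record
    { isRing = record
      { +-isAbelianGroup = record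
        { isGroup = record
          { isMonoid = record
            { isSemigroup = record
              { isMagma = record { isEquivalence = ≈-isEquivalence ; ∙-cong = ⊕-cong }
              ; assoc = ⊕-assoc }
            ; identity = ⊕-identityˡ , λ f → ≈-trans (⊕-comm f (const 0ℚ)) (⊕-identityˡ f) }
          ; inverse = ⊕-inverseˡ , λ f → ≈-trans (⊕-comm f (⊝ f)) (⊕-inverseˡ f)
          ; ⁻¹-cong = ⊝-cong }
        ; comm = ⊕-comm }
      ; *-cong = ⊛-cong
      ; *-assoc = ⊛-assoc
      ; *-identity = ⊛-identityˡ , λ f → ≈-trans (⊛-comm f (const 1ℚ)) (⊛-identityˡ f)
      ; distrib = (λ h f g → ≈-trans (⊛-comm h (f ⊕ g)) (≈-trans (⊛-distribʳ h f g) (⊕-cong (⊛-comm f h) (⊛-comm g h))))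
                , ⊛-distribʳ }
    ; *-comm = ⊛-comm } }

-- Coefficients from ℚ let the solver handle identities that contain `half`.
constMorphism : CommutativeRing.rawRing +-*-commutativeRing ACR.-Raw-AlmostCommutative⟶ ACR.fromCommutativeRing seriesRing
constMorphism = record
  { ⟦_⟧ = const ; +-homo = const-⊕ ; *-homo = const-⊛-const
  ; -‿homo = const-neg
  ; 0-homo = ≈-refl ; 1-homo = ≈-refl }

const-≟ : ∀ p q → Maybe (const p ≈ const q)
const-≟ p q with p ≟ q
... | yes refl = just ≈-refl
... | no _     = nothing

module SeriesSolver = Algebra.Solver.Ring _ (ACR.fromCommutativeRing seriesRing) constMorphism const-≟

module S = SeriesSolver

-- The WZ pair

-- Division-free use of an inverse: `h` is the cofactor of the relation `u = 1`. Applied repeatedly,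
-- it reduces an identity between quotients to a polynomial identity modulo relations "denominator
-- times inverse is 1", which the solver checks once the cofactors are supplied.
cancel : ∀ {f g} h {u} → u ≈ const 1ℚ → f ≈ g ⊕ h ⊛ (u ⊖ const 1ℚ) → f ≈ g
cancel {f} {g} h {u} u≈1 f≈ = ≈-trans f≈ (≈-trans
  (⊕-cong ≈-refl (⊛-cong (≈-refl {h}) (⊕-cong u≈1 ≈-refl)))
  (S.solve 2 (λ g h → g S.:+ h S.:* (S.con 1ℚ S.:- S.con 1ℚ) S.:= g) ≈-refl g h))

-- Numerals are built by adding 1 so that the solver can read `K (suc m)` as `K m` plus a constant.
K : ℕ → Series
K zero    = const 0ℚ
K (suc m) = K m ⊕ const 1ℚ

K≈ : ∀ m → K m ≈ const (ℕ→ℚ m)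
K≈ zero    = ≈-refl
K≈ (suc m) = ≈-trans (⊕-cong (K≈ m) ≈-refl) (≈-trans (≈-sym (const-⊕ (ℕ→ℚ m) 1ℚ))
  (pointwise λ n → cong (λ p → const p n) (trans (+-comm (ℕ→ℚ m) 1ℚ) (sym (ℕ→ℚ-+ 1 m)))))

K-+ : ∀ m n → K (m ℕ.+ n) ≈ K m ⊕ K n
K-+ zero n    = S.solve 1 (λ k → k S.:= S.con 0ℚ S.:+ k) ≈-refl (K n)
K-+ (suc m) n = ≈-trans (⊕-cong (K-+ m n) ≈-refl)
  (S.solve 2 (λ k l → k S.:+ l S.:+ S.con 1ℚ S.:= k S.:+ S.con 1ℚ S.:+ l) ≈-refl (K m) (K n))

linear-+ : ∀ β γ → linear (β + γ) ≈ linear β ⊕ linear γ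
linear-+ β γ = pointwise λ
  { zero    → trans (linear-zero (β + γ)) (sym (trans (⊕-at (linear β) (linear γ) 0) (cong₂ _+_ (linear-zero β) (linear-zero γ))))
  ; (suc n) → trans (linear-suc (β + γ) n) (trans (at (const-⊕ β γ) n) (trans (⊕-at (const β) (const γ) n)
      (sym (trans (⊕-at (linear β) (linear γ) (suc n)) (cong₂ _+_ (linear-suc β n) (linear-suc γ n)))))) }

-- geom β j is the series 1 / (j + 1 - βx).
geom : ℚ → ℕ → Series
geom β j zero    = recip j
geom β j (suc n) = recip j * (β * geom β j n)

-- Free of subtraction, and therefore the form in which norms of both sides can be compared, as in
-- `Bounded-geom`.
geom-step : ∀ β j → K (suc j) ⊛ geom β j ≈ const 1ℚ ⊕ linear β ⊛ geom β j
geom-step β j = ≈-trans (⊛-cong (K≈ (suc j)) ≈-refl) (pointwise λ n → trans (const-⊛-at (ℕ→ℚ (suc j)) (geom β j) n) (step n))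
  where
  open ≡-Reasoning
  step : ∀ n → ℕ→ℚ (suc j) * geom β j n ≡ (const 1ℚ ⊕ linear β ⊛ geom β j) n
  step zero = begin
    ℕ→ℚ (suc j) * recip j                  ≡⟨ recip-inverse j ⟩
    1ℚ + 0ℚ                                ≡⟨ cong₂ _+_ (const-zero 1ℚ) (linear-⊛-zero β (geom β j)) ⟨
    const 1ℚ 0 + (linear β ⊛ geom β j) 0   ≡⟨ ⊕-at (const 1ℚ) (linear β ⊛ geom β j) 0 ⟨
    (const 1ℚ ⊕ linear β ⊛ geom β j) 0     ∎
  step (suc n) = begin
    ℕ→ℚ (suc j) * (recip j * (β * g))      ≡⟨ *-assoc (ℕ→ℚ (suc j)) (recip j) (β * g) ⟨
    ℕ→ℚ (suc j) * recip j * (β * g)        ≡⟨ cong (_* (β * g)) (recip-inverse j) ⟩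
    1ℚ * (β * g)                           ≡⟨ trans (*-identityˡ (β * g)) (sym (+-identityˡ (β * g))) ⟩
    0ℚ + β * g                             ≡⟨ cong₂ _+_ (const-suc 1ℚ n) (linear-⊛-suc β (geom β j) n) ⟨
    const 1ℚ (suc n) + (linear β ⊛ geom β j) (suc n) ≡⟨ ⊕-at (const 1ℚ) (linear β ⊛ geom β j) (suc n) ⟨
    (const 1ℚ ⊕ linear β ⊛ geom β j) (suc n) ∎
    where
    g : ℚ
    g = geom β j n

geom-inverse : ∀ β j → (K (suc j) ⊖ linear β) ⊛ geom β j ≈ const 1ℚ
geom-inverse β j = ≈-trans
  (S.solve 3 (λ k b g → (k S.:- b) S.:* g S.:= k S.:* g S.:- b S.:* g) ≈-refl (K (suc j)) (linear β) (geom β j))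
  (≈-trans (⊕-cong (geom-step β j) ≈-refl)
  (S.solve 2 (λ o x → o S.:+ x S.:- x S.:= o) ≈-refl (const 1ℚ) (linear β ⊛ geom β j)))

-- In Pochhammer symbols, `A β m` is (b)_m / (1-b)_m with b = βx, and `B γ n m` below is (c)_m /
-- (1-c)_m with c = γx - n.
A : ℚ → ℕ → Series
A β zero    = const 1ℚ
A β (suc m) = A β m ⊛ (K m ⊕ linear β) ⊛ geom β m

B : ℚ → ℕ → ℕ → Series
B γ n zero    = const 1ℚ
B γ n (suc m) = B γ n m ⊛ (K m ⊖ K n ⊕ linear γ) ⊛ geom γ (m ℕ.+ n)

-- F β γ n j and G β γ n j are the entries (m, n) of the WZ pair with m = j + 1, b = βx and c = γx - n.
F : ℚ → ℚ → ℕ → ℕ → Series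
F β γ n j = const (recip j) ⊛ A β (suc j) ⊛ B γ n (suc j)

G : ℚ → ℚ → ℕ → ℕ → Series
G β γ n j = const half ⊛ geom (β + γ) n ⊛ (A β j ⊛ (K j ⊕ linear β)) ⊛ (B γ n j ⊛ geom γ (j ℕ.+ n))

-- With c = γx - n and `e` = 1 - c, one has (c-1)_(j+1) = -e (c)_j and (2-c)_(j+1) = (1-c)_j
-- (j+1-c)(j+2-c) / e. Both rows of the pair are thereby expressed through `B γ n j`.
B-shift : ∀ γ n j → let e = K (suc n) ⊖ linear γ in
  B γ (suc n) (suc j) ≈ ⊝ (e ⊛ e ⊛ B γ n j ⊛ geom γ (j ℕ.+ n) ⊛ geom γ (suc j ℕ.+ n))
B-shift γ n zero = cancel ((K (suc n) ⊖ linear γ) ⊛ geom γ (suc n)) (geom-inverse γ n)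
  (S.solve 4 (λ k c g g′ → S.con 1ℚ S.:* (S.con 0ℚ S.:- k S.:+ c) S.:* g′ S.:=
       S.:- ((k S.:- c) S.:* (k S.:- c) S.:* S.con 1ℚ S.:* g S.:* g′)
         S.:+ (k S.:- c) S.:* g′ S.:* ((k S.:- c) S.:* g S.:- S.con 1ℚ))
    ≈-refl (K (suc n)) (linear γ) (geom γ n) (geom γ (suc n)))
B-shift γ n (suc j) = ≈-trans
  (⊛-cong (⊛-cong (B-shift γ n j) ≈-refl) (pointwise λ i → cong (λ l → geom γ l i) (ℕP.+-suc (suc j) n)))
  (S.solve 7 (λ kj kn c b g₁ g₂ g₃ →
      let e = kn S.:+ S.con 1ℚ S.:- c ; m = kj S.:+ S.con 1ℚ S.:- (kn S.:+ S.con 1ℚ) S.:+ c in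
      S.:- (e S.:* e S.:* b S.:* g₁ S.:* g₂) S.:* m S.:* g₃ S.:=
      S.:- (e S.:* e S.:* (b S.:* (kj S.:- kn S.:+ c) S.:* g₁) S.:* g₂ S.:* g₃))
    ≈-refl (K j) (K n) (linear γ) (B γ n j) (geom γ (j ℕ.+ n)) (geom γ (suc j ℕ.+ n)) (geom γ (suc (suc j) ℕ.+ n)))

const-cong : ∀ {p q} → p ≡ q → const p ≈ const q
const-cong refl = ≈-refl

K-recip : ∀ j → K (suc j) ⊛ const (recip j) ≈ const 1ℚ
K-recip j = ≈-trans (⊛-cong (K≈ (suc j)) ≈-refl) (≈-trans (≈-sym (const-⊛-const (ℕ→ℚ (suc j)) (recip j))) (const-cong (recip-inverse j)))

-- With `T`, `m`, `b`, `e` as below, both sides equal `- m T / ((m - b)(m + e))`. On the left this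
-- is `e² + (m + e)(m - e) = m²`; on the right it is `(m + b)(m - e) - (m - b)(m + e) = -2m(e -
-- b)`, where `e - b` cancels the factor `geom (β + γ) n`.
wz : ∀ β γ n j → F β γ (suc n) j ⊖ F β γ n j ≈ G β γ n (suc j) ⊖ G β γ n j
wz β γ n j = ≈-trans
  (⊕-cong (⊛-cong ≈-refl (B-shift γ n j)) ≈-refl)
  -- The four relations state that `const r`, `g₂`, `i` and `a` invert `m`, `m + e`, `e - b` and
  -- `m - b`; the first argument of each `cancel` is the cofactor of its relation.
  (cancel (⊝ (T ⊛ a ⊛ g₂ ⊛ m)) (K-recip j)
  (cancel (T ⊛ a ⊛ (const r ⊛ (m ⊖ e) ⊖ const half ⊛ i ⊛ (m ⊖ b))) g₂-inv
  (cancel (T ⊛ a ⊛ g₂ ⊛ m) i-inv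
  (cancel (⊝ (const half ⊛ i ⊛ T)) (geom-inverse β j)
  (S.solve 11 (λ r Aj bj a g₁ g₂ i kj kn b c →
     let m = kj S.:+ S.con 1ℚ
         e = kn S.:+ S.con 1ℚ S.:- c
         T = Aj S.:* (kj S.:+ b) S.:* bj S.:* g₁
         A′ = Aj S.:* (kj S.:+ b) S.:* a
         n₁ = kj S.:- kn S.:+ c
         one = S.con 1ℚ
         h = S.con half
     in
     r S.:* A′ S.:* (S.:- (e S.:* e S.:* bj S.:* g₁ S.:* g₂)) S.:- r S.:* A′ S.:* (bj S.:* n₁ S.:* g₁)
     S.:=
     h S.:* i S.:* (A′ S.:* (m S.:+ b)) S.:* (bj S.:* n₁ S.:* g₁ S.:* g₂) S.:- h S.:* i S.:* (Aj S.:* (kj S.:+ b)) S.:* (bj S.:* g₁)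
     S.:+ S.:- (T S.:* a S.:* g₂ S.:* m) S.:* (m S.:* r S.:- one)
     S.:+ T S.:* a S.:* (r S.:* (m S.:- e) S.:- h S.:* i S.:* (m S.:- b)) S.:* ((m S.:+ e) S.:* g₂ S.:- one)
     S.:+ T S.:* a S.:* g₂ S.:* m S.:* ((e S.:- b) S.:* i S.:- one)
     S.:+ S.:- (h S.:* i S.:* T) S.:* ((m S.:- b) S.:* a S.:- one))
   ≈-refl (const r) (A β j) (B γ n j) a g₁ g₂ i (K j) (K n) b (linear γ))))))
  where
  r : ℚ
  r = recip j
  m b e a g₁ g₂ i T : Series
  m = K (suc j)
  b = linear β
  e = K (suc n) ⊖ linear γ
  a = geom β j
  g₁ = geom γ (j ℕ.+ n)
  g₂ = geom γ (suc j ℕ.+ n)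
  i = geom (β + γ) n
  T = A β j ⊛ (K j ⊕ b) ⊛ B γ n j ⊛ g₁
  g₂-inv : (m ⊕ e) ⊛ g₂ ≈ const 1ℚ
  g₂-inv = ≈-trans (⊛-cong (≈-trans
      (S.solve 3 (λ kj kn c → kj S.:+ S.con 1ℚ S.:+ (kn S.:+ S.con 1ℚ S.:- c) S.:= kj S.:+ kn S.:+ S.con 1ℚ S.:+ S.con 1ℚ S.:- c) ≈-refl (K j) (K n) (linear γ))
      (⊕-cong (⊕-cong (⊕-cong (≈-sym (K-+ j n)) ≈-refl) ≈-refl) ≈-refl)) ≈-refl)
    (geom-inverse γ (suc j ℕ.+ n))
  i-inv : (e ⊖ b) ⊛ i ≈ const 1ℚ
  i-inv = ≈-trans (⊛-cong (≈-trans
      (S.solve 3 (λ k b c → k S.:- c S.:- b S.:= k S.:- (b S.:+ c)) ≈-refl (K (suc n)) b (linear γ))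
      (⊕-cong ≈-refl (⊝-cong (≈-sym (linear-+ β γ))))) ≈-refl)
    (geom-inverse (β + γ) n)

-- Telescoping the pair over a rectangle

sumS : ℕ → (ℕ → Series) → Series
sumS zero f    = const 0ℚ
sumS (suc N) f = sumS N f ⊕ f N

sumS-cong : ∀ N {f g} → (∀ j → f j ≈ g j) → sumS N f ≈ sumS N g
sumS-cong zero h    = ≈-refl
sumS-cong (suc N) h = ⊕-cong (sumS-cong N h) (h N)

sumS-⊖ : ∀ N f g → sumS N (λ j → f j ⊖ g j) ≈ sumS N f ⊖ sumS N g
sumS-⊖ zero f g    = S.solve 0 (S.con 0ℚ S.:= S.con 0ℚ S.:- S.con 0ℚ) ≈-refl
sumS-⊖ (suc N) f g = ≈-trans (⊕-cong (sumS-⊖ N f g) ≈-refl)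
  (S.solve 4 (λ p q x y → p S.:- q S.:+ (x S.:- y) S.:= p S.:+ x S.:- (q S.:+ y)) ≈-refl (sumS N f) (sumS N g) (f N) (g N))

sumS-scale : ∀ N h f → sumS N (λ j → h ⊛ f j) ≈ h ⊛ sumS N f
sumS-scale zero h f    = S.solve 1 (λ h → S.con 0ℚ S.:= h S.:* S.con 0ℚ) ≈-refl h
sumS-scale (suc N) h f = ≈-trans (⊕-cong (sumS-scale N h f) ≈-refl)
  (S.solve 3 (λ h p x → h S.:* p S.:+ h S.:* x S.:= h S.:* (p S.:+ x)) ≈-refl h (sumS N f) (f N))

wz-row : ∀ β γ n N → sumS N (F β γ (suc n)) ⊖ sumS N (F β γ n) ≈ G β γ n N ⊖ G β γ n 0
wz-row β γ n zero    = S.solve 1 (λ g → S.con 0ℚ S.:- S.con 0ℚ S.:= g S.:- g) ≈-refl (G β γ n 0)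
wz-row β γ n (suc N) = ≈-trans
  (S.solve 4 (λ p q x y → p S.:+ x S.:- (q S.:+ y) S.:= p S.:- q S.:+ (x S.:- y)) ≈-refl
    (sumS N (F β γ (suc n))) (sumS N (F β γ n)) (F β γ (suc n) N) (F β γ n N))
  (≈-trans (⊕-cong (wz-row β γ n N) (wz β γ n N))
  (S.solve 3 (λ x y z → x S.:- y S.:+ (z S.:- x) S.:= z S.:- y) ≈-refl (G β γ n N) (G β γ n 0) (G β γ n (suc N))))

wz-rectangle : ∀ β γ N M → sumS N (F β γ 0) ≈ sumS N (F β γ M) ⊕ (sumS M (λ n → G β γ n 0) ⊖ sumS M (λ n → G β γ n N))
wz-rectangle β γ N zero    = S.solve 1 (λ f → f S.:= f S.:+ (S.con 0ℚ S.:- S.con 0ℚ)) ≈-refl (sumS N (F β γ 0))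
wz-rectangle β γ N (suc M) = ≈-trans (wz-rectangle β γ N M)
  (≈-trans
    (S.solve 4 (λ f f′ p q → f S.:+ (p S.:- q) S.:= f′ S.:- (f′ S.:- f) S.:+ (p S.:- q)) ≈-refl
      (sumS N (F β γ M)) (sumS N (F β γ (suc M))) P Q)
  (≈-trans (⊕-cong (⊕-cong ≈-refl (⊝-cong (wz-row β γ M N))) ≈-refl)
  (S.solve 5 (λ f′ p q x y → f′ S.:- (y S.:- x) S.:+ (p S.:- q) S.:= f′ S.:+ (p S.:+ x S.:- (q S.:+ y))) ≈-refl
    (sumS N (F β γ (suc M))) P Q (G β γ M 0) (G β γ M N))))
  where
  P Q : Series
  P = sumS M (λ n → G β γ n 0)
  Q = sumS M (λ n → G β γ n N)

linear-0 : linear 0ℚ ≈ const 0ℚ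
linear-0 = pointwise λ { zero → trans (linear-zero 0ℚ) (sym (const-zero 0ℚ))
                       ; (suc n) → trans (linear-suc 0ℚ n) (trans (const-0 n) (sym (const-suc 0ℚ n))) }

-- The factor k = 0 of the product is c itself, here zero.
B-0 : ∀ j → B 0ℚ 0 (suc j) ≈ const 0ℚ
B-0 zero    = ≈-trans (⊛-cong (⊛-cong ≈-refl (⊕-cong ≈-refl linear-0)) ≈-refl)
  (S.solve 1 (λ g → S.con 1ℚ S.:* (S.con 0ℚ S.:- S.con 0ℚ S.:+ S.con 0ℚ) S.:* g S.:= S.con 0ℚ) ≈-refl (geom 0ℚ 0))
B-0 (suc j) = ≈-trans (⊛-cong (⊛-cong (B-0 j) ≈-refl) ≈-refl)
  (S.solve 2 (λ f g → S.con 0ℚ S.:* f S.:* g S.:= S.con 0ℚ) ≈-refl (K (suc j) ⊖ K 0 ⊕ linear 0ℚ) (geom 0ℚ (suc j ℕ.+ 0)))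

sumF-0 : ∀ β N → sumS N (F β 0ℚ 0) ≈ const 0ℚ
sumF-0 β zero    = ≈-refl
sumF-0 β (suc N) = ≈-trans (⊕-cong (sumF-0 β N) (⊛-cong ≈-refl (B-0 N)))
  (S.solve 1 (λ f → S.con 0ℚ S.:+ f S.:* S.con 0ℚ S.:= S.con 0ℚ) ≈-refl (const (recip N) ⊛ A β (suc N)))

-- Partial fractions for `b / ((k - b - c)(k - c))` with k = n + 1: the numerator is the difference
-- of the two denominators.
G-0 : ∀ β γ n → G β γ n 0 ≈ const half ⊛ (geom (β + γ) n ⊖ geom γ n)
G-0 β γ n =
  cancel (const half ⊛ geom (β + γ) n) (geom-inverse γ n)
  (cancel (⊝ (const half ⊛ geom γ n)) s-inv
  (S.solve 5 (λ i g k b c → let h = S.con half in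
      h S.:* i S.:* (S.con 1ℚ S.:* (S.con 0ℚ S.:+ b)) S.:* (S.con 1ℚ S.:* g) S.:=
      h S.:* (i S.:- g) S.:+ h S.:* i S.:* ((k S.:- c) S.:* g S.:- S.con 1ℚ)
        S.:+ S.:- (h S.:* g) S.:* ((k S.:- (b S.:+ c)) S.:* i S.:- S.con 1ℚ))
    ≈-refl (geom (β + γ) n) (geom γ n) (K (suc n)) (linear β) (linear γ)))
  where
  s-inv : (K (suc n) ⊖ (linear β ⊕ linear γ)) ⊛ geom (β + γ) n ≈ const 1ℚ
  s-inv = ≈-trans (⊛-cong (⊕-cong ≈-refl (⊝-cong (≈-sym (linear-+ β γ)))) ≈-refl) (geom-inverse (β + γ) n)

mainTerm : ℚ → ℚ → ℕ → Series
mainTerm β γ n = const half ⊛ (geom (β + γ) n ⊖ geom γ n ⊖ (geom β n ⊖ geom 0ℚ n))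

errorF errorG : ℚ → ℚ → ℕ → Series
errorF β γ N = sumS N (λ j → F β γ N j ⊖ F β 0ℚ N j)
errorG β γ N = sumS N (λ n → G β γ n N ⊖ G β 0ℚ n N)

-- The rectangle identity for `γ` minus the one for 0, whose left side vanishes. On the edge `j = 0`
-- the difference is the main term; the edges `n = N` and `j = N` yield the errors.
sumF : ∀ β γ N → sumS N (F β γ 0) ≈ sumS N (mainTerm β γ) ⊕ (errorF β γ N ⊖ errorG β γ N)
sumF β γ N = ≈-trans
  (S.solve 1 (λ f → f S.:= f S.:- S.con 0ℚ) ≈-refl (sumS N (F β γ 0)))
  (≈-trans (⊕-cong (wz-rectangle β γ N N) (⊝-cong (≈-trans (≈-sym (sumF-0 β N)) (wz-rectangle β 0ℚ N N))))
  (≈-trans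
    (S.solve 6 (λ f p q f₀ p₀ q₀ → f S.:+ (p S.:- q) S.:- (f₀ S.:+ (p₀ S.:- q₀)) S.:= p S.:- p₀ S.:+ (f S.:- f₀ S.:- (q S.:- q₀))) ≈-refl
      (sumS N (F β γ N)) (sumS N (λ n → G β γ n 0)) (sumS N (λ n → G β γ n N))
      (sumS N (F β 0ℚ N)) (sumS N (λ n → G β 0ℚ n 0)) (sumS N (λ n → G β 0ℚ n N)))
  (⊕-cong
    (≈-trans (≈-sym (sumS-⊖ N (λ n → G β γ n 0) (λ n → G β 0ℚ n 0))) (sumS-cong N main))
    (⊕-cong (≈-sym (sumS-⊖ N (F β γ N) (F β 0ℚ N))) (⊝-cong (≈-sym (sumS-⊖ N (λ n → G β γ n N) (λ n → G β 0ℚ n N))))))))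
  where
  main : ∀ n → G β γ n 0 ⊖ G β 0ℚ n 0 ≈ mainTerm β γ n
  main n = ≈-trans (⊕-cong (G-0 β γ n) (⊝-cong (≈-trans (G-0 β 0ℚ n)
      (⊛-cong ≈-refl (⊕-cong (pointwise λ i → cong (λ β′ → geom β′ n i) (+-identityʳ β)) ≈-refl)))))
    (S.solve 4 (λ s c b o → let h = S.con half in h S.:* (s S.:- c) S.:- h S.:* (b S.:- o) S.:= h S.:* (s S.:- c S.:- (b S.:- o)))
      ≈-refl (geom (β + γ) n) (geom γ n) (geom β n) (geom 0ℚ n))

-- Coefficient norms and the error terms

partialNorm : ℕ → Series → ℚ
partialNorm zero    f = 0ℚ
partialNorm (suc d) f = ∣ f 0 ∣ + partialNorm d (tail f)

-- Bounded f C says that the ℓ¹ norm of the coefficient sequence of f is at most C.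
Bounded : Series → ℚ → Set
Bounded f C = ∀ d → partialNorm d f ≤ℚ C

partialNorm-cong : ∀ d {f g} → f ≈ g → partialNorm d f ≡ partialNorm d g
partialNorm-cong zero h    = refl
partialNorm-cong (suc d) h = cong₂ _+_ (cong ∣_∣ (at h 0)) (partialNorm-cong d (pointwise λ n → at h (suc n)))

0≤partialNorm : ∀ d f → 0ℚ ≤ℚ partialNorm d f
0≤partialNorm zero f    = ≤-refl
0≤partialNorm (suc d) f = 0≤+ (0≤∣p∣ (f 0)) (0≤partialNorm d (tail f))

partialNorm-suc : ∀ d f → partialNorm d f ≤ℚ partialNorm (suc d) f
partialNorm-suc zero f    = 0≤partialNorm 1 f
partialNorm-suc (suc d) f = +-monoʳ-≤ ∣ f 0 ∣ (partialNorm-suc d (tail f))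

partialNorm-+ : ∀ d {f g h : Series} → (∀ n → h n ≡ f n + g n) → partialNorm d h ≤ℚ partialNorm d f + partialNorm d g
partialNorm-+ zero eq            = ≤-refl
partialNorm-+ (suc d) {f} {g} {h} eq = begin
  ∣ h 0 ∣ + partialNorm d (tail h)
    ≤⟨ +-mono-≤ (subst (λ x → ∣ x ∣ ≤ℚ ∣ f 0 ∣ + ∣ g 0 ∣) (sym (eq 0)) (∣p+q∣≤∣p∣+∣q∣ (f 0) (g 0)))
                (partialNorm-+ d (λ n → eq (suc n))) ⟩
  ∣ f 0 ∣ + ∣ g 0 ∣ + (partialNorm d (tail f) + partialNorm d (tail g))
    ≡⟨ solve 4 (λ a b x y → a :+ b :+ (x :+ y) := a :+ x :+ (b :+ y)) refl ∣ f 0 ∣ ∣ g 0 ∣ (partialNorm d (tail f)) (partialNorm d (tail g)) ⟩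
  partialNorm (suc d) f + partialNorm (suc d) g ∎
  where open ≤-Reasoning

partialNorm-scale : ∀ d p {f g : Series} → (∀ n → g n ≡ p * f n) → partialNorm d g ≡ ∣ p ∣ * partialNorm d f
partialNorm-scale zero p eq = sym (*-zeroʳ ∣ p ∣)
partialNorm-scale (suc d) p {f} {g} eq = trans
  (cong₂ _+_ (trans (cong ∣_∣ (eq 0)) (∣p*q∣≡∣p∣*∣q∣ p (f 0))) (partialNorm-scale d p (λ n → eq (suc n))))
  (sym (*-distribˡ-+ ∣ p ∣ ∣ f 0 ∣ (partialNorm d (tail f))))

-- Submultiplicativity survives truncation because the first `d` coefficients of a product involve
-- only the first `d` of each factor. All norms thus remain finite sums.
partialNorm-⊛ : ∀ d f g → partialNorm d (f ⊛ g) ≤ℚ partialNorm d f * partialNorm d g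
partialNorm-⊛ zero f g    = ≤-reflexive (sym (*-zeroˡ 0ℚ))
partialNorm-⊛ (suc d) f g = begin
  ∣ (f ⊛ g) 0 ∣ + partialNorm d (tail (f ⊛ g))
    ≤⟨ +-mono-≤ (≤-reflexive (trans (cong ∣_∣ (⊛-zero f g)) (∣p*q∣≡∣p∣*∣q∣ (f 0) (g 0)))) (partialNorm-+ d (⊛-suc f g)) ⟩
  a * ∣ g 0 ∣ + (partialNorm d (λ n → f 0 * g (suc n)) + partialNorm d (tail f ⊛ g))
    ≤⟨ +-monoʳ-≤ (a * ∣ g 0 ∣) (+-mono-≤ (≤-reflexive (partialNorm-scale d (f 0) (λ _ → refl)))
         (≤-trans (partialNorm-⊛ d (tail f) g) (*-monoˡ-≤-nonNeg x {{nonNegative (0≤partialNorm d (tail f))}} (partialNorm-suc d g)))) ⟩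
  a * ∣ g 0 ∣ + (a * y + x * (∣ g 0 ∣ + y))
    ≡⟨ solve 4 (λ a b x y → a :* b :+ (a :* y :+ x :* (b :+ y)) := (a :+ x) :* (b :+ y)) refl a ∣ g 0 ∣ x y ⟩
  (a + x) * (∣ g 0 ∣ + y) ∎
  where
  open ≤-Reasoning
  a x y : ℚ
  a = ∣ f 0 ∣
  x = partialNorm d (tail f)
  y = partialNorm d (tail g)

coefficient-bound : ∀ n {f C} → Bounded f C → ∣ f n ∣ ≤ℚ C
coefficient-bound n {f} b = ≤-trans (lemma n f) (b (suc n))
  where
  lemma : ∀ n f → ∣ f n ∣ ≤ℚ partialNorm (suc n) f
  lemma zero f    = ≤-reflexive (sym (+-identityʳ ∣ f 0 ∣))
  lemma (suc n) f = subst (_≤ℚ ∣ f 0 ∣ + partialNorm (suc n) (tail f)) (+-identityˡ ∣ f (suc n) ∣)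
    (+-mono-≤ (0≤∣p∣ (f 0)) (lemma n (tail f)))

Bounded-≥0 : ∀ {f C} → Bounded f C → 0ℚ ≤ℚ C
Bounded-≥0 b = b 0

Bounded-≤ : ∀ {f C D} → C ≤ℚ D → Bounded f C → Bounded f D
Bounded-≤ le b d = ≤-trans (b d) le

Bounded-≈ : ∀ {f g C} → f ≈ g → Bounded f C → Bounded g C
Bounded-≈ {C = C} eq b d = subst (_≤ℚ C) (partialNorm-cong d eq) (b d)

Bounded-⊕ : ∀ {f g C D} → Bounded f C → Bounded g D → Bounded (f ⊕ g) (C + D)
Bounded-⊕ {f} {g} b c d = ≤-trans (partialNorm-+ d (⊕-at f g)) (+-mono-≤ (b d) (c d))

Bounded-⊝ : ∀ {f C} → Bounded f C → Bounded (⊝ f) C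
Bounded-⊝ {f} {C} b d = subst (_≤ℚ C) (sym (trans
  (partialNorm-scale d (- 1ℚ) (λ n → trans (⊝-at f n) (solve 1 (λ x → :- x := con (- 1ℚ) :* x) refl (f n))))
  (*-identityˡ (partialNorm d f)))) (b d)

Bounded-⊛ : ∀ {f g C D} → Bounded f C → Bounded g D → Bounded (f ⊛ g) (C * D)
Bounded-⊛ {f} {g} b c d = ≤-trans (partialNorm-⊛ d f g)
  (*-mono-≤-nn (Bounded-≥0 b) (0≤partialNorm d g) (b d) (c d))

partialNorm-0 : ∀ d {f : Series} → (∀ n → f n ≡ 0ℚ) → partialNorm d f ≡ 0ℚ
partialNorm-0 zero h    = refl
partialNorm-0 (suc d) h = trans (cong₂ _+_ (cong ∣_∣ (h 0)) (partialNorm-0 d (λ n → h (suc n)))) (+-identityˡ 0ℚ)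

Bounded-const : ∀ {p C} → ∣ p ∣ ≤ℚ C → Bounded (const p) C
Bounded-const {p} le zero    = ≤-trans (0≤∣p∣ p) le
Bounded-const {p} {C} le (suc d) = subst (_≤ℚ C)
  (sym (trans (cong₂ _+_ (cong ∣_∣ (const-zero p)) (partialNorm-0 d (const-suc p))) (+-identityʳ ∣ p ∣))) le

Bounded-linear : ∀ {β C} → ∣ β ∣ ≤ℚ C → Bounded (linear β) C
Bounded-linear {β} le zero    = ≤-trans (0≤∣p∣ β) le
Bounded-linear {β} {C} le (suc d) = subst (_≤ℚ C)
  (sym (trans (cong₂ _+_ (cong ∣_∣ (linear-zero β)) (partialNorm-cong d (pointwise (linear-suc β)))) (+-identityˡ (partialNorm d (const β)))))
  (Bounded-const le d)

Bounded-K : ∀ m → Bounded (K m) (ℕ→ℚ m)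
Bounded-K m = Bounded-≈ (≈-sym (K≈ m)) (Bounded-const (≤-reflexive (0≤p⇒∣p∣≡p (0≤ℕ→ℚ m))))

-- Norms in `geom-step` give `k s ≤ 1 + η s`, and `s`, a finite sum, may be moved to the left.
-- Asking for `1 ≤ (k - η) C` spares an inverse in the statement.
Bounded-geom : ∀ {β η C} j → ∣ β ∣ ≤ℚ η → 0ℚ <ℚ ℕ→ℚ (suc j) - η → 1ℚ ≤ℚ (ℕ→ℚ (suc j) - η) * C → Bounded (geom β j) C
Bounded-geom {β} {η} {C} j β≤η pos 1≤ d = *-cancelˡ-≤-pos (k - η) {{positive pos}} (≤-trans below 1≤)
  where
  open ≤-Reasoning
  k s : ℚ
  k = ℕ→ℚ (suc j)
  s = partialNorm d (geom β j)
  total : k * s ≤ℚ 1ℚ + η * s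
  total = begin
    k * s        ≡⟨ cong (_* s) (0≤p⇒∣p∣≡p (0≤ℕ→ℚ (suc j))) ⟨
    ∣ k ∣ * s    ≡⟨ partialNorm-scale d k (λ n → const-⊛-at k (geom β j) n) ⟨
    partialNorm d (const k ⊛ geom β j) ≡⟨ partialNorm-cong d (≈-trans (⊛-cong (≈-sym (K≈ (suc j))) ≈-refl) (geom-step β j)) ⟩
    partialNorm d (const 1ℚ ⊕ linear β ⊛ geom β j) ≤⟨ partialNorm-+ d (⊕-at (const 1ℚ) (linear β ⊛ geom β j)) ⟩
    partialNorm d (const 1ℚ) + partialNorm d (linear β ⊛ geom β j)
      ≤⟨ +-mono-≤ (Bounded-const {1ℚ} ≤-refl d) (≤-trans (partialNorm-⊛ d (linear β) (geom β j))
           (*-monoʳ-≤-nonNeg s {{nonNegative (0≤partialNorm d (geom β j))}} (Bounded-linear β≤η d))) ⟩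
    1ℚ + η * s ∎
  below : (k - η) * s ≤ℚ 1ℚ
  below = ≤-from-diff (subst (0ℚ ≤ℚ_) (solve 3 (λ k e s → con 1ℚ :+ e :* s :- k :* s := con 1ℚ :- (k :- e) :* s) refl k η s)
    (subst (_≤ℚ 1ℚ + η * s - k * s) (+-inverseʳ (k * s)) (+-monoˡ-≤ (- (k * s)) total)))

-- Explicit bounds on the factors

eighth quarter : ℚ
eighth = ℤ.+ 1 / 8
quarter = ℤ.+ 1 / 4

ℕ→ℚ-suc : ∀ m → ℕ→ℚ (suc m) ≡ 1ℚ + ℕ→ℚ m
ℕ→ℚ-suc m = ℕ→ℚ-+ 1 m

0≤recip : ∀ j → 0ℚ ≤ℚ recip j
0≤recip j = <⇒≤ (positive⁻¹ (recip j) {{recip-pos j}})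

-- The sharp bound 1 / (j + 1 - 1/8) for the norm of 1 / (j + 1 - βx) with |β| ≤ 1/8.
recip⁻ : ℕ → ℚ
recip⁻ j = ℕ→ℚ 8 * recip (8 ℕ.* j ℕ.+ 6)

recip⁻-inverse : ∀ j → (ℕ→ℚ (suc j) - eighth) * recip⁻ j ≡ 1ℚ
recip⁻-inverse j = begin
  (ℕ→ℚ (suc j) - eighth) * (ℕ→ℚ 8 * r)          ≡⟨ cong (λ x → (x - eighth) * (ℕ→ℚ 8 * r)) (ℕ→ℚ-suc j) ⟩
  (1ℚ + ℕ→ℚ j - eighth) * (ℕ→ℚ 8 * r)           ≡⟨ solve 2 (λ j r → (con 1ℚ :+ j :- con eighth) :* (con (ℕ→ℚ 8) :* r) := (con 1ℚ :+ (con (ℕ→ℚ 8) :* j :+ con (ℕ→ℚ 6))) :* r) refl (ℕ→ℚ j) r ⟩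
  (1ℚ + (ℕ→ℚ 8 * ℕ→ℚ j + ℕ→ℚ 6)) * r            ≡⟨ cong (λ x → (1ℚ + (x + ℕ→ℚ 6)) * r) (ℕ→ℚ-* 8 j) ⟨
  (1ℚ + (ℕ→ℚ (8 ℕ.* j) + ℕ→ℚ 6)) * r            ≡⟨ cong (λ x → (1ℚ + x) * r) (ℕ→ℚ-+ (8 ℕ.* j) 6) ⟨
  (1ℚ + ℕ→ℚ (8 ℕ.* j ℕ.+ 6)) * r                ≡⟨ cong (_* r) (ℕ→ℚ-suc (8 ℕ.* j ℕ.+ 6)) ⟨
  ℕ→ℚ (suc (8 ℕ.* j ℕ.+ 6)) * r                 ≡⟨ recip-inverse (8 ℕ.* j ℕ.+ 6) ⟩
  1ℚ ∎
  where
  open ≡-Reasoning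
  r : ℚ
  r = recip (8 ℕ.* j ℕ.+ 6)

0≤recip⁻ : ∀ j → 0ℚ ≤ℚ recip⁻ j
0≤recip⁻ j = 0≤* (0≤ℕ→ℚ 8) (0≤recip (8 ℕ.* j ℕ.+ 6))

recip≤recip⁻ : ∀ j → recip j ≤ℚ recip⁻ j
recip≤recip⁻ j = ≤-from-diff (subst (0ℚ ≤ℚ_) eq (0≤* (nonNegative⁻¹ eighth) (0≤* (0≤recip j) (0≤recip⁻ j))))
  where
  open ≡-Reasoning
  k a b : ℚ
  k = ℕ→ℚ (suc j)
  a = recip j
  b = recip⁻ j
  eq : eighth * (a * b) ≡ b - a
  eq = begin
    eighth * (a * b) ≡⟨ solve 3 (λ k a b → con eighth :* (a :* b) := (k :* a) :* b :- ((k :- con eighth) :* b) :* a) refl k a b ⟩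
    (k * a) * b - ((k - eighth) * b) * a ≡⟨ cong₂ (λ x y → x * b - y * a) (recip-inverse j) (recip⁻-inverse j) ⟩
    1ℚ * b - 1ℚ * a ≡⟨ solve 2 (λ a b → con 1ℚ :* b :- con 1ℚ :* a := b :- a) refl a b ⟩
    b - a ∎

1≤ℕ→ℚ-suc : ∀ j → 1ℚ ≤ℚ ℕ→ℚ (suc j)
1≤ℕ→ℚ-suc j = ℕ→ℚ-mono {1} {suc j} (s≤s z≤n)

0<suc-η : ∀ η j → η <ℚ 1ℚ → 0ℚ <ℚ ℕ→ℚ (suc j) - η
0<suc-η η j η<1 = <⇒0<diff (<-≤-trans η<1 (1≤ℕ→ℚ-suc j))

geom-bound⁻ : ∀ {β} j → ∣ β ∣ ≤ℚ eighth → Bounded (geom β j) (recip⁻ j)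
geom-bound⁻ j β≤ = Bounded-geom j β≤ (0<suc-η eighth j (*<* (ℤ.+<+ (s≤s (s≤s z≤n))))) (≤-reflexive (sym (recip⁻-inverse j)))

-- The cap is 1/4 because `G` contains `geom (β + γ)` with both parameters up to 1/8. The factor 2
-- comes from `k ≤ 2 (k - 1/4)` for `k ≥ 1`.
geom-bound : ∀ {β} j → ∣ β ∣ ≤ℚ quarter → Bounded (geom β j) (ℕ→ℚ 2 * recip j)
geom-bound j β≤ = Bounded-geom j β≤ (0<suc-η quarter j (*<* (ℤ.+<+ (s≤s (s≤s z≤n))))) (begin
  1ℚ                                         ≡⟨ recip-inverse j ⟨
  k * recip j                                ≤⟨ *-monoʳ-≤-nonNeg (recip j) {{nonNegative (0≤recip j)}} (≤-from-diff {k} {(k - quarter) * ℕ→ℚ 2} (subst (0ℚ ≤ℚ_)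
       (solve 1 (λ k → (k :- con 1ℚ) :+ con half := (k :- con quarter) :* con (ℕ→ℚ 2) :- k) refl k)
       (0≤+ (subst (_≤ℚ k - 1ℚ) (+-inverseʳ 1ℚ) (+-monoˡ-≤ (- 1ℚ) (1≤ℕ→ℚ-suc j))) (nonNegative⁻¹ half)))) ⟩
  (k - quarter) * ℕ→ℚ 2 * recip j            ≡⟨ *-assoc (k - quarter) (ℕ→ℚ 2) (recip j) ⟩
  (k - quarter) * (ℕ→ℚ 2 * recip j) ∎)
  where
  open ≤-Reasoning
  k : ℚ
  k = ℕ→ℚ (suc j)

-- The product of `(k + 1/8) / (k - 1/8)` over 1 ≤ k ≤ j, of order j^(1/4).
ω : ℕ → ℚ
ω zero    = 1ℚ
ω (suc j) = ω j * ((ℕ→ℚ (suc j) + eighth) * recip⁻ j)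

ω-step : ∀ j → ω (suc j) ≡ ω j + quarter * (ω j * recip⁻ j)
ω-step j = begin
  ω j * ((k + eighth) * b)  ≡⟨ solve 3 (λ w k b → w :* ((k :+ con eighth) :* b) := w :* ((k :- con eighth) :* b) :+ con quarter :* (w :* b)) refl (ω j) k b ⟩
  ω j * ((k - eighth) * b) + quarter * (ω j * b) ≡⟨ cong (λ x → ω j * x + quarter * (ω j * b)) (recip⁻-inverse j) ⟩
  ω j * 1ℚ + quarter * (ω j * b) ≡⟨ cong (_+ quarter * (ω j * b)) (*-identityʳ (ω j)) ⟩
  ω j + quarter * (ω j * b) ∎
  where
  open ≡-Reasoning
  k b : ℚ
  k = ℕ→ℚ (suc j)
  b = recip⁻ j

p≤p+q : ∀ p {q} → 0ℚ ≤ℚ q → p ≤ℚ p + q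
p≤p+q p {q} 0≤q = subst (_≤ℚ p + q) (+-identityʳ p) (+-monoʳ-≤ p 0≤q)

1≤ω : ∀ j → 1ℚ ≤ℚ ω j
0≤ω : ∀ j → 0ℚ ≤ℚ ω j
0≤ω j = ≤-trans (nonNegative⁻¹ 1ℚ) (1≤ω j)
1≤ω zero    = ≤-refl
1≤ω (suc j) = subst (1ℚ ≤ℚ_) (sym (ω-step j))
  (≤-trans (1≤ω j) (p≤p+q (ω j) (0≤* (nonNegative⁻¹ quarter) (0≤* (0≤ω j) (0≤recip⁻ j)))))

sumℕ→ℚ : ℕ → (ℕ → ℚ) → ℚ
sumℕ→ℚ zero c    = 0ℚ
sumℕ→ℚ (suc N) c = sumℕ→ℚ N c + c N

Bounded-sumS : ∀ N {f c} → (∀ j → j < N → Bounded (f j) (c j)) → Bounded (sumS N f) (sumℕ→ℚ N c)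
Bounded-sumS zero b    = Bounded-const {0ℚ} ≤-refl
Bounded-sumS (suc N) b = Bounded-⊕ (Bounded-sumS N (λ j lt → b j (ℕP.m<n⇒m<1+n lt))) (b N ℕP.≤-refl)

-- Telescoping: by `ω-step` each summand is at most `4 (ω (suc j) - ω j)`.
sum-ω-recip : ∀ N → sumℕ→ℚ N (λ j → ω j * recip j) ≤ℚ ℕ→ℚ 4 * ω N
sum-ω-recip zero    = nonNegative⁻¹ (ℕ→ℚ 4 * 1ℚ)
sum-ω-recip (suc N) = begin
  sumℕ→ℚ N (λ j → ω j * recip j) + ω N * recip N
    ≤⟨ +-mono-≤ (sum-ω-recip N) (*-monoˡ-≤-nonNeg (ω N) {{nonNegative (0≤ω N)}} (recip≤recip⁻ N)) ⟩
  ℕ→ℚ 4 * ω N + ω N * recip⁻ N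
    ≡⟨ solve 2 (λ w b → con (ℕ→ℚ 4) :* w :+ w :* b := con (ℕ→ℚ 4) :* (w :+ con quarter :* (w :* b))) refl (ω N) (recip⁻ N) ⟩
  ℕ→ℚ 4 * (ω N + quarter * (ω N * recip⁻ N)) ≡⟨ cong (ℕ→ℚ 4 *_) (ω-step N) ⟨
  ℕ→ℚ 4 * ω (suc N) ∎
  where open ≤-Reasoning

-- With k = N + 1 the induction step is `(2k + 1)(k - 1/8)⁴ ≥ (2k - 1)(k + 1/8)⁴`. For the value 1/8
-- the terms of degree 5 and 4 cancel, and the difference is exactly `(5/32) k² + 1/2048`.
ω⁴≤ : ∀ N → ω N * ω N * (ω N * ω N) ≤ℚ ℕ→ℚ 2 * ℕ→ℚ (suc N) - 1ℚ
ω⁴≤ zero    = ≤-refl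
ω⁴≤ (suc N) = ≤-from-diff (subst (0ℚ ≤ℚ_) eq (0≤+
  (0≤* (0≤⁴) (≤-diff (ω⁴≤ N)))
  (0≤* b⁴ (0≤+ (0≤* (nonNegative⁻¹ (ℤ.+ 5 / 32)) (0≤* (0≤ℕ→ℚ (suc N)) (0≤ℕ→ℚ (suc N)))) (nonNegative⁻¹ (ℤ.+ 1 / 2048))))))
  where
  open ≡-Reasoning
  w k b ρ : ℚ
  w = ω N
  k = ℕ→ℚ (suc N)
  b = recip⁻ N
  ρ = (k + eighth) * b
  ≤-diff : ∀ {p q} → p ≤ℚ q → 0ℚ ≤ℚ q - p
  ≤-diff {p} {q} h = subst (_≤ℚ q - p) (+-inverseʳ p) (+-monoˡ-≤ (- p) h)
  0≤ρ : 0ℚ ≤ℚ ρ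
  0≤ρ = 0≤* (0≤+ (0≤ℕ→ℚ (suc N)) (nonNegative⁻¹ eighth)) (0≤recip⁻ N)
  0≤⁴ : 0ℚ ≤ℚ ρ * ρ * (ρ * ρ)
  0≤⁴ = 0≤* (0≤* 0≤ρ 0≤ρ) (0≤* 0≤ρ 0≤ρ)
  b⁴ : 0ℚ ≤ℚ b * b * (b * b)
  b⁴ = 0≤* (0≤* (0≤recip⁻ N) (0≤recip⁻ N)) (0≤* (0≤recip⁻ N) (0≤recip⁻ N))
  v : ℚ
  v = (k - eighth) * b
  eq : ρ * ρ * (ρ * ρ) * (ℕ→ℚ 2 * k - 1ℚ - w * w * (w * w)) + b * b * (b * b) * ((ℤ.+ 5 / 32) * (k * k) + (ℤ.+ 1 / 2048))
       ≡ ℕ→ℚ 2 * ℕ→ℚ (suc (suc N)) - 1ℚ - ω (suc N) * ω (suc N) * (ω (suc N) * ω (suc N))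
  eq = begin
    _ ≡⟨ solve 3 (λ w k b → let r = (k :+ con eighth) :* b ; v = (k :- con eighth) :* b in
           r :* r :* (r :* r) :* (con (ℕ→ℚ 2) :* k :- con 1ℚ :- w :* w :* (w :* w)) :+ b :* b :* (b :* b) :* (con (ℤ.+ 5 / 32) :* (k :* k) :+ con (ℤ.+ 1 / 2048))
           := (con (ℕ→ℚ 2) :* k :+ con 1ℚ) :* (v :* v :* (v :* v)) :- w :* r :* (w :* r) :* (w :* r :* (w :* r))) refl w k b ⟩
    (ℕ→ℚ 2 * k + 1ℚ) * (v * v * (v * v)) - w * ρ * (w * ρ) * (w * ρ * (w * ρ))
      ≡⟨ cong (λ x → (ℕ→ℚ 2 * k + 1ℚ) * (x * x * (x * x)) - w * ρ * (w * ρ) * (w * ρ * (w * ρ))) (recip⁻-inverse N) ⟩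
    (ℕ→ℚ 2 * k + 1ℚ) * 1ℚ - w * ρ * (w * ρ) * (w * ρ * (w * ρ))
      ≡⟨ cong (_- w * ρ * (w * ρ) * (w * ρ * (w * ρ))) (trans (solve 1 (λ k → (con (ℕ→ℚ 2) :* k :+ con 1ℚ) :* con 1ℚ := con (ℕ→ℚ 2) :* (con 1ℚ :+ k) :- con 1ℚ) refl k)
           (cong (λ x → ℕ→ℚ 2 * x - 1ℚ) (sym (ℕ→ℚ-suc (suc N))))) ⟩
    _ ∎

-- The next numerator is carried along so that each step pairs `K (suc j) + b` with
-- `1 / (j + 1 - b)`, which is one factor of `ω`. The numerator at k = 0 supplies the `eighth`.
A-bound : ∀ {β} → ∣ β ∣ ≤ℚ eighth → ∀ j → Bounded (A β j ⊛ (K j ⊕ linear β)) (eighth * ω j)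
A-bound {β} β≤ zero    = Bounded-⊛ {C = 1ℚ} {D = 0ℚ + eighth} (Bounded-const {1ℚ} ≤-refl) (Bounded-⊕ (Bounded-const {0ℚ} ≤-refl) (Bounded-linear β≤))
A-bound {β} β≤ (suc j) = Bounded-≤
  (≤-reflexive (solve 3 (λ w b k → con eighth :* w :* b :* k := con eighth :* (w :* (k :* b))) refl (ω j) (recip⁻ j) (ℕ→ℚ (suc j) + eighth)))
  (Bounded-⊛ (Bounded-⊛ (A-bound β≤ j) (geom-bound⁻ j β≤)) (Bounded-⊕ (Bounded-K (suc j)) (Bounded-linear β≤)))

Bounded-⊖ : ∀ {f g C D} → Bounded f C → Bounded g D → Bounded (f ⊖ g) (C + D)
Bounded-⊖ b c = Bounded-⊕ b (Bounded-⊝ c)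

B-factor : ℚ → ℕ → ℕ → Series
B-factor γ n m = (K m ⊖ K n ⊕ linear γ) ⊛ geom γ (m ℕ.+ n)

-- The numerator has norm at most `m + n + 1/8`, which is below `m + n + 1 - 1/8`. Unlike `A`, the
-- products `B` are therefore bounded by 1, uniformly in `n`.
B-factor-bound : ∀ {γ} → ∣ γ ∣ ≤ℚ eighth → ∀ n m → Bounded (B-factor γ n m) 1ℚ
B-factor-bound γ≤ n m = Bounded-≤
  (≤-trans (*-monoʳ-≤-nonNeg (recip⁻ (m ℕ.+ n)) {{nonNegative (0≤recip⁻ (m ℕ.+ n))}} x≤y) (≤-reflexive (recip⁻-inverse (m ℕ.+ n))))
  (Bounded-⊛ (Bounded-⊕ (Bounded-⊖ (Bounded-K m) (Bounded-K n)) (Bounded-linear γ≤)) (geom-bound⁻ (m ℕ.+ n) γ≤))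
  where
  x y : ℚ
  x = ℕ→ℚ m + ℕ→ℚ n + eighth
  y = ℕ→ℚ (suc (m ℕ.+ n)) - eighth
  x≤y : x ≤ℚ y
  x≤y = ≤-from-diff {x} {y} (subst (0ℚ ≤ℚ_)
    (trans (solve 2 (λ m n → con (ℤ.+ 3 / 4) := con 1ℚ :+ (m :+ n) :- con eighth :- (m :+ n :+ con eighth)) refl (ℕ→ℚ m) (ℕ→ℚ n))
      (cong (λ z → z - eighth - x) (sym (trans (ℕ→ℚ-suc (m ℕ.+ n)) (cong (1ℚ +_) (ℕ→ℚ-+ m n))))))
    (nonNegative⁻¹ (ℤ.+ 3 / 4)))

B-suc : ∀ γ n m → B γ n (suc m) ≈ B γ n m ⊛ B-factor γ n m
B-suc γ n m = S.solve 3 (λ b x g → b S.:* x S.:* g S.:= b S.:* (x S.:* g)) ≈-refl (B γ n m) (K m ⊖ K n ⊕ linear γ) (geom γ (m ℕ.+ n))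

B-bound : ∀ {γ} → ∣ γ ∣ ≤ℚ eighth → ∀ n m → Bounded (B γ n m) 1ℚ
B-bound γ≤ n zero    = Bounded-const {1ℚ} ≤-refl
B-bound {γ} γ≤ n (suc m) = Bounded-≈ (≈-sym (B-suc γ n m))
  (Bounded-≤ {C = 1ℚ * 1ℚ} ≤-refl (Bounded-⊛ (B-bound γ≤ n m) (B-factor-bound γ≤ n m)))

recip-antimono : ∀ {i j} → i ≤ j → recip j ≤ℚ recip i
recip-antimono {i} {j} i≤j = ≤-from-diff {recip j} {recip i} (subst (0ℚ ≤ℚ_) eq
  (0≤* (0≤* (0≤recip i) (0≤recip j)) (subst (_≤ℚ ℕ→ℚ (suc j) - ℕ→ℚ (suc i)) (+-inverseʳ (ℕ→ℚ (suc i))) (+-monoˡ-≤ (- ℕ→ℚ (suc i)) (ℕ→ℚ-mono (s≤s i≤j))))))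
  where
  open ≡-Reasoning
  a b x y : ℚ
  a = recip i
  b = recip j
  x = ℕ→ℚ (suc i)
  y = ℕ→ℚ (suc j)
  eq : a * b * (y - x) ≡ a - b
  eq = begin
    a * b * (y - x)           ≡⟨ solve 4 (λ a b x y → a :* b :* (y :- x) := y :* b :* a :- x :* a :* b) refl a b x y ⟩
    y * b * a - x * a * b     ≡⟨ cong₂ (λ u v → u * a - v * b) (recip-inverse j) (recip-inverse i) ⟩
    1ℚ * a - 1ℚ * b           ≡⟨ solve 2 (λ a b → con 1ℚ :* a :- con 1ℚ :* b := a :- b) refl a b ⟩
    a - b ∎

-- With v = m + n + 1, `(m - n + c) v - (m - n)(v - c) = (2m + 1)
-- c`. The gain is a numerator free of `n` over a denominator quadratic in `n`.
B-factor-difference : ∀ γ n m → B-factor γ n m ⊖ B-factor 0ℚ n m ≈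
  (K m ⊕ K m ⊕ const 1ℚ) ⊛ (linear γ ⊛ geom γ (m ℕ.+ n) ⊛ geom 0ℚ (m ℕ.+ n))
B-factor-difference γ n m = ≈-trans
  (⊕-cong ≈-refl (⊝-cong (⊛-cong (⊕-cong ≈-refl linear-0) ≈-refl)))
  (cancel ((K m ⊕ K m ⊕ const 1ℚ) ⊛ O ⊖ const 1ℚ) I-inv
  (cancel (const 1ℚ ⊖ (K m ⊕ K m ⊕ const 1ℚ) ⊛ I) O-inv
  (S.solve 5 (λ km kn c i o → let one = S.con 1ℚ ; d = km S.:+ km S.:+ one ; v = km S.:+ kn S.:+ one in
      (km S.:- kn S.:+ c) S.:* i S.:- (km S.:- kn S.:+ S.con 0ℚ) S.:* o S.:=
      d S.:* (c S.:* i S.:* o) S.:+ (d S.:* o S.:- one) S.:* ((v S.:- c) S.:* i S.:- one)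
        S.:+ (one S.:- d S.:* i) S.:* (v S.:* o S.:- one))
    ≈-refl (K m) (K n) (linear γ) I O)))
  where
  I O : Series
  I = geom γ (m ℕ.+ n)
  O = geom 0ℚ (m ℕ.+ n)
  I-inv : (K m ⊕ K n ⊕ const 1ℚ ⊖ linear γ) ⊛ I ≈ const 1ℚ
  I-inv = ≈-trans (⊛-cong (⊕-cong (⊕-cong (≈-sym (K-+ m n)) ≈-refl) ≈-refl) ≈-refl) (geom-inverse γ (m ℕ.+ n))
  O-inv : (K m ⊕ K n ⊕ const 1ℚ) ⊛ O ≈ const 1ℚ
  O-inv = ≈-trans (⊛-cong (≈-trans (⊕-cong (≈-sym (K-+ m n)) ≈-refl)
      (≈-trans (S.solve 1 (λ k → k S.:= k S.:- S.con 0ℚ) ≈-refl (K (suc (m ℕ.+ n)))) (⊕-cong ≈-refl (⊝-cong (≈-sym linear-0))))) ≈-refl)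
    (geom-inverse 0ℚ (m ℕ.+ n))

eighth≤quarter : eighth ≤ℚ quarter
eighth≤quarter = *≤* (ℤ.+≤+ (s≤s (s≤s (s≤s (s≤s z≤n)))))

∣0∣≤eighth : ∣ 0ℚ ∣ ≤ℚ eighth
∣0∣≤eighth = nonNegative⁻¹ eighth

B-factor-difference-bound : ∀ {γ} → ∣ γ ∣ ≤ℚ eighth → ∀ n m → m ≤ n →
  Bounded (B-factor γ n m ⊖ B-factor 0ℚ n m) (recip n)
B-factor-difference-bound {γ} γ≤ n m m≤n = Bounded-≈ (≈-sym (B-factor-difference γ n m))
  (Bounded-≤ bound (Bounded-⊛ (Bounded-⊕ (Bounded-⊕ (Bounded-K m) (Bounded-K m)) (Bounded-const {1ℚ} ≤-refl))
    (Bounded-⊛ (Bounded-⊛ (Bounded-linear γ≤) (geom-bound l (≤-trans γ≤ eighth≤quarter)))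
      (geom-bound l (≤-trans ∣0∣≤eighth eighth≤quarter)))))
  where
  open ≤-Reasoning
  l : ℕ
  l = m ℕ.+ n
  r x y : ℚ
  r = recip l
  x = ℕ→ℚ m + ℕ→ℚ m + 1ℚ
  y = ℕ→ℚ (suc l)
  -- Here `m ≤ n` enters: `2m + 1 ≤ m + n + 1` cancels one of the two denominators.
  x≤y : x ≤ℚ y
  x≤y = begin
    ℕ→ℚ m + ℕ→ℚ m + 1ℚ     ≡⟨ +-comm (ℕ→ℚ m + ℕ→ℚ m) 1ℚ ⟩
    1ℚ + (ℕ→ℚ m + ℕ→ℚ m)   ≡⟨ cong (1ℚ +_) (ℕ→ℚ-+ m m) ⟨
    1ℚ + ℕ→ℚ (m ℕ.+ m)     ≡⟨ ℕ→ℚ-suc (m ℕ.+ m) ⟨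
    ℕ→ℚ (suc (m ℕ.+ m))    ≤⟨ ℕ→ℚ-mono (s≤s (ℕP.+-monoʳ-≤ m m≤n)) ⟩
    ℕ→ℚ (suc l) ∎
  bound : x * (eighth * (ℕ→ℚ 2 * r) * (ℕ→ℚ 2 * r)) ≤ℚ recip n
  bound = begin
    x * (eighth * (ℕ→ℚ 2 * r) * (ℕ→ℚ 2 * r))
      ≡⟨ solve 2 (λ x r → x :* (con eighth :* (con (ℕ→ℚ 2) :* r) :* (con (ℕ→ℚ 2) :* r)) := x :* (con half :* r :* r)) refl x r ⟩
    x * (half * r * r)
      ≤⟨ *-monoʳ-≤-nonNeg (half * r * r) {{nonNegative (0≤* (0≤* (nonNegative⁻¹ half) (0≤recip l)) (0≤recip l))}} x≤y ⟩
    y * (half * r * r)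
      ≡⟨ solve 2 (λ y r → y :* (con half :* r :* r) := y :* r :* (con half :* r)) refl y r ⟩
    y * r * (half * r)
      ≡⟨ cong (_* (half * r)) (recip-inverse l) ⟩
    1ℚ * (half * r)
      ≤⟨ p≤p+q (1ℚ * (half * r)) (0≤* (nonNegative⁻¹ half) (0≤recip l)) ⟩
    1ℚ * (half * r) + half * r
      ≡⟨ solve 1 (λ r → con 1ℚ :* (con half :* r) :+ con half :* r := r) refl r ⟩
    r ≤⟨ recip-antimono (ℕP.m≤n+m n m) ⟩
    recip n ∎

-- The factors are exchanged one at a time; since all of them have norm at most 1, the errors simply
-- add up.
B-difference-bound : ∀ {γ} → ∣ γ ∣ ≤ℚ eighth → ∀ n j → j ≤ suc n →
  Bounded (B γ n j ⊖ B 0ℚ n j) (ℕ→ℚ j * recip n)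
B-difference-bound {γ} γ≤ n zero _ = Bounded-≈ (S.solve 0 (S.con 0ℚ S.:= S.con 1ℚ S.:- S.con 1ℚ) ≈-refl)
  (Bounded-≤ (≤-reflexive (sym (*-zeroˡ (recip n)))) (Bounded-const {0ℚ} ≤-refl))
B-difference-bound {γ} γ≤ n (suc j) (s≤s j≤n) = Bounded-≈ (≈-sym split)
  (Bounded-≤ (≤-reflexive (trans (solve 2 (λ j r → j :* r :* con 1ℚ :+ con 1ℚ :* r := (con 1ℚ :+ j) :* r) refl (ℕ→ℚ j) (recip n))
      (cong (_* recip n) (sym (ℕ→ℚ-suc j)))))
    (Bounded-⊕ (Bounded-⊛ (B-difference-bound γ≤ n j (ℕP.m≤n⇒m≤1+n j≤n)) (B-factor-bound ∣0∣≤eighth n j))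
               (Bounded-⊛ (B-bound γ≤ n j) (B-factor-difference-bound γ≤ n j j≤n))))
  where
  split : B γ n (suc j) ⊖ B 0ℚ n (suc j) ≈
    (B γ n j ⊖ B 0ℚ n j) ⊛ B-factor 0ℚ n j ⊕ B γ n j ⊛ (B-factor γ n j ⊖ B-factor 0ℚ n j)
  split = ≈-trans (⊕-cong (B-suc γ n j) (⊝-cong (B-suc 0ℚ n j)))
    (S.solve 4 (λ b b₀ x x₀ → b S.:* x S.:- b₀ S.:* x₀ S.:= (b S.:- b₀) S.:* x₀ S.:+ b S.:* (x S.:- x₀)) ≈-refl
      (B γ n j) (B 0ℚ n j) (B-factor γ n j) (B-factor 0ℚ n j))

sumℕ→ℚ-scale : ∀ N p c → sumℕ→ℚ N (λ j → p * c j) ≡ p * sumℕ→ℚ N c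
sumℕ→ℚ-scale zero p c    = sym (*-zeroʳ p)
sumℕ→ℚ-scale (suc N) p c = trans (cong (_+ p * c N) (sumℕ→ℚ-scale N p c)) (sym (*-distribˡ-+ p (sumℕ→ℚ N c) (c N)))

Bounded-sumS-ω : ∀ N {f p} → 0ℚ ≤ℚ p → (∀ j → j < N → Bounded (f j) (p * (ω j * recip j))) →
  Bounded (sumS N f) (p * (ℕ→ℚ 4 * ω N))
Bounded-sumS-ω N {f} {p} 0≤p b = Bounded-≤
  (≤-trans (≤-reflexive (sumℕ→ℚ-scale N p (λ j → ω j * recip j))) (*-monoˡ-≤-nonNeg p {{nonNegative 0≤p}} (sum-ω-recip N)))
  (Bounded-sumS N b)

module _ {β γ : ℚ} (β≤ : ∣ β ∣ ≤ℚ eighth) (γ≤ : ∣ γ ∣ ≤ℚ eighth) where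

  -- The factor `j + 1` from `B-difference-bound` cancels against the 1/m in `F`, which leaves
  -- `ω j / (j + 1)` for `sum-ω-recip`.
  errorF-bound : ∀ N → Bounded (errorF β γ N) (ω N * recip N)
  errorF-bound N = Bounded-≤
    (≤-reflexive (solve 2 (λ r w → con quarter :* r :* (con (ℕ→ℚ 4) :* w) := w :* r) refl (recip N) (ω N)))
    (Bounded-sumS-ω N (0≤* (nonNegative⁻¹ quarter) (0≤recip N)) term)
    where
    term : ∀ j → j < N → Bounded (F β γ N j ⊖ F β 0ℚ N j) (quarter * recip N * (ω j * recip j))
    term j j<N = Bounded-≈
      (S.solve 4 (λ r a b b₀ → r S.:* a S.:* (b S.:- b₀) S.:= r S.:* a S.:* b S.:- r S.:* a S.:* b₀) ≈-refl
        (const (recip j)) (A β (suc j)) (B γ N (suc j)) (B 0ℚ N (suc j)))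
      (Bounded-≤ (≤-reflexive (trans
          (solve 4 (λ r w k q → r :* (con eighth :* w :* (con (ℕ→ℚ 2) :* r)) :* (k :* q) := k :* r :* (con quarter :* q :* (w :* r))) refl (recip j) (ω j) (ℕ→ℚ (suc j)) (recip N))
          (trans (cong (_* (quarter * recip N * (ω j * recip j))) (recip-inverse j)) (*-identityˡ (quarter * recip N * (ω j * recip j))))))
        (Bounded-⊛ (Bounded-⊛ (Bounded-const (≤-reflexive (0≤p⇒∣p∣≡p (0≤recip j))))
            (Bounded-⊛ (A-bound β≤ j) (geom-bound j (≤-trans β≤ eighth≤quarter))))
          (B-difference-bound γ≤ N (suc j) (ℕP.m≤n⇒m≤1+n j<N))))

-- The decay in `N` comes from `geom γ (N + n)`. The factor `ω n ≥ 1` is inserted so that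
-- `sum-ω-recip` also handles the sum over `n`.
G-bound : ∀ {β γ} → ∣ β ∣ ≤ℚ eighth → ∣ γ ∣ ≤ℚ eighth → ∀ N n →
  Bounded (G β γ n N) (quarter * (ω N * recip N) * (ω n * recip n))
G-bound {β} {γ} β≤ γ≤ N n = Bounded-≤ bound
  (Bounded-⊛ (Bounded-⊛ (Bounded-⊛ (Bounded-const {half} ≤-refl) (geom-bound n (≤-trans (∣p+q∣≤∣p∣+∣q∣ β γ) (+-mono-≤ β≤ γ≤)))) (A-bound β≤ N))
    (Bounded-⊛ (B-bound γ≤ n N) (geom-bound (N ℕ.+ n) (≤-trans γ≤ eighth≤quarter))))
  where
  open ≤-Reasoning
  w r q : ℚ
  w = ω N
  r = recip n
  q = recip (N ℕ.+ n)
  bound : half * (ℕ→ℚ 2 * r) * (eighth * w) * (1ℚ * (ℕ→ℚ 2 * q)) ≤ℚ quarter * (w * recip N) * (ω n * r)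
  bound = begin
    half * (ℕ→ℚ 2 * r) * (eighth * w) * (1ℚ * (ℕ→ℚ 2 * q))
      ≡⟨ solve 3 (λ w r q → con half :* (con (ℕ→ℚ 2) :* r) :* (con eighth :* w) :* (con 1ℚ :* (con (ℕ→ℚ 2) :* q)) := con quarter :* (w :* q) :* (con 1ℚ :* r)) refl w r q ⟩
    quarter * (w * q) * (1ℚ * r)
      ≤⟨ *-mono-≤-nn (0≤* (nonNegative⁻¹ quarter) (0≤* (0≤ω N) (0≤recip N))) (0≤* (nonNegative⁻¹ 1ℚ) (0≤recip n))
           (*-monoˡ-≤-nonNeg quarter (*-monoˡ-≤-nonNeg w {{nonNegative (0≤ω N)}} (recip-antimono (ℕP.m≤m+n N n))))
           (*-monoʳ-≤-nonNeg r {{nonNegative (0≤recip n)}} (1≤ω n)) ⟩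
    quarter * (w * recip N) * (ω n * r) ∎

δ : ℕ → ℚ
δ N = ω N * ω N * recip N

error-bound : ∀ {β γ} → ∣ β ∣ ≤ℚ eighth → ∣ γ ∣ ≤ℚ eighth → ∀ N → Bounded (errorF β γ N ⊖ errorG β γ N) (ℕ→ℚ 3 * δ N)
error-bound {β} {γ} β≤ γ≤ N = Bounded-≤ bound (Bounded-⊖ (errorF-bound β≤ γ≤ N) errorG-bound)
  where
  w r : ℚ
  w = ω N
  r = recip N
  errorG-bound : Bounded (errorG β γ N) (half * (w * r) * (ℕ→ℚ 4 * w))
  errorG-bound = Bounded-sumS-ω N (0≤* (nonNegative⁻¹ half) (0≤* (0≤ω N) (0≤recip N))) (λ n _ → Bounded-≤
    (≤-reflexive (solve 2 (λ x y → con quarter :* x :* y :+ con quarter :* x :* y := con half :* x :* y) refl (w * r) (ω n * recip n)))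
    (Bounded-⊖ (G-bound β≤ γ≤ N n) (G-bound β≤ ∣0∣≤eighth N n)))
  bound : w * r + half * (w * r) * (ℕ→ℚ 4 * w) ≤ℚ ℕ→ℚ 3 * δ N
  bound = ≤-trans
    (+-monoˡ-≤ (half * (w * r) * (ℕ→ℚ 4 * w)) (subst (_≤ℚ w * (w * r)) (*-identityˡ (w * r)) (*-monoʳ-≤-nonNeg (w * r) {{nonNegative (0≤* (0≤ω N) (0≤recip N))}} (1≤ω N))))
    (≤-reflexive (solve 2 (λ w r → w :* (w :* r) :+ con half :* (w :* r) :* (con (ℕ→ℚ 4) :* w) := con (ℕ→ℚ 3) :* (w :* w :* r)) refl w r))

recip-Small : Small recip
recip-Small (mkℚ (ℤ.+ zero) d _) (*<* (ℤ.+<+ ()))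
recip-Small (mkℚ ℤ.-[1+ n ] d _) (*<* ())
-- `ε` is (p+1)/(d+1), hence at least 1/(d+1), and N ≥ d+1 makes 1/(N+1) strictly smaller.
recip-Small ε@(mkℚ (ℤ.+ (suc p)) d _) 0<ε = suc d , bound
  where
  bound : ∀ N → suc d ≤ N → ∣ recip N ∣ <ℚ ε
  bound N le = subst (_<ℚ ε) (sym (0≤p⇒∣p∣≡p (0≤recip N))) (toℚᵘ-cancel-<
    (ℚᵘP.<-respˡ-≃ (ℚᵘP.≃-sym (toℚᵘ-fromℚᵘ (ℚᵘ.mkℚᵘ (ℤ.+ 1) N)))
      (ℚᵘ.*<* (ℤ.+<+ (ℕP.≤-trans (s≤s (subst (_≤ N) (sym (ℕP.+-identityʳ (suc d))) le)) (ℕP.m≤m+n (suc N) (p ℕ.* suc N)))))))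

-- Square roots are avoided by comparing squares: `ω⁴≤` bounds the square of `δ N` by 2/(N+1), which
-- is brought below `ε * ε`.
δ-Small : Small δ
δ-Small ε 0<ε with recip-Small (half * (ε * ε)) (0<½* (positive⁻¹ (ε * ε) {{pos*pos⇒pos ε {{positive 0<ε}} ε {{positive 0<ε}}}}))
... | N₀ , small = N₀ , bound
  where
  0≤δ : ∀ N → 0ℚ ≤ℚ δ N
  0≤δ N = 0≤* (0≤* (0≤ω N) (0≤ω N)) (0≤recip N)
  square : ∀ N → N₀ ≤ N → δ N * δ N <ℚ ε * ε
  square N le = begin-strict
    w * w * r * (w * w * r)      ≡⟨ solve 2 (λ w r → w :* w :* r :* (w :* w :* r) := w :* w :* (w :* w) :* (r :* r)) refl w r ⟩
    w * w * (w * w) * (r * r)    ≤⟨ *-monoʳ-≤-nonNeg (r * r) {{nonNegative (0≤* (0≤recip N) (0≤recip N))}} (≤-trans (ω⁴≤ N) below) ⟩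
    ℕ→ℚ 2 * k * (r * r)          ≡⟨ solve 2 (λ k r → con (ℕ→ℚ 2) :* k :* (r :* r) := k :* r :* (con (ℕ→ℚ 2) :* r)) refl k r ⟩
    k * r * (ℕ→ℚ 2 * r)          ≡⟨ trans (cong (_* (ℕ→ℚ 2 * r)) (recip-inverse N)) (*-identityˡ (ℕ→ℚ 2 * r)) ⟩
    ℕ→ℚ 2 * r                    <⟨ *-monoʳ-<-pos (ℕ→ℚ 2) (subst (_<ℚ half * (ε * ε)) (0≤p⇒∣p∣≡p (0≤recip N)) (small N le)) ⟩
    ℕ→ℚ 2 * (half * (ε * ε))     ≡⟨ solve 1 (λ e → con (ℕ→ℚ 2) :* (con half :* e) := e) refl (ε * ε) ⟩
    ε * ε ∎
    where
    open ≤-Reasoning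
    w r k : ℚ
    w = ω N
    r = recip N
    k = ℕ→ℚ (suc N)
    below : ℕ→ℚ 2 * k - 1ℚ ≤ℚ ℕ→ℚ 2 * k
    below = subst (ℕ→ℚ 2 * k - 1ℚ ≤ℚ_) (solve 1 (λ k → con (ℕ→ℚ 2) :* k :- con 1ℚ :+ con 1ℚ := con (ℕ→ℚ 2) :* k) refl k)
      (p≤p+q (ℕ→ℚ 2 * k - 1ℚ) (nonNegative⁻¹ 1ℚ))
  bound : ∀ N → N₀ ≤ N → ∣ δ N ∣ <ℚ ε
  bound N le with δ N <? ε
  ... | yes δ<ε = subst (_<ℚ ε) (sym (0≤p⇒∣p∣≡p (0≤δ N))) δ<ε
  ... | no δ≮ε  = ⊥-elim (<-irrefl refl (<-≤-trans (square N le)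
                    (*-mono-≤-nn (0≤δ N) (<⇒≤ 0<ε) (≮⇒≥ δ≮ε) (≮⇒≥ δ≮ε))))

Small-≤ : ∀ {f g} → (∀ N → ∣ f N ∣ ≤ℚ g N) → Small g → Small f
Small-≤ {f} {g} le sg ε 0<ε with sg ε 0<ε
... | N₀ , h = N₀ , λ N N₀≤N → ≤-<-trans (le N) (≤-<-trans (p≤∣p∣ (g N)) (h N N₀≤N))
  where
  p≤∣p∣ : ∀ p → p ≤ℚ ∣ p ∣
  p≤∣p∣ p = [ (λ 0≤p → ≤-reflexive (sym (0≤p⇒∣p∣≡p 0≤p))) , (λ p≤0 → ≤-trans p≤0 (0≤∣p∣ p)) ]′ (≤-total 0ℚ p)

-- Sums over odd compositions

-- ∑comp n g is the sum of g over the compositions of n. A composition of n + 1 either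
-- starts with 1 or arises from a composition of n by raising the first part.
bump : List ℕ → List ℕ
bump []      = []
bump (i ∷ a) = suc i ∷ a

∑comp : ℕ → (List ℕ → ℚ) → ℚ
∑comp zero          g = g []
∑comp (suc zero)    g = g (1 ∷ [])
∑comp (suc (suc n)) g = ∑comp (suc n) (g ∘ (1 ∷_)) + ∑comp (suc n) (g ∘ bump)

∑comp-cong-suc : ∀ n {g g′} → (∀ j a → length a ≤ n → g (j ∷ a) ≡ g′ (j ∷ a)) → ∑comp (suc n) g ≡ ∑comp (suc n) g′
∑comp-cong-suc zero h    = h 1 [] z≤n
∑comp-cong-suc (suc n) h = cong₂ _+_ (∑comp-cong-suc n (λ j a le → h 1 (j ∷ a) (s≤s le)))
                                 (∑comp-cong-suc n (λ j a le → h (suc j) a (ℕP.m≤n⇒m≤1+n le)))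

∑comp-cong : ∀ n {g g′} → (∀ a → length a ≤ n → g a ≡ g′ a) → ∑comp n g ≡ ∑comp n g′
∑comp-cong zero h    = h [] z≤n
∑comp-cong (suc n) h = ∑comp-cong-suc n (λ j a le → h (j ∷ a) (s≤s le))

∑comp-+ : ∀ n g h → ∑comp n (λ a → g a + h a) ≡ ∑comp n g + ∑comp n h
∑comp-+ zero g h          = refl
∑comp-+ (suc zero) g h    = refl
∑comp-+ (suc (suc n)) g h = trans (cong₂ _+_ (∑comp-+ (suc n) (g ∘ (1 ∷_)) (h ∘ (1 ∷_))) (∑comp-+ (suc n) (g ∘ bump) (h ∘ bump)))
  (solve 4 (λ a b c d → a :+ b :+ (c :+ d) := a :+ c :+ (b :+ d)) refl
    (∑comp (suc n) (g ∘ (1 ∷_))) (∑comp (suc n) (h ∘ (1 ∷_))) (∑comp (suc n) (g ∘ bump)) (∑comp (suc n) (h ∘ bump)))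

∑comp-* : ∀ n p g → ∑comp n (λ a → p * g a) ≡ p * ∑comp n g
∑comp-* zero p g          = refl
∑comp-* (suc zero) p g    = refl
∑comp-* (suc (suc n)) p g = trans (cong₂ _+_ (∑comp-* (suc n) p (g ∘ (1 ∷_))) (∑comp-* (suc n) p (g ∘ bump)))
  (sym (*-distribˡ-+ p (∑comp (suc n) (g ∘ (1 ∷_))) (∑comp (suc n) (g ∘ bump))))

∑comp-0 : ∀ n → ∑comp n (λ _ → 0ℚ) ≡ 0ℚ
∑comp-0 n = trans (∑comp-* n 0ℚ (λ _ → 0ℚ)) (*-zeroˡ (∑comp n (λ _ → 0ℚ)))

∑comp-zero : ∀ n {g} → (∀ j a → g (j ∷ a) ≡ 0ℚ) → ∑comp (suc n) g ≡ 0ℚ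
∑comp-zero n h = trans (∑comp-cong-suc n (λ j a _ → h j a)) (∑comp-0 (suc n))

sumℚ-++ : ∀ (g : List ℕ → ℚ) xs ys → sumℚ (map g (xs ++ ys)) ≡ sumℚ (map g xs) + sumℚ (map g ys)
sumℚ-++ g [] ys       = sym (+-identityˡ (sumℚ (map g ys)))
sumℚ-++ g (x ∷ xs) ys = trans (cong (g x +_) (sumℚ-++ g xs ys)) (sym (+-assoc (g x) (sumℚ (map g xs)) (sumℚ (map g ys))))

sumℚ-concatMap : ∀ (g : List ℕ → ℚ) (L : ℕ → List (List ℕ)) xs →
  sumℚ (map g (concatMap L xs)) ≡ sumℚ (map (λ j → sumℚ (map g (L j))) xs)
sumℚ-concatMap g L []       = refl
sumℚ-concatMap g L (x ∷ xs) = trans (sumℚ-++ g (L x) (concatMap L xs)) (cong (sumℚ (map g (L x)) +_) (sumℚ-concatMap g L xs))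

sumℚ-cong : ∀ {f g : ℕ → ℚ} → (∀ x → f x ≡ g x) → ∀ xs → sumℚ (map f xs) ≡ sumℚ (map g xs)
sumℚ-cong h []       = refl
sumℚ-cong h (x ∷ xs) = cong₂ _+_ (h x) (sumℚ-cong h xs)

sumℚ-applyUpTo-suc : ∀ (φ h : ℕ → ℕ) (ψ : ℕ → ℚ) n → (∀ j → φ j ≡ suc (h j)) →
  sumℚ (map ψ (applyUpTo φ n)) ≡ sumℚ (map (ψ ∘ suc) (applyUpTo h n))
sumℚ-applyUpTo-suc φ h ψ zero eq    = refl
sumℚ-applyUpTo-suc φ h ψ (suc n) eq = cong₂ _+_ (cong ψ (eq 0)) (sumℚ-applyUpTo-suc (φ ∘ suc) (h ∘ suc) ψ n (eq ∘ suc))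

-- A first part `suc j` is a first part 1 raised `j` times. Unrolling the raisings gives the
-- enumeration by first part used in `compsF`.
∑comp-first : ∀ k g → ∑comp (suc k) g ≡ sumℚ (map (λ j → ∑comp (k ℕ.∸ j) (g ∘ (suc j ∷_))) (upTo (suc k)))
∑comp-first zero g    = sym (+-identityʳ (g (1 ∷ [])))
∑comp-first (suc k) g = cong (∑comp (suc k) (g ∘ (1 ∷_)) +_) (trans (∑comp-first k (g ∘ bump))
  (sym (sumℚ-applyUpTo-suc suc (λ j → j) (λ j → ∑comp (suc k ℕ.∸ j) (g ∘ (suc j ∷_))) (suc k) (λ _ → refl))))

compsF-sum : ∀ f k g → k ≤ f → sumℚ (map g (compsF f k)) ≡ ∑comp k g
compsF-sum f zero g _                 = +-identityʳ (g [])
compsF-sum (suc f) (suc k) g (s≤s le) = begin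
  sumℚ (map g (concatMap (λ j → map (suc j ∷_) (compsF f (k ℕ.∸ j))) (upTo (suc k))))
    ≡⟨ sumℚ-concatMap g (λ j → map (suc j ∷_) (compsF f (k ℕ.∸ j))) (upTo (suc k)) ⟩
  sumℚ (map (λ j → sumℚ (map g (map (suc j ∷_) (compsF f (k ℕ.∸ j))))) (upTo (suc k)))
    ≡⟨ sumℚ-cong (λ j → trans (cong sumℚ (sym (map-∘ (compsF f (k ℕ.∸ j)))))
         (compsF-sum f (k ℕ.∸ j) (g ∘ (suc j ∷_)) (ℕP.≤-trans (ℕP.m∸n≤m k j) le))) (upTo (suc k)) ⟩
  sumℚ (map (λ j → ∑comp (k ℕ.∸ j) (g ∘ (suc j ∷_))) (upTo (suc k)))
    ≡⟨ ∑comp-first k g ⟨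
  ∑comp (suc k) g ∎
  where open ≡-Reasoning

compositions-sum : ∀ k g → sumℚ (map g (compositions k)) ≡ ∑comp k g
compositions-sum k g = compsF-sum k k g ℕP.≤-refl

^ℚ-+ : ∀ p i j → p ^ℚ (i ℕ.+ j) ≡ p ^ℚ i * p ^ℚ j
^ℚ-+ p zero j    = sym (*-identityˡ (p ^ℚ j))
^ℚ-+ p (suc i) j = trans (cong (p *_) (^ℚ-+ p i j)) (sym (*-assoc p (p ^ℚ i) (p ^ℚ j)))

-- The increments of the truncated values when the bound on the summation indices grows from M to M + 1.
Δζtr : ℕ → List ℕ → ℚ
Δζtr M []       = 0ℚ
Δζtr M (i ∷ is) = recip M ^ℚ i * ζtr M is

ζtr-suc : ∀ M a → ζtr (suc M) a ≡ ζtr M a + Δζtr M a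
ζtr-suc M []       = sym (+-identityʳ 1ℚ)
ζtr-suc M (i ∷ is) = refl

Δζrtr : ℚ → ℕ → List ℕ → ℚ
Δζrtr r M a = ∑comp (length a) (λ J → r ^ℚ (length a ℕ.∸ length J) * Δζtr M (blockSums J a))

ζrtr-∑comp : ∀ r N a → ζrtr r N a ≡ ∑comp (length a) (λ J → r ^ℚ (length a ℕ.∸ length J) * ζtr N (blockSums J a))
ζrtr-∑comp r N a = compositions-sum (length a) (λ J → r ^ℚ (length a ℕ.∸ length J) * ζtr N (blockSums J a))

ζrtr-suc : ∀ r M a → ζrtr r (suc M) a ≡ ζrtr r M a + Δζrtr r M a
ζrtr-suc r M a = begin
  ζrtr r (suc M) a ≡⟨ ζrtr-∑comp r (suc M) a ⟩
  ∑comp (length a) (λ J → c J * ζtr (suc M) (blockSums J a))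
    ≡⟨ ∑comp-cong (length a) (λ J _ → trans (cong (c J *_) (ζtr-suc M (blockSums J a))) (*-distribˡ-+ (c J) (ζtr M (blockSums J a)) (Δζtr M (blockSums J a)))) ⟩
  ∑comp (length a) (λ J → c J * ζtr M (blockSums J a) + c J * Δζtr M (blockSums J a))
    ≡⟨ ∑comp-+ (length a) (λ J → c J * ζtr M (blockSums J a)) (λ J → c J * Δζtr M (blockSums J a)) ⟩
  ∑comp (length a) (λ J → c J * ζtr M (blockSums J a)) + Δζrtr r M a ≡⟨ cong (_+ Δζrtr r M a) (ζrtr-∑comp r M a) ⟨
  ζrtr r M a + Δζrtr r M a ∎
  where
  open ≡-Reasoning
  c : List ℕ → ℚ
  c J = r ^ℚ (length a ℕ.∸ length J)

ζrtr-0 : ∀ r i a → ζrtr r 0 (i ∷ a) ≡ 0ℚ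
ζrtr-0 r i a = trans (ζrtr-∑comp r 0 (i ∷ a)) (∑comp-zero (length a) (λ j J → *-zeroʳ (r ^ℚ (length a ℕ.∸ length J))))

-- Either `i` forms a block alone, and the remaining indices are at most M, or it joins the block of
-- the next entry. The latter loses one block, hence the factor `r`, and that block keeps the index
-- M + 1.
Δζrtr-∷ : ∀ r M i a → Δζrtr r M (i ∷ a) ≡ recip M ^ℚ i * (ζrtr r M a + r * Δζrtr r M a)
Δζrtr-∷ r M i [] = begin
  1ℚ * (recip M ^ℚ (i ℕ.+ 0) * 1ℚ)  ≡⟨ cong (λ k → 1ℚ * (recip M ^ℚ k * 1ℚ)) (ℕP.+-identityʳ i) ⟩
  1ℚ * (recip M ^ℚ i * 1ℚ)          ≡⟨ solve 2 (λ x r → con 1ℚ :* (x :* con 1ℚ) := x :* (con 1ℚ :+ r :* con 0ℚ)) refl (recip M ^ℚ i) r ⟩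
  recip M ^ℚ i * (1ℚ + r * 0ℚ) ∎
  where open ≡-Reasoning
Δζrtr-∷ r M i a@(i′ ∷ a′) = begin
  ∑comp (suc k) (λ J → r ^ℚ (suc k ℕ.∸ length J) * (q ^ℚ (i ℕ.+ 0) * ζtr M (blockSums J a)))
    + ∑comp (suc k) (λ J → r ^ℚ (suc (suc k) ℕ.∸ length (bump J)) * Δζtr M (blockSums (bump J) (i ∷ a)))
    ≡⟨ cong₂ _+_ (∑comp-cong (suc k) (λ J _ → trans (cong (λ m → r ^ℚ (suc k ℕ.∸ length J) * (q ^ℚ m * ζtr M (blockSums J a))) (ℕP.+-identityʳ i))
                    (solve 3 (λ x y z → x :* (y :* z) := y :* (x :* z)) refl (r ^ℚ (suc k ℕ.∸ length J)) (q ^ℚ i) (ζtr M (blockSums J a)))))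
                 (∑comp-cong-suc k raise) ⟩
  ∑comp (suc k) (λ J → q ^ℚ i * (r ^ℚ (suc k ℕ.∸ length J) * ζtr M (blockSums J a)))
    + ∑comp (suc k) (λ J → q ^ℚ i * r * (r ^ℚ (suc k ℕ.∸ length J) * Δζtr M (blockSums J a)))
    ≡⟨ cong₂ _+_ (∑comp-* (suc k) (q ^ℚ i) (λ J → r ^ℚ (suc k ℕ.∸ length J) * ζtr M (blockSums J a)))
                 (∑comp-* (suc k) (q ^ℚ i * r) (λ J → r ^ℚ (suc k ℕ.∸ length J) * Δζtr M (blockSums J a))) ⟩
  q ^ℚ i * ∑comp (suc k) (λ J → r ^ℚ (suc k ℕ.∸ length J) * ζtr M (blockSums J a)) + q ^ℚ i * r * Δζrtr r M a
    ≡⟨ cong (λ x → q ^ℚ i * x + q ^ℚ i * r * Δζrtr r M a) (ζrtr-∑comp r M a) ⟨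
  q ^ℚ i * ζrtr r M a + q ^ℚ i * r * Δζrtr r M a
    ≡⟨ solve 4 (λ q x r y → q :* x :+ q :* r :* y := q :* (x :+ r :* y)) refl (q ^ℚ i) (ζrtr r M a) r (Δζrtr r M a) ⟩
  q ^ℚ i * (ζrtr r M a + r * Δζrtr r M a) ∎
  where
  open ≡-Reasoning
  k : ℕ
  k = length a′
  q : ℚ
  q = recip M
  raise : ∀ j J → length J ≤ k →
    r ^ℚ (suc k ℕ.∸ length J) * (q ^ℚ (i ℕ.+ sumℕ (take j a)) * ζtr M (blockSums J (drop j a)))
    ≡ q ^ℚ i * r * (r ^ℚ (k ℕ.∸ length J) * (q ^ℚ (sumℕ (take j a)) * ζtr M (blockSums J (drop j a))))
  raise j J le = trans
    (cong₂ (λ x y → x * (y * ζtr M (blockSums J (drop j a)))) (cong (r ^ℚ_) (ℕP.+-∸-assoc 1 le)) (^ℚ-+ q i (sumℕ (take j a))))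
    (solve 5 (λ r x y z w → r :* x :* (y :* z :* w) := y :* r :* (x :* (z :* w))) refl
      r (r ^ℚ (k ℕ.∸ length J)) (q ^ℚ i) (q ^ℚ (sumℕ (take j a))) (ζtr M (blockSums J (drop j a))))

-- `y` marks the number of parts. With the condition passed as a separate Boolean, the same
-- recursions serve with and without `headGt1`.
weigh : ℚ → Bool → (List ℕ → ℚ) → List ℕ → ℚ
weigh y b h a = if b then y ^ℚ length a * h a else 0ℚ

weigh-ζrtr-suc : ∀ y b M a → weigh y b (ζrtr half (suc M)) a ≡ weigh y b (ζrtr half M) a + weigh y b (Δζrtr half M) a
weigh-ζrtr-suc y true M a  = trans (cong (y ^ℚ length a *_) (ζrtr-suc half M a)) (*-distribˡ-+ (y ^ℚ length a) (ζrtr half M a) (Δζrtr half M a))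
weigh-ζrtr-suc y false M a = refl

oddSum oddIncrement oddSum>1 : ℚ → ℕ → ℕ → ℚ
oddSum y M n       = ∑comp n (λ a → weigh y (allOdd a) (ζrtr half M) a)
oddIncrement y M n = ∑comp n (λ a → weigh y (allOdd a) (Δζrtr half M) a)
oddSum>1 y M n     = ∑comp n (λ a → weigh y (allOdd a ∧ headGt1 a) (ζrtr half M) a)

weigh-1∷ : ∀ y M b a → weigh y b (Δζrtr half M) (1 ∷ a) ≡
  y * recip M * (weigh y b (ζrtr half M) a + half * weigh y b (Δζrtr half M) a)
weigh-1∷ y M false a = solve 2 (λ y q → con 0ℚ := y :* q :* (con 0ℚ :+ con half :* con 0ℚ)) refl y (recip M)
weigh-1∷ y M true a  = trans (cong (y * y ^ℚ length a *_) (Δζrtr-∷ half M 1 a))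
  (solve 5 (λ y z q s d → y :* z :* (q :* con 1ℚ :* (s :+ con half :* d)) := y :* q :* (z :* s :+ con half :* (z :* d))) refl
    y (y ^ℚ length a) (recip M) (ζrtr half M a) (Δζrtr half M a))

weigh-raise : ∀ y M b i a → weigh y b (Δζrtr half M) (suc (suc i) ∷ a) ≡ recip M * recip M * weigh y b (Δζrtr half M) (i ∷ a)
weigh-raise y M false i a = sym (*-zeroʳ (recip M * recip M))
weigh-raise y M true i a  = begin
  z * Δζrtr half M (suc (suc i) ∷ a)      ≡⟨ cong (z *_) (Δζrtr-∷ half M (suc (suc i)) a) ⟩
  z * (q * (q * q ^ℚ i) * t)              ≡⟨ solve 4 (λ z q p t → z :* (q :* (q :* p) :* t) := q :* q :* (z :* (p :* t))) refl z q (q ^ℚ i) t ⟩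
  q * q * (z * (q ^ℚ i * t))              ≡⟨ cong (λ x → q * q * (z * x)) (Δζrtr-∷ half M i a) ⟨
  q * q * (z * Δζrtr half M (i ∷ a)) ∎
  where
  open ≡-Reasoning
  z q t : ℚ
  z = y ^ℚ suc (length a)
  q = recip M
  t = ζrtr half M a + half * Δζrtr half M a

first-1 : ∀ y M n → ∑comp n (λ a → weigh y (allOdd a) (Δζrtr half M) (1 ∷ a)) ≡ y * recip M * (oddSum y M n + half * oddIncrement y M n)
first-1 y M n = begin
  ∑comp n (λ a → weigh y (allOdd a) (Δζrtr half M) (1 ∷ a))
    ≡⟨ ∑comp-cong n (λ a _ → weigh-1∷ y M (allOdd a) a) ⟩
  ∑comp n (λ a → y * recip M * (s a + half * d a))
    ≡⟨ ∑comp-* n (y * recip M) (λ a → s a + half * d a) ⟩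
  y * recip M * ∑comp n (λ a → s a + half * d a)
    ≡⟨ cong (y * recip M *_) (trans (∑comp-+ n s (λ a → half * d a)) (cong (∑comp n s +_) (∑comp-* n half d))) ⟩
  y * recip M * (oddSum y M n + half * oddIncrement y M n) ∎
  where
  open ≡-Reasoning
  s d : List ℕ → ℚ
  s a = weigh y (allOdd a) (ζrtr half M) a
  d a = weigh y (allOdd a) (Δζrtr half M) a

oddIncrement-1 : ∀ y M → oddIncrement y M 1 ≡ y * recip M * (oddSum y M 0 + half * oddIncrement y M 0)
oddIncrement-1 y M = first-1 y M 0

-- An odd first part is 1 or exceeds a smaller odd one by 2, and raising it by 2 costs the factor
-- `recip M * recip M`.
oddIncrement-suc-suc : ∀ y M n → oddIncrement y M (suc (suc n)) ≡
  y * recip M * (oddSum y M (suc n) + half * oddIncrement y M (suc n)) + recip M * recip M * oddIncrement y M n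
oddIncrement-suc-suc y M n = cong₂ _+_ (first-1 y M (suc n)) (raised n)
  where
  w : List ℕ → ℚ
  w a = weigh y (allOdd a) (Δζrtr half M) a
  raised : ∀ n → ∑comp (suc n) (w ∘ bump) ≡ recip M * recip M * oddIncrement y M n
  raised zero    = sym (*-zeroʳ (recip M * recip M))
  raised (suc n) = begin
    -- A first part 1 raised once is the even number 2, hence the zero summand; all other
    -- compositions are raised twice.
    ∑comp (suc n) (λ a → 0ℚ) + ∑comp (suc n) (w ∘ bump ∘ bump)
      ≡⟨ cong₂ _+_ (∑comp-0 (suc n)) (∑comp-cong-suc n (λ i a _ → weigh-raise y M (allOdd (i ∷ a)) i a)) ⟩
    0ℚ + ∑comp (suc n) (λ a → recip M * recip M * w a)
      ≡⟨ trans (+-identityˡ (∑comp (suc n) (λ a → recip M * recip M * w a))) (∑comp-* (suc n) (recip M * recip M) w) ⟩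
    recip M * recip M * ∑comp (suc n) w ∎
    where open ≡-Reasoning

oddSum-suc : ∀ y M n → oddSum y (suc M) n ≡ oddSum y M n + oddIncrement y M n
oddSum-suc y M n = trans (∑comp-cong n (λ a _ → weigh-ζrtr-suc y (allOdd a) M a))
  (∑comp-+ n (λ a → weigh y (allOdd a) (ζrtr half M) a) (λ a → weigh y (allOdd a) (Δζrtr half M) a))

weigh-ζrtr-0 : ∀ y b i a → weigh y b (ζrtr half 0) (i ∷ a) ≡ 0ℚ
weigh-ζrtr-0 y false i a = refl
weigh-ζrtr-0 y true i a  = trans (cong (y ^ℚ suc (length a) *_) (ζrtr-0 half i a)) (*-zeroʳ (y ^ℚ suc (length a)))

oddSum-0-suc : ∀ y n → oddSum y 0 (suc n) ≡ 0ℚ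
oddSum-0-suc y n = ∑comp-zero n (λ i a → weigh-ζrtr-0 y (allOdd (i ∷ a)) i a)

oddSum>1-0 : ∀ y n → oddSum>1 y 0 n ≡ 0ℚ
oddSum>1-0 y zero    = refl
oddSum>1-0 y (suc n) = ∑comp-zero n (λ i a → weigh-ζrtr-0 y (allOdd (i ∷ a) ∧ headGt1 (i ∷ a)) i a)

∧-false : ∀ b → (b ∧ false) ≡ false
∧-false true  = refl
∧-false false = refl

∧-true : ∀ b → (b ∧ true) ≡ b
∧-true true  = refl
∧-true false = refl

-- As for `oddIncrement`, but `headGt1` removes the first part 1, so only the quadratic term
-- remains.
oddSum>1-suc : ∀ y M n → oddSum>1 y (suc M) (suc (suc n)) ≡ oddSum>1 y M (suc (suc n)) + recip M * recip M * oddIncrement y M n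
oddSum>1-suc y M n = trans
  (∑comp-cong (suc (suc n)) (λ a _ → weigh-ζrtr-suc y (allOdd a ∧ headGt1 a) M a))
  (trans (∑comp-+ (suc (suc n)) (λ a → weigh y (allOdd a ∧ headGt1 a) (ζrtr half M) a) w)
  (cong (oddSum>1 y M (suc (suc n)) +_) (begin
    ∑comp (suc n) (w ∘ (1 ∷_)) + ∑comp (suc n) (w ∘ bump)
      ≡⟨ cong₂ _+_ (∑comp-zero n (λ i a → cong (λ b → weigh y b (Δζrtr half M) (1 ∷ i ∷ a)) (∧-false (allOdd (i ∷ a))))) (raised n) ⟩
    0ℚ + recip M * recip M * oddIncrement y M n
      ≡⟨ +-identityˡ (recip M * recip M * oddIncrement y M n) ⟩
    recip M * recip M * oddIncrement y M n ∎)))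
  where
  open ≡-Reasoning
  w : List ℕ → ℚ
  w a = weigh y (allOdd a ∧ headGt1 a) (Δζrtr half M) a
  raised : ∀ n → ∑comp (suc n) (w ∘ bump) ≡ recip M * recip M * oddIncrement y M n
  raised zero    = sym (*-zeroʳ (recip M * recip M))
  raised (suc n) = begin
    ∑comp (suc n) (λ a → 0ℚ) + ∑comp (suc n) (w ∘ bump ∘ bump)
      ≡⟨ cong₂ _+_ (∑comp-0 (suc n)) (∑comp-cong-suc n (λ i a _ → trans
           (cong (λ b → weigh y b (Δζrtr half M) (suc (suc i) ∷ a)) (∧-true (allOdd (i ∷ a))))
           (weigh-raise y M (allOdd (i ∷ a)) i a))) ⟩
    0ℚ + ∑comp (suc n) (λ a → recip M * recip M * weigh y (allOdd a) (Δζrtr half M) a)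
      ≡⟨ trans (+-identityˡ _) (∑comp-* (suc n) (recip M * recip M) (λ a → weigh y (allOdd a) (Δζrtr half M) a)) ⟩
    recip M * recip M * oddIncrement y M (suc n) ∎

sumℚ-filterB : ∀ (p : List ℕ → Bool) (f : List ℕ → ℚ) xs →
  sumℚ (map f (filterB p xs)) ≡ sumℚ (map (λ a → if p a then f a else 0ℚ) xs)
sumℚ-filterB p f []       = refl
sumℚ-filterB p f (x ∷ xs) with p x
... | true  = cong (f x +_) (sumℚ-filterB p f xs)
... | false = trans (sumℚ-filterB p f xs) (sym (+-identityˡ (sumℚ (map (λ a → if p a then f a else 0ℚ) xs))))

eval-cong : ∀ d {p p′ : ℕ → ℚ} t → (∀ i → i < d → p i ≡ p′ i) → eval d p t ≡ eval d p′ t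
eval-cong zero t h    = refl
eval-cong (suc d) t h = cong₂ (λ x y → x + t * y) (h 0 (s≤s z≤n)) (eval-cong d t (λ i lt → h (suc i) (s≤s lt)))

eval-0 : ∀ d t → eval d (λ _ → 0ℚ) t ≡ 0ℚ
eval-0 zero t    = refl
eval-0 (suc d) t = trans (cong (λ x → 0ℚ + t * x) (eval-0 d t)) (trans (+-identityˡ (t * 0ℚ)) (*-zeroʳ t))

eval-∑comp : ∀ d n (g : ℕ → List ℕ → ℚ) t → eval d (λ l → ∑comp n (g l)) t ≡ ∑comp n (λ a → eval d (λ l → g l a) t)
eval-∑comp zero n g t    = sym (∑comp-0 n)
eval-∑comp (suc d) n g t = begin
  ∑comp n (g 0) + t * eval d (λ l → ∑comp n (g (suc l))) t       ≡⟨ cong (λ x → ∑comp n (g 0) + t * x) (eval-∑comp d n (g ∘ suc) t) ⟩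
  ∑comp n (g 0) + t * ∑comp n h                                  ≡⟨ cong (∑comp n (g 0) +_) (∑comp-* n t h) ⟨
  ∑comp n (g 0) + ∑comp n (λ a → t * h a)                        ≡⟨ ∑comp-+ n (g 0) (λ a → t * h a) ⟨
  ∑comp n (λ a → g 0 a + t * h a) ∎
  where
  open ≡-Reasoning
  h : List ℕ → ℚ
  h a = eval d (λ l → g (suc l) a) t

eval-single : ∀ d k z t → k < d → eval d (λ l → if does (k ℕP.≟ l) then z else 0ℚ) t ≡ t ^ℚ k * z
eval-single (suc d) zero z t _          = trans (cong (λ x → z + t * x) (eval-0 d t))
  (solve 2 (λ z t → z :+ t :* con 0ℚ := con 1ℚ :* z) refl z t)
eval-single (suc d) (suc k) z t (s≤s lt) = trans (cong (λ x → 0ℚ + t * x) (eval-single d k z t lt))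
  (solve 3 (λ t p z → con 0ℚ :+ t :* (p :* z) := t :* p :* z) refl t (t ^ℚ k) z)

-- A composition of `n` has at most `n` parts, so `suc n` coefficients capture every length; for
-- each composition exactly one power of `y` survives.
lhsTr-generating : ∀ n N y → eval (suc n) (λ l → lhsTr n l N) y ≡ oddSum>1 y N n
lhsTr-generating n N y = begin
  eval (suc n) (λ l → lhsTr n l N) y
    ≡⟨ eval-cong (suc n) y (λ l _ → trans (sumℚ-filterB (λ a → hasLength l a ∧ allOdd a ∧ headGt1 a) (ζrtr half N) (compositions n))
         (compositions-sum n (g l))) ⟩
  eval (suc n) (λ l → ∑comp n (g l)) y
    ≡⟨ eval-∑comp (suc n) n g y ⟩
  ∑comp n (λ a → eval (suc n) (λ l → g l a) y)
    ≡⟨ ∑comp-cong n (λ a le → by-length (allOdd a ∧ headGt1 a) a le) ⟩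
  oddSum>1 y N n ∎
  where
  open ≡-Reasoning
  g : ℕ → List ℕ → ℚ
  g l a = if hasLength l a ∧ allOdd a ∧ headGt1 a then ζrtr half N a else 0ℚ
  by-length : ∀ b a → length a ≤ n →
    eval (suc n) (λ l → if hasLength l a ∧ b then ζrtr half N a else 0ℚ) y ≡ weigh y b (ζrtr half N) a
  by-length true a le  = trans
    (eval-cong (suc n) y (λ l _ → cong (λ b → if b then ζrtr half N a else 0ℚ) (∧-true (hasLength l a))))
    (eval-single (suc n) (length a) (ζrtr half N a) y (s≤s le))
  by-length false a le = trans
    (eval-cong (suc n) y (λ l _ → cong (λ b → if b then ζrtr half N a else 0ℚ) (∧-false (hasLength l a))))
    (eval-0 (suc n) y)

-- Generating series

scaled : ℚ → (ℕ → ℚ) → Series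
scaled ρ f n = ρ ^ℚ n * f n

linear-cong : ∀ {p q} → p ≡ q → linear p ≈ linear q
linear-cong refl = ≈-refl

linear-* : ∀ p β → linear (p * β) ≈ const p ⊛ linear β
linear-* p β = pointwise λ
  { zero    → trans (linear-zero (p * β)) (sym (trans (const-⊛-at p (linear β) 0) (trans (cong (p *_) (linear-zero β)) (*-zeroʳ p))))
  ; (suc n) → trans (linear-suc (p * β) n) (trans (at (const-⊛-const p β) n) (trans (const-⊛-at p (const β) n)
      (sym (trans (const-⊛-at p (linear β) (suc n)) (cong (p *_) (linear-suc β n)))))) }

linear-⊛-linear : ∀ p q → linear p ⊛ linear q ≈ const (p * q) ⊛ (linear 1ℚ ⊛ linear 1ℚ)
linear-⊛-linear p q = ≈-trans (⊛-cong (unit p) (unit q))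
  (≈-trans (S.solve 3 (λ p q x → p S.:* x S.:* (q S.:* x) S.:= p S.:* q S.:* (x S.:* x)) ≈-refl (const p) (const q) (linear 1ℚ))
  (⊛-cong (≈-sym (const-⊛-const p q)) ≈-refl))
  where
  unit : ∀ p → linear p ≈ const p ⊛ linear 1ℚ
  unit p = ≈-trans (linear-cong (sym (*-identityʳ p))) (linear-* p 1ℚ)

cancel-unit : ∀ {f g} u v → u ⊛ v ≈ const 1ℚ → u ⊛ f ≈ u ⊛ g → f ≈ g
cancel-unit {f} {g} u v uv eq = ≈-trans (cancel (⊝ f) uv
    (S.solve 3 (λ f u v → f S.:= v S.:* (u S.:* f) S.:+ S.:- f S.:* (u S.:* v S.:- S.con 1ℚ)) ≈-refl f u v))
  (≈-trans (⊛-cong ≈-refl eq)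
  (cancel g uv (S.solve 3 (λ g u v → v S.:* (u S.:* g) S.:= g S.:+ g S.:* (u S.:* v S.:- S.con 1ℚ)) ≈-refl g u v)))

module Generating (ρ y β γ : ℚ) (sum-eq : ℕ→ℚ 2 * (β + γ) ≡ ρ * y) (product-eq : β * γ ≡ - (ρ * ρ)) where

  b c s R : Series
  b = linear β
  c = linear γ
  s = b ⊕ c
  R = linear ρ

  Sₓ Dₓ Lₓ : ℕ → Series
  Sₓ M = scaled ρ (oddSum y M)
  Dₓ M = scaled ρ (oddIncrement y M)
  Lₓ M = scaled ρ (oddSum>1 y M)

  R² : R ⊛ R ≈ ⊝ (b ⊛ c)
  R² = ≈-trans (linear-⊛-linear ρ ρ)
    (≈-trans (⊛-cong (≈-trans (const-cong (trans (solve 1 (λ x → x := :- (:- x)) refl (ρ * ρ)) (cong -_ (sym product-eq)))) (const-neg (β * γ))) ≈-refl)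
    (≈-trans (S.solve 2 (λ p x → S.:- p S.:* x S.:= S.:- (p S.:* x)) ≈-refl (const (β * γ)) (linear 1ℚ ⊛ linear 1ℚ))
    (⊝-cong (≈-sym (linear-⊛-linear β γ)))))

  linear-ρyq : ∀ q → linear (q * (ρ * y)) ≈ const q ⊛ (const (ℕ→ℚ 2) ⊛ s)
  linear-ρyq q = ≈-trans (linear-* q (ρ * y)) (⊛-cong ≈-refl
    (≈-trans (linear-cong (sym sum-eq)) (≈-trans (linear-* (ℕ→ℚ 2) (β + γ)) (⊛-cong ≈-refl (linear-+ β γ)))))

  R-R-at-1 : ∀ f → (R ⊛ (R ⊛ f)) 1 ≡ 0ℚ
  R-R-at-1 f = trans (linear-⊛-suc ρ (R ⊛ f) 0) (trans (cong (ρ *_) (linear-⊛-zero ρ f)) (*-zeroʳ ρ))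

  R-R-at : ∀ f n → (R ⊛ (R ⊛ f)) (suc (suc n)) ≡ ρ * (ρ * f n)
  R-R-at f n = trans (linear-⊛-suc ρ (R ⊛ f) (suc n)) (cong (ρ *_) (linear-⊛-suc ρ f n))

  D-step : ∀ M → Dₓ M ≈ linear (recip M * (ρ * y)) ⊛ (Sₓ M ⊕ const half ⊛ Dₓ M) ⊕ const (recip M * recip M) ⊛ (R ⊛ (R ⊛ Dₓ M))
  D-step M = pointwise λ n → trans (coefficient n) (sym (⊕-at (linear (q * (ρ * y)) ⊛ (Sₓ M ⊕ const half ⊛ Dₓ M)) (const (q * q) ⊛ (R ⊛ (R ⊛ Dₓ M))) n))
    where
    open ≡-Reasoning
    q : ℚ
    q = recip M
    inner : ∀ n → (linear (q * (ρ * y)) ⊛ (Sₓ M ⊕ const half ⊛ Dₓ M)) (suc n) ≡ q * (ρ * y) * (Sₓ M n + half * Dₓ M n)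
    inner n = trans (linear-⊛-suc (q * (ρ * y)) (Sₓ M ⊕ const half ⊛ Dₓ M) n)
      (cong (q * (ρ * y) *_) (trans (⊕-at (Sₓ M) (const half ⊛ Dₓ M) n) (cong (Sₓ M n +_) (const-⊛-at half (Dₓ M) n))))
    coefficient : ∀ n → Dₓ M n ≡ (linear (q * (ρ * y)) ⊛ (Sₓ M ⊕ const half ⊛ Dₓ M)) n + (const (q * q) ⊛ (R ⊛ (R ⊛ Dₓ M))) n
    coefficient zero = sym (trans (cong₂ _+_ (linear-⊛-zero (q * (ρ * y)) (Sₓ M ⊕ const half ⊛ Dₓ M))
        (trans (const-⊛-at (q * q) (R ⊛ (R ⊛ Dₓ M)) 0) (trans (cong (q * q *_) (linear-⊛-zero ρ (R ⊛ Dₓ M))) (*-zeroʳ (q * q)))))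
      (+-identityʳ 0ℚ))
    coefficient (suc zero) = begin
      ρ * 1ℚ * oddIncrement y M 1    ≡⟨ cong (ρ * 1ℚ *_) (oddIncrement-1 y M) ⟩
      ρ * 1ℚ * (y * q * (s₀ + half * d₀))
        ≡⟨ solve 6 (λ r y q s d z → r :* con 1ℚ :* (y :* q :* (s :+ con half :* d)) := q :* (r :* y) :* (con 1ℚ :* s :+ con half :* (con 1ℚ :* d)) :+ q :* q :* con 0ℚ) refl ρ y q s₀ d₀ 0ℚ ⟩
      q * (ρ * y) * (1ℚ * s₀ + half * (1ℚ * d₀)) + q * q * 0ℚ
        ≡⟨ cong₂ _+_ (inner 0) (trans (const-⊛-at (q * q) (R ⊛ (R ⊛ Dₓ M)) 1) (cong (q * q *_) (R-R-at-1 (Dₓ M)))) ⟨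
      _ ∎
      where
      s₀ d₀ : ℚ
      s₀ = oddSum y M 0
      d₀ = oddIncrement y M 0
    coefficient (suc (suc n)) = begin
      ρ * (ρ * p) * oddIncrement y M (suc (suc n)) ≡⟨ cong (ρ * (ρ * p) *_) (oddIncrement-suc-suc y M n) ⟩
      ρ * (ρ * p) * (y * q * (s₁ + half * d₁) + q * q * d₀)
        ≡⟨ solve 7 (λ r p y q s d e → r :* (r :* p) :* (y :* q :* (s :+ con half :* d) :+ q :* q :* e) := q :* (r :* y) :* (r :* p :* s :+ con half :* (r :* p :* d)) :+ q :* q :* (r :* (r :* (p :* e)))) refl ρ p y q s₁ d₁ d₀ ⟩
      q * (ρ * y) * (ρ * p * s₁ + half * (ρ * p * d₁)) + q * q * (ρ * (ρ * (p * d₀)))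
        ≡⟨ cong₂ _+_ (inner (suc n)) (trans (const-⊛-at (q * q) (R ⊛ (R ⊛ Dₓ M)) (suc (suc n))) (cong (q * q *_) (R-R-at (Dₓ M) n))) ⟨
      _ ∎
      where
      p s₁ d₁ d₀ : ℚ
      p = ρ ^ℚ n
      s₁ = oddSum y M (suc n)
      d₁ = oddIncrement y M (suc n)
      d₀ = oddIncrement y M n

  S-suc : ∀ M → Sₓ (suc M) ≈ Sₓ M ⊕ Dₓ M
  S-suc M = pointwise λ n → trans (trans (cong (ρ ^ℚ n *_) (oddSum-suc y M n)) (*-distribˡ-+ (ρ ^ℚ n) (oddSum y M n) (oddIncrement y M n))) (sym (⊕-at (Sₓ M) (Dₓ M) n))

  S-0 : Sₓ 0 ≈ const 1ℚ
  S-0 = pointwise λ { zero → sym (const-zero 1ℚ)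
                    ; (suc n) → trans (cong (ρ ^ℚ suc n *_) (oddSum-0-suc y n)) (trans (*-zeroʳ (ρ ^ℚ suc n)) (sym (const-suc 1ℚ n))) }

  L-0 : Lₓ 0 ≈ const 0ℚ
  L-0 = pointwise λ n → trans (cong (ρ ^ℚ n *_) (oddSum>1-0 y n)) (trans (*-zeroʳ (ρ ^ℚ n)) (sym (const-0 n)))

  L-suc : ∀ M → Lₓ (suc M) ≈ Lₓ M ⊕ const (recip M * recip M) ⊛ (R ⊛ (R ⊛ Dₓ M))
  L-suc M = pointwise λ n → trans (coefficient n) (sym (trans (⊕-at (Lₓ M) (const (q * q) ⊛ (R ⊛ (R ⊛ Dₓ M))) n)
      (cong (Lₓ M n +_) (const-⊛-at (q * q) (R ⊛ (R ⊛ Dₓ M)) n))))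
    where
    q : ℚ
    q = recip M
    coefficient : ∀ n → Lₓ (suc M) n ≡ Lₓ M n + q * q * (R ⊛ (R ⊛ Dₓ M)) n
    coefficient zero = sym (trans (cong (λ x → 0ℚ + q * q * x) (linear-⊛-zero ρ (R ⊛ Dₓ M)))
      (solve 1 (λ q → con 0ℚ :+ q :* q :* con 0ℚ := con 0ℚ) refl q))
    coefficient (suc zero) = sym (trans (cong (λ x → ρ * 1ℚ * 0ℚ + q * q * x) (R-R-at-1 (Dₓ M)))
      (solve 2 (λ r q → r :* con 1ℚ :* con 0ℚ :+ q :* q :* con 0ℚ := r :* con 1ℚ :* con 0ℚ) refl ρ q))
    coefficient (suc (suc n)) = trans (cong (ρ ^ℚ suc (suc n) *_) (oddSum>1-suc y M n))
      (trans (solve 5 (λ r p q l d → r :* (r :* p) :* (l :+ q :* q :* d) := r :* (r :* p) :* l :+ q :* q :* (r :* (r :* (p :* d)))) refl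
          ρ (ρ ^ℚ n) q (oddSum>1 y M (suc (suc n))) (oddIncrement y M n))
        (cong (λ x → Lₓ M (suc (suc n)) + q * q * x) (sym (R-R-at (Dₓ M) n))))

  unit inverse : ℕ → Series
  unit M    = (K (suc M) ⊖ b) ⊛ (K (suc M) ⊖ c)
  inverse M = geom β M ⊛ geom γ M

  unit-inverse : ∀ M → unit M ⊛ inverse M ≈ const 1ℚ
  unit-inverse M = ≈-trans
    (S.solve 4 (λ u v g h → u S.:* v S.:* (g S.:* h) S.:= u S.:* g S.:* (v S.:* h)) ≈-refl (K (suc M) ⊖ b) (K (suc M) ⊖ c) (geom β M) (geom γ M))
    (≈-trans (⊛-cong (geom-inverse β M) (geom-inverse γ M)) (S.solve 0 (S.con 1ℚ S.:* S.con 1ℚ S.:= S.con 1ℚ) ≈-refl))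

  -- `D-step` times k², with the `half` term moved to the left, reads
  -- `(k² - k s + b c) D = 2 k s S`. The conditions on the sum and product of `β` and `γ` serve to
  -- factor the left as `(k - b)(k - c)`.
  unit-D : ∀ M → unit M ⊛ Dₓ M ≈ const (ℕ→ℚ 2) ⊛ (K (suc M) ⊛ s ⊛ Sₓ M)
  unit-D M = ≈-trans
    (S.solve 4 (λ k b c d → (k S.:- b) S.:* (k S.:- c) S.:* d S.:= k S.:* k S.:* d S.:- (k S.:* (b S.:+ c) S.:- b S.:* c) S.:* d) ≈-refl k b c (Dₓ M))
    (≈-trans (⊕-cong (⊛-cong ≈-refl (≈-trans (D-step M) (⊕-cong (⊛-cong (linear-ρyq (recip M)) ≈-refl)
       (≈-trans (⊛-cong (const-⊛-const (recip M) (recip M)) (≈-sym (⊛-assoc R R (Dₓ M)))) (⊛-cong ≈-refl (⊛-cong R² ≈-refl)))))) ≈-refl)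
    (cancel (k ⊛ (const (ℕ→ℚ 2) ⊛ s) ⊛ (Sₓ M ⊕ const half ⊛ Dₓ M) ⊖ (k ⊛ q ⊕ const 1ℚ) ⊛ b ⊛ c ⊛ Dₓ M) (K-recip M)
    (S.solve 6 (λ k q b c S D → let two = S.con (ℕ→ℚ 2) ; h = S.con half ; one = S.con 1ℚ ; s = b S.:+ c in
        k S.:* k S.:* (q S.:* (two S.:* s) S.:* (S S.:+ h S.:* D) S.:+ q S.:* q S.:* (S.:- (b S.:* c) S.:* D))
          S.:- (k S.:* s S.:- b S.:* c) S.:* D
        S.:= two S.:* (k S.:* s S.:* S)
          S.:+ (k S.:* (two S.:* s) S.:* (S S.:+ h S.:* D) S.:- (k S.:* q S.:+ one) S.:* b S.:* c S.:* D) S.:* (k S.:* q S.:- one))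
      ≈-refl k q b c (Sₓ M) (Dₓ M))))
    where
    k q : Series
    k = K (suc M)
    q = const (recip M)

  AB : ℕ → Series
  AB m = A β m ⊛ B γ 0 m

  AB-step : ∀ m → unit m ⊛ AB (suc m) ≈ AB m ⊛ ((K m ⊕ b) ⊛ (K m ⊕ c))
  AB-step m = ≈-trans
    (⊛-cong ≈-refl (⊛-cong ≈-refl (⊛-cong ≈-refl (pointwise λ i → cong (λ l → geom γ l i) (ℕP.+-identityʳ m)))))
    (cancel (AB m ⊛ ((K m ⊕ b) ⊛ (K m ⊕ c))) (unit-inverse m)
    (S.solve 7 (λ k b c a B g h → let one = S.con 1ℚ ; u = (k S.:+ one S.:- b) S.:* (k S.:+ one S.:- c) in
        u S.:* (a S.:* (k S.:+ b) S.:* g S.:* (B S.:* (k S.:- S.con 0ℚ S.:+ c) S.:* h)) S.:=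
        a S.:* B S.:* ((k S.:+ b) S.:* (k S.:+ c)) S.:+ a S.:* B S.:* ((k S.:+ b) S.:* (k S.:+ c)) S.:* (u S.:* (g S.:* h) S.:- one))
      ≈-refl (K m) b c (A β m) (B γ 0 m) (geom β m) (geom γ m)))

  -- By `(k - b)(k - c) + 2k(b + c) = (k + b)(k + c)`, `S` is the product of `(k + b)(k + c) / ((k -
  -- b)(k - c))` over 1 ≤ k ≤ M. The factor `b c` is the missing numerator at k = 0. It is also what
  -- `L` provides, since `R ⊛ R` is `- b c`, so the non-unit `b c` is never divided out.
  bcS : ∀ M → b ⊛ c ⊛ Sₓ M ≈ unit M ⊛ AB (suc M)
  bcD : ∀ M → b ⊛ c ⊛ Dₓ M ≈ const (ℕ→ℚ 2) ⊛ (K (suc M) ⊛ s ⊛ AB (suc M))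

  bcD M = cancel-unit (unit M) (inverse M) (unit-inverse M)
    (≈-trans (S.solve 4 (λ b c u d → u S.:* (b S.:* c S.:* d) S.:= b S.:* c S.:* (u S.:* d)) ≈-refl b c (unit M) (Dₓ M))
    (≈-trans (⊛-cong ≈-refl (unit-D M))
    (≈-trans (S.solve 4 (λ b c k S → let two = S.con (ℕ→ℚ 2) in b S.:* c S.:* (two S.:* (k S.:* (b S.:+ c) S.:* S)) S.:= two S.:* (k S.:* (b S.:+ c)) S.:* (b S.:* c S.:* S)) ≈-refl b c (K (suc M)) (Sₓ M))
    (≈-trans (⊛-cong ≈-refl (bcS M))
    (S.solve 4 (λ k s u a → let two = S.con (ℕ→ℚ 2) in two S.:* (k S.:* s) S.:* (u S.:* a) S.:= u S.:* (two S.:* (k S.:* s S.:* a))) ≈-refl (K (suc M)) s (unit M) (AB (suc M)))))))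

  bcS zero    = ≈-trans (⊛-cong ≈-refl S-0) (≈-trans
    (S.solve 2 (λ b c → b S.:* c S.:* S.con 1ℚ S.:= S.con 1ℚ S.:* S.con 1ℚ S.:* ((S.con 0ℚ S.:+ b) S.:* (S.con 0ℚ S.:+ c))) ≈-refl b c)
    (≈-sym (AB-step 0)))
  bcS (suc M) = ≈-trans (⊛-cong ≈-refl (S-suc M))
    (≈-trans (S.solve 4 (λ b c x y → b S.:* c S.:* (x S.:+ y) S.:= b S.:* c S.:* x S.:+ b S.:* c S.:* y) ≈-refl b c (Sₓ M) (Dₓ M))
    (≈-trans (⊕-cong (bcS M) (bcD M))
    (≈-trans (S.solve 4 (λ k b c a → (k S.:- b) S.:* (k S.:- c) S.:* a S.:+ S.con (ℕ→ℚ 2) S.:* (k S.:* (b S.:+ c) S.:* a) S.:= a S.:* ((k S.:+ b) S.:* (k S.:+ c))) ≈-refl (K (suc M)) b c (AB (suc M)))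
    (≈-sym (AB-step (suc M))))))

  L-sum : ∀ N → Lₓ N ≈ ⊝ (const (ℕ→ℚ 2) ⊛ s ⊛ sumS N (F β γ 0))
  L-sum zero    = ≈-trans L-0 (S.solve 1 (λ s → S.con 0ℚ S.:= S.:- (S.con (ℕ→ℚ 2) S.:* s S.:* S.con 0ℚ)) ≈-refl s)
  L-sum (suc M) = ≈-trans (L-suc M)
    (≈-trans (⊕-cong (L-sum M) (≈-trans (⊛-cong (const-⊛-const (recip M) (recip M)) (≈-trans (≈-sym (⊛-assoc R R (Dₓ M))) (⊛-cong R² ≈-refl)))
      (≈-trans (S.solve 4 (λ q b c d → q S.:* q S.:* (S.:- (b S.:* c) S.:* d) S.:= S.:- (q S.:* q) S.:* (b S.:* c S.:* d)) ≈-refl q b c (Dₓ M))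
      (⊛-cong ≈-refl (bcD M)))))
    (cancel (⊝ (q ⊛ const (ℕ→ℚ 2) ⊛ s ⊛ AB (suc M))) (K-recip M)
    (S.solve 6 (λ s f q k a B → let two = S.con (ℕ→ℚ 2) in
        S.:- (two S.:* s S.:* f) S.:+ S.:- (q S.:* q) S.:* (two S.:* (k S.:* s S.:* (a S.:* B))) S.:=
        S.:- (two S.:* s S.:* (f S.:+ q S.:* a S.:* B)) S.:+ S.:- (q S.:* two S.:* s S.:* (a S.:* B)) S.:* (k S.:* q S.:- S.con 1ℚ))
      ≈-refl s (sumS M (F β γ 0)) q (K (suc M)) (A β (suc M)) (B γ 0 (suc M)))))
    where
    q : Series
    q = const (recip M)

geom-^ : ∀ β j n → geom β j n ≡ recip j ^ℚ suc n * β ^ℚ n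
geom-^ β j zero    = solve 1 (λ r → r := r :* con 1ℚ :* con 1ℚ) refl (recip j)
geom-^ β j (suc n) = trans (cong (λ x → recip j * (β * x)) (geom-^ β j n))
  (solve 4 (λ r b p q → r :* (b :* (r :* p :* q)) := r :* (r :* p) :* (b :* q)) refl (recip j) β (recip j ^ℚ n) (β ^ℚ n))

sumS-coefficient : ∀ N n f g c → (∀ j → f j n ≡ g (suc j) * c) → sumS N f n ≡ sum1to N g * c
sumS-coefficient zero n f g c h    = trans (const-0 n) (sym (*-zeroˡ c))
sumS-coefficient (suc N) n f g c h = trans (⊕-at (sumS N f) (f N) n)
  (trans (cong₂ _+_ (sumS-coefficient N n f g c h) (h N)) (sym (*-distribʳ-+ c (sum1to N g) (g (suc N)))))

module _ (ρ y β γ : ℚ) (sum-eq : ℕ→ℚ 2 * (β + γ) ≡ ρ * y) (product-eq : β * γ ≡ - (ρ * ρ)) where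

  open Generating ρ y β γ sum-eq product-eq

  σ : ℚ
  σ = β + γ

  mainCoefficient : ℕ → ℚ
  mainCoefficient n = σ * (β ^ℚ suc n + γ ^ℚ suc n - σ ^ℚ suc n)

  main-sum : ∀ N → ⊝ (const (ℕ→ℚ 2) ⊛ s ⊛ sumS N (mainTerm β γ)) ≈
    sumS N (λ j → linear σ ⊛ (geom β j ⊕ geom γ j ⊖ geom σ j ⊖ geom 0ℚ j))
  main-sum N = ≈-trans
    (S.solve 2 (λ s m → S.:- (S.con (ℕ→ℚ 2) S.:* s S.:* m) S.:= S.con (- ℕ→ℚ 2) S.:* s S.:* m) ≈-refl s (sumS N (mainTerm β γ)))
    (≈-trans (≈-sym (sumS-scale N (const (- ℕ→ℚ 2) ⊛ s) (mainTerm β γ)))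
    (sumS-cong N (λ j → ≈-trans
      (S.solve 5 (λ s gs gc gb go → S.con (- ℕ→ℚ 2) S.:* s S.:* (S.con half S.:* (gs S.:- gc S.:- (gb S.:- go))) S.:= s S.:* (gb S.:+ gc S.:- gs S.:- go))
        ≈-refl s (geom σ j) (geom γ j) (geom β j) (geom 0ℚ j))
      (⊛-cong (≈-sym (linear-+ β γ)) ≈-refl))))

  main-coefficient : ∀ N n → (⊝ (const (ℕ→ℚ 2) ⊛ s ⊛ sumS N (mainTerm β γ))) (suc (suc n)) ≡
    ζtr N (suc (suc n) ∷ []) * mainCoefficient n
  main-coefficient N n = trans (at (main-sum N) (suc (suc n)))
    (sumS-coefficient N (suc (suc n)) _ (λ m → recip (m ℕ.∸ 1) ^ℚ suc (suc n) * 1ℚ) (mainCoefficient n) term)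
    where
    open ≡-Reasoning
    term : ∀ j → (linear σ ⊛ (geom β j ⊕ geom γ j ⊖ geom σ j ⊖ geom 0ℚ j)) (suc (suc n)) ≡
      recip j ^ℚ suc (suc n) * 1ℚ * mainCoefficient n
    term j = begin
      (linear σ ⊛ (geom β j ⊕ geom γ j ⊖ geom σ j ⊖ geom 0ℚ j)) (suc (suc n))
        ≡⟨ linear-⊛-suc σ (geom β j ⊕ geom γ j ⊖ geom σ j ⊖ geom 0ℚ j) (suc n) ⟩
      σ * (geom β j ⊕ geom γ j ⊖ geom σ j ⊖ geom 0ℚ j) (suc n)
        ≡⟨ cong (σ *_) (trans (⊕-at (geom β j ⊕ geom γ j ⊖ geom σ j) (⊝ geom 0ℚ j) (suc n))
             (cong₂ _+_ (trans (⊕-at (geom β j ⊕ geom γ j) (⊝ geom σ j) (suc n))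
               (cong₂ _+_ (⊕-at (geom β j) (geom γ j) (suc n)) (⊝-at (geom σ j) (suc n)))) (⊝-at (geom 0ℚ j) (suc n)))) ⟩
      σ * (geom β j (suc n) + geom γ j (suc n) - geom σ j (suc n) - geom 0ℚ j (suc n))
        ≡⟨ cong (σ *_) (cong₂ _-_ (cong₂ _-_ (cong₂ _+_ (geom-^ β j (suc n)) (geom-^ γ j (suc n))) (geom-^ σ j (suc n))) (geom-^ 0ℚ j (suc n))) ⟩
      -- The last term vanishes: `geom 0ℚ j` is a constant series and the index is positive.
      σ * (r * β ^ℚ suc n + r * γ ^ℚ suc n - r * σ ^ℚ suc n - r * (0ℚ * 0ℚ ^ℚ n))
        ≡⟨ solve 6 (λ s r b c d z → s :* (r :* b :+ r :* c :- r :* d :- r :* (con 0ℚ :* z)) := r :* con 1ℚ :* (s :* (b :+ c :- d))) refl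
             σ r (β ^ℚ suc n) (γ ^ℚ suc n) (σ ^ℚ suc n) (0ℚ ^ℚ n) ⟩
      r * 1ℚ * (σ * (β ^ℚ suc n + γ ^ℚ suc n - σ ^ℚ suc n)) ∎
      where
      r : ℚ
      r = recip j ^ℚ suc (suc n)

  L-main-Small : ∣ β ∣ ≤ℚ eighth → ∣ γ ∣ ≤ℚ eighth → ∀ n →
    Small (λ N → ρ ^ℚ suc (suc n) * oddSum>1 y N (suc (suc n)) - ζtr N (suc (suc n) ∷ []) * mainCoefficient n)
  -- The constant collects the norm 2, the bound 1/8 + 1/8 for `s`, and the 3 of `error-bound`.
  L-main-Small β≤ γ≤ n = Small-≤ bound (Small-* (ℕ→ℚ 2 * quarter * ℕ→ℚ 3) δ-Small)
    where
    m : ℕ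
    m = suc (suc n)
    main error : ℕ → Series
    main N = ⊝ (const (ℕ→ℚ 2) ⊛ s ⊛ sumS N (mainTerm β γ))
    error N = ⊝ (const (ℕ→ℚ 2) ⊛ s ⊛ (errorF β γ N ⊖ errorG β γ N))
    error-bounded : ∀ N → Bounded (error N) (ℕ→ℚ 2 * quarter * (ℕ→ℚ 3 * δ N))
    error-bounded N = Bounded-⊝ (Bounded-⊛ (Bounded-⊛ (Bounded-const {ℕ→ℚ 2} ≤-refl)
      (Bounded-⊕ (Bounded-linear β≤) (Bounded-linear γ≤))) (error-bound β≤ γ≤ N))
    split : ∀ N → Lₓ N ≈ main N ⊕ error N
    split N = ≈-trans (L-sum N) (≈-trans (⊝-cong (⊛-cong ≈-refl (sumF β γ N)))
      (S.solve 3 (λ t f e → S.:- (t S.:* (f S.:+ e)) S.:= S.:- (t S.:* f) S.:+ S.:- (t S.:* e)) ≈-refl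
        (const (ℕ→ℚ 2) ⊛ s) (sumS N (mainTerm β γ)) (errorF β γ N ⊖ errorG β γ N)))
    bound : ∀ N → ∣ Lₓ N m - ζtr N (m ∷ []) * mainCoefficient n ∣ ≤ℚ ℕ→ℚ 2 * quarter * ℕ→ℚ 3 * δ N
    bound N = subst₂ _≤ℚ_ (cong ∣_∣ (sym (begin
        Lₓ N m - ζ                        ≡⟨ cong (_- ζ) (trans (at (split N) m) (⊕-at (main N) (error N) m)) ⟩
        main N m + error N m - ζ          ≡⟨ cong (λ x → x + error N m - ζ) (main-coefficient N n) ⟩
        ζ + error N m - ζ                 ≡⟨ solve 2 (λ z e → z :+ e :- z := e) refl ζ (error N m) ⟩
        error N m ∎)))
      (sym (*-assoc (ℕ→ℚ 2 * quarter) (ℕ→ℚ 3) (δ N)))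
      (coefficient-bound m (error-bounded N))
      where
      open ≡-Reasoning
      ζ : ℚ
      ζ = ζtr N (m ∷ []) * mainCoefficient n

-- Lucas polynomials and the binomial coefficients

-- lucasCoeff k i is the coefficient of zⁱ in aᵏ + (-1/a)ᵏ as a polynomial in z = a - 1/a.
lucasCoeff : ℕ → ℕ → ℚ
lucasCoeff zero          zero    = ℕ→ℚ 2
lucasCoeff zero          (suc i) = 0ℚ
lucasCoeff (suc zero)    zero    = 0ℚ
lucasCoeff (suc zero)    (suc zero) = 1ℚ
lucasCoeff (suc zero)    (suc (suc i)) = 0ℚ
lucasCoeff (suc (suc k)) zero    = lucasCoeff k zero
lucasCoeff (suc (suc k)) (suc i) = lucasCoeff (suc k) i + lucasCoeff k (suc i)

eval-+ : ∀ d p q t → eval d (λ i → p i + q i) t ≡ eval d p t + eval d q t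
eval-+ zero p q t    = refl
eval-+ (suc d) p q t = trans (cong (λ x → p 0 + q 0 + t * x) (eval-+ d (λ i → p (suc i)) (λ i → q (suc i)) t))
  (solve 5 (λ a b t x y → a :+ b :+ t :* (x :+ y) := a :+ t :* x :+ (b :+ t :* y)) refl (p 0) (q 0) t
    (eval d (λ i → p (suc i)) t) (eval d (λ i → q (suc i)) t))

eval-* : ∀ d c p t → eval d (λ i → c * p i) t ≡ c * eval d p t
eval-* zero c p t    = sym (*-zeroʳ c)
eval-* (suc d) c p t = trans (cong (λ x → c * p 0 + t * x) (eval-* d c (λ i → p (suc i)) t))
  (solve 4 (λ c a t x → c :* a :+ t :* (c :* x) := c :* (a :+ t :* x)) refl c (p 0) t (eval d (λ i → p (suc i)) t))

eval-rescale : ∀ d c p t → eval d (λ i → c ^ℚ i * p i) t ≡ eval d p (c * t)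
eval-rescale zero c p t    = refl
eval-rescale (suc d) c p t = begin
  1ℚ * p 0 + t * eval d (λ i → c * c ^ℚ i * p (suc i)) t
    ≡⟨ cong (λ x → 1ℚ * p 0 + t * x) (trans (eval-cong d t (λ i _ → *-assoc c (c ^ℚ i) (p (suc i)))) (eval-* d c (λ i → c ^ℚ i * p (suc i)) t)) ⟩
  1ℚ * p 0 + t * (c * eval d (λ i → c ^ℚ i * p (suc i)) t)
    ≡⟨ cong (λ x → 1ℚ * p 0 + t * (c * x)) (eval-rescale d c (λ i → p (suc i)) t) ⟩
  1ℚ * p 0 + t * (c * eval d (λ i → p (suc i)) (c * t))
    ≡⟨ solve 4 (λ p t c e → con 1ℚ :* p :+ t :* (c :* e) := p :+ c :* t :* e) refl (p 0) t c (eval d (λ i → p (suc i)) (c * t)) ⟩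
  p 0 + c * t * eval d (λ i → p (suc i)) (c * t) ∎
  where open ≡-Reasoning

-- `a` and `g` are the roots of X² = zX + 1 with z = a + g, so their power sums obey the recursion
-- of `lucasCoeff`.
eval-lucasCoeff : ∀ a g → a * g ≡ - 1ℚ → ∀ d k → k < d → eval d (lucasCoeff k) (a + g) ≡ a ^ℚ k + g ^ℚ k
eval-lucasCoeff a g ag (suc d) zero _ = trans (cong (λ x → ℕ→ℚ 2 + (a + g) * x) (eval-0 d (a + g)))
  (solve 1 (λ z → con (ℕ→ℚ 2) :+ z :* con 0ℚ := con 1ℚ :+ con 1ℚ) refl (a + g))
eval-lucasCoeff a g ag (suc zero) (suc k) (s≤s ())
eval-lucasCoeff a g ag (suc (suc d)) (suc zero) _ = trans (cong (λ x → 0ℚ + (a + g) * (1ℚ + (a + g) * x)) (eval-0 d (a + g)))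
  (solve 2 (λ a g → con 0ℚ :+ (a :+ g) :* (con 1ℚ :+ (a :+ g) :* con 0ℚ) := a :* con 1ℚ :+ g :* con 1ℚ) refl a g)
eval-lucasCoeff a g ag (suc d) (suc (suc k)) (s≤s lt) = begin
  lucasCoeff k 0 + z * eval d (λ i → lucasCoeff (suc k) i + lucasCoeff k (suc i)) z
    ≡⟨ cong (λ x → lucasCoeff k 0 + z * x) (eval-+ d (lucasCoeff (suc k)) (λ i → lucasCoeff k (suc i)) z) ⟩
  lucasCoeff k 0 + z * (eval d (lucasCoeff (suc k)) z + eval d (λ i → lucasCoeff k (suc i)) z)
    ≡⟨ solve 4 (λ p z x y → p :+ z :* (x :+ y) := z :* x :+ (p :+ z :* y)) refl (lucasCoeff k 0) z (eval d (lucasCoeff (suc k)) z) (eval d (λ i → lucasCoeff k (suc i)) z) ⟩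
  z * eval d (lucasCoeff (suc k)) z + eval (suc d) (lucasCoeff k) z
    ≡⟨ cong₂ (λ x y → z * x + y) (eval-lucasCoeff a g ag d (suc k) lt) (eval-lucasCoeff a g ag (suc d) k (ℕP.<-trans (ℕP.n<1+n k) (ℕP.m<n⇒m<1+n lt))) ⟩
  (a + g) * (a * p + g * q) + (p + q)
    ≡⟨ solve 4 (λ a g p q → (a :+ g) :* (a :* p :+ g :* q) :+ (p :+ q) := a :* (a :* p) :+ g :* (g :* q) :+ (a :* g :- con (- 1ℚ)) :* (p :+ q)) refl a g p q ⟩
  a * (a * p) + g * (g * q) + (a * g - - 1ℚ) * (p + q)
    ≡⟨ cong (λ x → a * (a * p) + g * (g * q) + (x - - 1ℚ) * (p + q)) ag ⟩
  a * (a * p) + g * (g * q) + 0ℚ * (p + q)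
    ≡⟨ solve 3 (λ x p q → x :+ con 0ℚ :* (p :+ q) := x) refl (a * (a * p) + g * (g * q)) p q ⟩
  a * (a * p) + g * (g * q) ∎
  where
  open ≡-Reasoning
  z p q : ℚ
  z = a + g
  p = a ^ℚ k
  q = g ^ℚ k

-- The coefficient of yˡ in (y/2) (V(y/2) - (y/2)ⁿ⁺¹), where V is the polynomial with coefficients lucasCoeff (n + 1).
target : ℕ → ℕ → ℚ
target n zero    = 0ℚ
target n (suc i) = half ^ℚ suc i * (lucasCoeff (suc n) i - (if does (suc n ℕP.≟ i) then 1ℚ else 0ℚ))

eval-target : ∀ n y a g → a * g ≡ - 1ℚ → half * y ≡ a + g →
  eval (suc (suc (suc n))) (target n) y ≡ (a + g) * (a ^ℚ suc n + g ^ℚ suc n - (a + g) ^ℚ suc n)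
eval-target n y a g ag hy = begin
  0ℚ + y * eval d (λ i → half * half ^ℚ i * p i) y
    ≡⟨ cong (λ x → 0ℚ + y * x) (trans (eval-cong d y (λ i _ → *-assoc half (half ^ℚ i) (p i))) (eval-* d half (λ i → half ^ℚ i * p i) y)) ⟩
  0ℚ + y * (half * eval d (λ i → half ^ℚ i * p i) y)
    ≡⟨ solve 3 (λ y h e → con 0ℚ :+ y :* (h :* e) := h :* y :* e) refl y half (eval d (λ i → half ^ℚ i * p i) y) ⟩
  half * y * eval d (λ i → half ^ℚ i * p i) y
    ≡⟨ cong₂ _*_ hy (trans (eval-rescale d half p y) (cong (eval d p) hy)) ⟩
  z * eval d p z
    ≡⟨ cong (z *_) (trans (eval-+ d (lucasCoeff (suc n)) (λ i → - e i) z) (cong₂ _+_ (eval-lucasCoeff a g ag d (suc n) ℕP.≤-refl)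
         (trans (trans (eval-cong d z (λ i _ → solve 1 (λ x → :- x := con (- 1ℚ) :* x) refl (e i))) (eval-* d (- 1ℚ) e z))
           (cong (- 1ℚ *_) (eval-single d (suc n) 1ℚ z ℕP.≤-refl))))) ⟩
  z * (a ^ℚ suc n + g ^ℚ suc n + - 1ℚ * (z ^ℚ suc n * 1ℚ))
    ≡⟨ solve 4 (λ z a g x → z :* (a :+ g :+ con (- 1ℚ) :* (x :* con 1ℚ)) := z :* (a :+ g :- x)) refl z (a ^ℚ suc n) (g ^ℚ suc n) (z ^ℚ suc n) ⟩
  z * (a ^ℚ suc n + g ^ℚ suc n - z ^ℚ suc n) ∎
  where
  open ≡-Reasoning
  d : ℕ
  d = suc (suc n)
  z : ℚ
  z = a + g
  e p : ℕ → ℚ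
  e i = if does (suc n ℕP.≟ i) then 1ℚ else 0ℚ
  p i = lucasCoeff (suc n) i - e i

-- Estimates at the sample points

*-^ℚ : ∀ p q n → (p * q) ^ℚ n ≡ p ^ℚ n * q ^ℚ n
*-^ℚ p q zero    = sym (*-identityˡ 1ℚ)
*-^ℚ p q (suc n) = trans (cong (p * q *_) (*-^ℚ p q n))
  (solve 4 (λ p q x y → p :* q :* (x :* y) := p :* x :* (q :* y)) refl p q (p ^ℚ n) (q ^ℚ n))

-- Sample points y = 2 (a - 1/a) with a = k + 1. With ρ = 1/(8a) the roots β = ρa and γ = -ρ/a
-- of X² - (ρy/2) X - ρ² have absolute value at most 1/8.
module _ (k : ℕ) where

  a₀ g₀ ρ₀ : ℚ
  a₀ = ℕ→ℚ (suc k)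
  g₀ = - recip k
  ρ₀ = eighth * recip k

  samplePoint : ℚ
  samplePoint = ℕ→ℚ 2 * (a₀ + g₀)

  private
    ag : a₀ * g₀ ≡ - 1ℚ
    ag = trans (sym (neg-distribʳ-* a₀ (recip k))) (cong -_ (recip-inverse k))

    ρ₀-pos : Positive ρ₀
    ρ₀-pos = pos*pos⇒pos eighth (recip k) {{recip-pos k}}

    ^-pos : ∀ p n → Positive p → Positive (p ^ℚ n)
    ^-pos p zero p>0    = _
    ^-pos p (suc n) p>0 = pos*pos⇒pos p {{p>0}} (p ^ℚ n) {{^-pos p n p>0}}

    ρ₀a₀ : ρ₀ * a₀ ≡ eighth
    ρ₀a₀ = trans (solve 2 (λ r a → con eighth :* r :* a := con eighth :* (a :* r)) refl (recip k) a₀)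
      (trans (cong (eighth *_) (recip-inverse k)) (*-identityʳ eighth))

    β≤ : ∣ ρ₀ * a₀ ∣ ≤ℚ eighth
    β≤ = ≤-reflexive (cong ∣_∣ ρ₀a₀)

    recip≤1 : recip k ≤ℚ 1ℚ
    recip≤1 = recip-antimono {0} {k} z≤n

    γ≤ : ∣ ρ₀ * g₀ ∣ ≤ℚ eighth
    γ≤ = begin
      ∣ ρ₀ * - recip k ∣        ≡⟨ cong ∣_∣ (sym (neg-distribʳ-* ρ₀ (recip k))) ⟩
      ∣ - (ρ₀ * recip k) ∣      ≡⟨ ∣-p∣≡∣p∣ (ρ₀ * recip k) ⟩
      ∣ ρ₀ * recip k ∣          ≡⟨ 0≤p⇒∣p∣≡p (0≤* (0≤* (nonNegative⁻¹ eighth) (0≤recip k)) (0≤recip k)) ⟩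
      eighth * recip k * recip k ≤⟨ *-mono-≤-nn (nonNegative⁻¹ eighth) (0≤recip k) (*-monoˡ-≤-nonNeg eighth recip≤1) recip≤1 ⟩
      eighth * 1ℚ * 1ℚ          ≡⟨⟩
      eighth ∎
      where open ≤-Reasoning

  -- The main coefficient is homogeneous of degree `m` in `ρ₀`, as is the scaling of the series; the
  -- fixed nonzero `ρ₀ ^ℚ m` divides out.
  sample-Small : ∀ n → Small (λ N → oddSum>1 samplePoint N (suc (suc n)) - ζtr N (suc (suc n) ∷ []) * eval (suc (suc (suc n))) (target n) samplePoint)
  sample-Small n = Small-div (ρ₀ ^ℚ m) {{pos⇒nonZero (ρ₀ ^ℚ m) {{^-pos ρ₀ m ρ₀-pos}}}}
    (Small-cong rescale (L-main-Small ρ₀ samplePoint (ρ₀ * a₀) (ρ₀ * g₀) sum-eq product-eq β≤ γ≤ n))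
    where
    m : ℕ
    m = suc (suc n)
    sum-eq : ℕ→ℚ 2 * (ρ₀ * a₀ + ρ₀ * g₀) ≡ ρ₀ * samplePoint
    sum-eq = solve 3 (λ r a g → con (ℕ→ℚ 2) :* (r :* a :+ r :* g) := r :* (con (ℕ→ℚ 2) :* (a :+ g))) refl ρ₀ a₀ g₀
    product-eq : ρ₀ * a₀ * (ρ₀ * g₀) ≡ - (ρ₀ * ρ₀)
    product-eq = trans (solve 3 (λ r a g → r :* a :* (r :* g) := r :* r :* (a :* g)) refl ρ₀ a₀ g₀)
      (trans (cong (ρ₀ * ρ₀ *_) ag) (solve 1 (λ r → r :* con (- 1ℚ) := :- r) refl (ρ₀ * ρ₀)))
    z : ℚ
    z = a₀ + g₀
    w = suc n
    main-eq : mainCoefficient ρ₀ samplePoint (ρ₀ * a₀) (ρ₀ * g₀) sum-eq product-eq n ≡ ρ₀ ^ℚ m * eval (suc m) (target n) samplePoint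
    main-eq = begin
      (ρ₀ * a₀ + ρ₀ * g₀) * ((ρ₀ * a₀) ^ℚ w + (ρ₀ * g₀) ^ℚ w - (ρ₀ * a₀ + ρ₀ * g₀) ^ℚ w)
        ≡⟨ cong (λ x → x * ((ρ₀ * a₀) ^ℚ w + (ρ₀ * g₀) ^ℚ w - x ^ℚ w)) (sym (*-distribˡ-+ ρ₀ a₀ g₀)) ⟩
      ρ₀ * z * ((ρ₀ * a₀) ^ℚ w + (ρ₀ * g₀) ^ℚ w - (ρ₀ * z) ^ℚ w)
        ≡⟨ cong (ρ₀ * z *_) (cong₂ _-_ (cong₂ _+_ (*-^ℚ ρ₀ a₀ w) (*-^ℚ ρ₀ g₀ w)) (*-^ℚ ρ₀ z w)) ⟩
      ρ₀ * z * (ρ₀ ^ℚ w * a₀ ^ℚ w + ρ₀ ^ℚ w * g₀ ^ℚ w - ρ₀ ^ℚ w * z ^ℚ w)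
        ≡⟨ solve 6 (λ r z p a g x → r :* z :* (p :* a :+ p :* g :- p :* x) := r :* p :* (z :* (a :+ g :- x))) refl ρ₀ z (ρ₀ ^ℚ w) (a₀ ^ℚ w) (g₀ ^ℚ w) (z ^ℚ w) ⟩
      ρ₀ ^ℚ m * (z * (a₀ ^ℚ w + g₀ ^ℚ w - z ^ℚ w))
        ≡⟨ cong (ρ₀ ^ℚ m *_) (eval-target n samplePoint a₀ g₀ ag (solve 1 (λ z → con half :* (con (ℕ→ℚ 2) :* z) := z) refl z)) ⟨
      ρ₀ ^ℚ m * eval (suc m) (target n) samplePoint ∎
      where open ≡-Reasoning
    rescale : ∀ N → ρ₀ ^ℚ m * oddSum>1 samplePoint N m - ζtr N (m ∷ []) * mainCoefficient ρ₀ samplePoint (ρ₀ * a₀) (ρ₀ * g₀) sum-eq product-eq n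
      ≡ ρ₀ ^ℚ m * (oddSum>1 samplePoint N m - ζtr N (m ∷ []) * eval (suc m) (target n) samplePoint)
    rescale N = trans (cong (λ x → ρ₀ ^ℚ m * oddSum>1 samplePoint N m - ζtr N (m ∷ []) * x) main-eq)
      (solve 4 (λ r o z e → r :* o :- z :* (r :* e) := r :* (o :- z :* e)) refl (ρ₀ ^ℚ m) (oddSum>1 samplePoint N m) (ζtr N (m ∷ [])) (eval (suc m) (target n) samplePoint))

samplePoint-mono : ∀ {i j} → i < j → samplePoint i <ℚ samplePoint j
samplePoint-mono {i} {j} i<j = *-monoʳ-<-pos (ℕ→ℚ 2)
  (+-mono-<-≤ (ℕ→ℚ-mono-< (s≤s i<j)) (neg-antimono-≤ (recip-antimono (ℕP.<⇒≤ i<j))))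

lhsTr-Small : ∀ n l → l < suc (suc (suc n)) → Small (λ N → lhsTr (suc (suc n)) l N - target n l * ζtr N (suc (suc n) ∷ []))
lhsTr-Small n = interpolation m (λ N l → lhsTr m l N - target n l * ζtr N (m ∷ [])) samplePoint samplePoint-mono
  (λ k → Small-cong (λ N → sym (trans
      (eval-+ (suc m) (λ l → lhsTr m l N) (λ l → - (target n l * ζtr N (m ∷ []))) (samplePoint k))
      (cong₂ _+_ (lhsTr-generating m N (samplePoint k))
        (trans (trans (eval-cong (suc m) (samplePoint k) (λ l _ → solve 2 (λ t z → :- (t :* z) := :- z :* t) refl (target n l) (ζtr N (m ∷ []))))
                      (eval-* (suc m) (- ζtr N (m ∷ [])) (target n) (samplePoint k)))
          (sym (neg-distribˡ-* (ζtr N (m ∷ [])) (eval (suc m) (target n) (samplePoint k))))))))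
    (sample-Small k n))
  where
  m : ℕ
  m = suc (suc n)

lucasCoeff-above : ∀ k i → k < i → lucasCoeff k i ≡ 0ℚ
lucasCoeff-above zero (suc i) _                     = refl
lucasCoeff-above (suc zero) (suc (suc i)) _         = refl
lucasCoeff-above (suc zero) (suc zero) (s≤s ())
lucasCoeff-above (suc (suc k)) (suc i) (s≤s lt)     = trans
  (cong₂ _+_ (lucasCoeff-above (suc k) i lt) (lucasCoeff-above k (suc i) (ℕP.m<n⇒m<1+n (ℕP.<-trans (ℕP.n<1+n k) lt)))) (+-identityˡ 0ℚ)

lucasCoeff-diagonal : ∀ i → lucasCoeff (suc i) (suc i) ≡ 1ℚ
lucasCoeff-diagonal zero    = refl
lucasCoeff-diagonal (suc i) = trans (cong₂ _+_ (lucasCoeff-diagonal i) (lucasCoeff-above i (suc (suc i)) (ℕP.m≤n⇒m≤1+n ℕP.≤-refl))) (+-identityʳ 1ℚ)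

double : ℕ → ℕ
double zero    = zero
double (suc j) = suc (suc (double j))

lucasCoeff-constant : ∀ j → lucasCoeff (double j ℕ.+ 0) 0 ≡ ℕ→ℚ 2
lucasCoeff-constant zero    = refl
lucasCoeff-constant (suc j) = lucasCoeff-constant j

-- For k = 2(j+1) + i this is the classical Lucas coefficient k/(k-j-1) C(k-j-1, j+1), split into
-- two binomials to stay in ℕ.
lucas : ℕ → ℕ → ℕ
lucas i j = suc (j ℕ.+ i) C i ℕ.+ (j ℕ.+ i) C i

nC0≡1 : ∀ n → n C 0 ≡ 1
nC0≡1 n = trans (nCk≡nC[n∸k] {0} {n} z≤n) (nCn≡1 n)

pascal : ∀ n k → suc n C suc k ≡ n C k ℕ.+ n C suc k
pascal n k = sym (nCk+nC[k+1]≡[n+1]C[k+1] n k)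

interchange : ∀ a b c d → (a ℕ.+ b) ℕ.+ (c ℕ.+ d) ≡ (a ℕ.+ c) ℕ.+ (b ℕ.+ d)
interchange a b c d = trans (ℕP.+-assoc a b (c ℕ.+ d)) (trans (cong (a ℕ.+_) (trans (sym (ℕP.+-assoc b c d))
  (trans (cong (ℕ._+ d) (ℕP.+-comm b c)) (ℕP.+-assoc c b d)))) (sym (ℕP.+-assoc a c (b ℕ.+ d))))

lucas-suc-suc : ∀ i j → lucas (suc i) (suc j) ≡ lucas i (suc j) ℕ.+ lucas (suc i) j
lucas-suc-suc i j rewrite ℕP.+-suc j i = trans
  (cong₂ ℕ._+_ (pascal (suc (suc (j ℕ.+ i))) i) (pascal (suc (j ℕ.+ i)) i))
  (interchange (suc (suc (j ℕ.+ i)) C i) (suc (suc (j ℕ.+ i)) C suc i) (suc (j ℕ.+ i) C i) (suc (j ℕ.+ i) C suc i))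

lucas-suc-0 : ∀ i → lucas (suc i) 0 ≡ lucas i 0 ℕ.+ 1
lucas-suc-0 i = trans (cong₂ ℕ._+_ (pascal (suc i) i) (pascal i i))
  (trans (interchange (suc i C i) (suc i C suc i) (i C i) (i C suc i))
    (cong (lucas i 0 ℕ.+_) (cong₂ ℕ._+_ (nCn≡1 (suc i)) (k>n⇒nCk≡0 (ℕP.n<1+n i)))))

lucasCoeff-lucas : ∀ i j → lucasCoeff (suc (suc (double j ℕ.+ i))) i ≡ ℕ→ℚ (lucas i j)
lucasCoeff-lucas zero j    = trans (lucasCoeff-constant j) (cong ℕ→ℚ (sym (cong₂ ℕ._+_ (nC0≡1 (suc (j ℕ.+ 0))) (nC0≡1 (j ℕ.+ 0)))))
lucasCoeff-lucas (suc i) j = trans (cong (_+ lucasCoeff (double j ℕ.+ suc i) (suc i))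
    (trans (cong (λ m → lucasCoeff (suc m) i) (ℕP.+-suc (double j) i)) (lucasCoeff-lucas i j))) (rest j)
  where
  rest : ∀ j → ℕ→ℚ (lucas i j) + lucasCoeff (double j ℕ.+ suc i) (suc i) ≡ ℕ→ℚ (lucas (suc i) j)
  -- At `j = 0` the second summand is a leading coefficient, outside the range of `lucas`.
  rest zero    = trans (cong (ℕ→ℚ (lucas i 0) +_) (lucasCoeff-diagonal i)) (sym (trans (cong ℕ→ℚ (lucas-suc-0 i)) (ℕ→ℚ-+ (lucas i 0) 1)))
  rest (suc j) = trans (cong (ℕ→ℚ (lucas i (suc j)) +_) (lucasCoeff-lucas (suc i) j))
    (sym (trans (cong ℕ→ℚ (lucas-suc-suc i j)) (ℕ→ℚ-+ (lucas i (suc j)) (lucas (suc i) j))))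

choose : ℕ → ℕ → ℕ
choose j i = (j ℕ.+ i) C i

choose-suc-suc : ∀ j i → choose (suc j) (suc i) ≡ choose (suc j) i ℕ.+ choose j (suc i)
choose-suc-suc j i = trans (pascal (j ℕ.+ suc i) i) (cong (λ m → m C i ℕ.+ choose j (suc i)) (ℕP.+-suc j i))

-- Proved jointly with `absorptionʳ`: after Pascal's rule, equating the two identities at `(j , i)`
-- trades the factor `suc j` for `suc i`.
absorptionˡ : ∀ j i → suc j ℕ.* choose (suc j) i ≡ suc (j ℕ.+ i) ℕ.* choose j i
absorptionʳ : ∀ j i → suc i ℕ.* choose j (suc i) ≡ suc (j ℕ.+ i) ℕ.* choose j i

absorptionˡ j zero    = cong₂ ℕ._*_ (cong suc (sym (ℕP.+-identityʳ j))) (trans (nC0≡1 (suc (j ℕ.+ 0))) (sym (nC0≡1 (j ℕ.+ 0))))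
absorptionˡ j (suc i) = begin
  suc j ℕ.* choose (suc j) (suc i)                                   ≡⟨ cong (suc j ℕ.*_) (choose-suc-suc j i) ⟩
  suc j ℕ.* (choose (suc j) i ℕ.+ choose j (suc i))                  ≡⟨ ℕP.*-distribˡ-+ (suc j) (choose (suc j) i) (choose j (suc i)) ⟩
  suc j ℕ.* choose (suc j) i ℕ.+ suc j ℕ.* choose j (suc i)          ≡⟨ cong (ℕ._+ suc j ℕ.* choose j (suc i)) (trans (absorptionˡ j i) (sym (absorptionʳ j i))) ⟩
  suc i ℕ.* choose j (suc i) ℕ.+ suc j ℕ.* choose j (suc i)          ≡⟨ ℕP.*-distribʳ-+ (choose j (suc i)) (suc i) (suc j) ⟨
  (suc i ℕ.+ suc j) ℕ.* choose j (suc i)                             ≡⟨ cong (ℕ._* choose j (suc i)) (ℕP.+-comm (suc i) (suc j)) ⟩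
  suc (j ℕ.+ suc i) ℕ.* choose j (suc i) ∎
  where open ≡-Reasoning

absorptionʳ zero i    = cong₂ ℕ._*_ (refl {x = suc i}) (trans (nCn≡1 (suc i)) (sym (nCn≡1 i)))
absorptionʳ (suc j) i = begin
  suc i ℕ.* choose (suc j) (suc i)                                   ≡⟨ cong (suc i ℕ.*_) (choose-suc-suc j i) ⟩
  suc i ℕ.* (choose (suc j) i ℕ.+ choose j (suc i))                  ≡⟨ ℕP.*-distribˡ-+ (suc i) (choose (suc j) i) (choose j (suc i)) ⟩
  suc i ℕ.* choose (suc j) i ℕ.+ suc i ℕ.* choose j (suc i)          ≡⟨ cong (suc i ℕ.* choose (suc j) i ℕ.+_) (trans (absorptionʳ j i) (sym (absorptionˡ j i))) ⟩
  suc i ℕ.* choose (suc j) i ℕ.+ suc j ℕ.* choose (suc j) i          ≡⟨ ℕP.*-distribʳ-+ (choose (suc j) i) (suc i) (suc j) ⟨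
  (suc i ℕ.+ suc j) ℕ.* choose (suc j) i                             ≡⟨ cong (ℕ._* choose (suc j) i) (trans (ℕP.+-comm (suc i) (suc j)) (ℕP.+-suc (suc j) i)) ⟩
  suc (suc j ℕ.+ i) ℕ.* choose (suc j) i ∎
  where open ≡-Reasoning

double≡+ : ∀ j → double j ≡ j ℕ.+ j
double≡+ zero    = refl
double≡+ (suc j) = cong suc (trans (cong suc (double≡+ j)) (sym (ℕP.+-suc j j)))

⌊double/2⌋ : ∀ j → ⌊ double j /2⌋ ≡ j
⌊double/2⌋ zero    = refl
⌊double/2⌋ (suc j) = cong suc (⌊double/2⌋ j)

-- In these parameters n - l = 2(j+1), (n+l)/2 = j+i+2, and n - 1 splits as `J + X`.
module Coefficients (i j : ℕ) where

  l n : ℕ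
  l = suc i
  n = suc (suc (suc (double j ℕ.+ i)))

  n+l : n ℕ.+ l ≡ double (suc (suc (j ℕ.+ i)))
  n+l = cong (λ m → suc (suc (suc m))) (trans (ℕP.+-suc (double j ℕ.+ i) i) (cong suc (begin
    double j ℕ.+ i ℕ.+ i     ≡⟨ trans (ℕP.+-assoc (double j) i i) (cong (ℕ._+ (i ℕ.+ i)) (double≡+ j)) ⟩
    j ℕ.+ j ℕ.+ (i ℕ.+ i)    ≡⟨ interchange j j i i ⟩
    j ℕ.+ i ℕ.+ (j ℕ.+ i)    ≡⟨ double≡+ (j ℕ.+ i) ⟨
    double (j ℕ.+ i) ∎)))
    where open ≡-Reasoning

  half-sum : ⌊ n ℕ.+ l /2⌋ ≡ suc (suc (j ℕ.+ i))
  half-sum = trans (cong ⌊_/2⌋ n+l) (⌊double/2⌋ (suc (suc (j ℕ.+ i))))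

  J X r x P Q h : ℚ
  J = ℕ→ℚ (suc j)
  X = ℕ→ℚ (suc (j ℕ.+ i))
  r = recip j
  x = recip (j ℕ.+ i)
  P = ℕ→ℚ ((j ℕ.+ i) C i)
  Q = ℕ→ℚ (suc (j ℕ.+ i) C i)
  h = half ^ℚ i

  n∸1 : ℕ→ℚ (n ℕ.∸ 1) ≡ J + X
  n∸1 = trans (cong ℕ→ℚ (trans (cong (λ m → suc (suc (m ℕ.+ i))) (double≡+ j))
      (cong suc (trans (cong suc (ℕP.+-assoc j j i)) (sym (ℕP.+-suc j (j ℕ.+ i)))))))
    (ℕ→ℚ-+ (suc j) (suc (j ℕ.+ i)))

  n∸l : invℕ (n ℕ.∸ l) ≡ half * r
  n∸l = begin
    invℕ (suc (suc (double j ℕ.+ i)) ℕ.∸ i)  ≡⟨ cong invℕ (ℕP.m+n∸n≡m (suc (suc (double j))) i) ⟩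
    d                                       ≡⟨ solve 1 (λ d → d := con 1ℚ :* d) refl d ⟩
    1ℚ * d                                  ≡⟨ cong (_* d) (recip-inverse j) ⟨
    J * r * d                               ≡⟨ solve 3 (λ k r d → k :* r :* d := con half :* r :* ((k :+ k) :* d)) refl J r d ⟩
    half * r * ((J + J) * d)                ≡⟨ cong (λ y → half * r * (y * d)) (trans (sym (ℕ→ℚ-+ (suc j) (suc j))) (cong ℕ→ℚ (sym (double≡+ (suc j))))) ⟩
    half * r * (ℕ→ℚ (suc (suc (double j))) * d) ≡⟨ cong (half * r *_) (recip-inverse (suc (double j))) ⟩
    half * r * 1ℚ                           ≡⟨ *-identityʳ (half * r) ⟩
    half * r ∎
    where
    open ≡-Reasoning
    d : ℚ
    d = recip (suc (double j))

  -- The reason the two closed forms agree: `(J + X) P / J` and `(J + X) Q / X` both become `P + Q`.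
  absorption : J * Q ≡ X * P
  absorption = trans (sym (ℕ→ℚ-* (suc j) (suc (j ℕ.+ i) C i))) (trans (cong ℕ→ℚ (absorptionˡ j i)) (ℕ→ℚ-* (suc (j ℕ.+ i)) ((j ℕ.+ i) C i)))

  coeff1-eq : coeff1 n l ≡ half * h * (Q + P)
  coeff1-eq = begin
    ℕ→ℚ (n ℕ.∸ 1) * invℕ (n ℕ.∸ l) * ℕ→ℚ ((⌊ n ℕ.+ l /2⌋ ℕ.∸ 2) C i) * h
      ≡⟨ cong₂ (λ y z → y * ℕ→ℚ ((z ℕ.∸ 2) C i) * h) (cong₂ _*_ n∸1 n∸l) half-sum ⟩
    (J + X) * (half * r) * P * h
      ≡⟨ solve 5 (λ J X r P h → (J :+ X) :* (con half :* r) :* P :* h := con half :* h :* (r :* (X :* P) :+ J :* r :* P)) refl J X r P h ⟩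
    half * h * (r * (X * P) + J * r * P)
      ≡⟨ cong (λ y → half * h * (r * y + J * r * P)) absorption ⟨
    half * h * (r * (J * Q) + J * r * P)
      ≡⟨ solve 5 (λ J r P Q h → con half :* h :* (r :* (J :* Q) :+ J :* r :* P) := con half :* h :* (J :* r :* (Q :+ P))) refl J r P Q h ⟩
    half * h * (J * r * (Q + P))
      ≡⟨ cong (λ y → half * h * (y * (Q + P))) (recip-inverse j) ⟩
    half * h * (1ℚ * (Q + P))
      ≡⟨ solve 2 (λ h y → h :* (con 1ℚ :* y) := h :* y) refl (half * h) (Q + P) ⟩
    half * h * (Q + P) ∎
    where open ≡-Reasoning

  coeff2-eq : coeff2 n l ≡ half * h * (Q + P)
  coeff2-eq = begin
    ℕ→ℚ (n ℕ.∸ 1) * invℕ (⌊ n ℕ.+ l /2⌋ ℕ.∸ 1) * ℕ→ℚ ((⌊ n ℕ.+ l /2⌋ ℕ.∸ 1) C i) * (half * h)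
      ≡⟨ cong₂ (λ y z → y * invℕ (z ℕ.∸ 1) * ℕ→ℚ ((z ℕ.∸ 1) C i) * (half * h)) n∸1 half-sum ⟩
    (J + X) * x * Q * (half * h)
      ≡⟨ solve 5 (λ J X x Q h → (J :+ X) :* x :* Q :* (con half :* h) := con half :* h :* (X :* x :* Q :+ x :* (J :* Q))) refl J X x Q h ⟩
    half * h * (X * x * Q + x * (J * Q))
      ≡⟨ cong (λ y → half * h * (X * x * Q + x * y)) absorption ⟩
    half * h * (X * x * Q + x * (X * P))
      ≡⟨ solve 5 (λ X x Q P h → con half :* h :* (X :* x :* Q :+ x :* (X :* P)) := con half :* h :* (X :* x :* (Q :+ P))) refl X x Q P h ⟩
    half * h * (X * x * (Q + P))
      ≡⟨ cong (λ y → half * h * (y * (Q + P))) (recip-inverse (j ℕ.+ i)) ⟩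
    half * h * (1ℚ * (Q + P))
      ≡⟨ solve 2 (λ h y → h :* (con 1ℚ :* y) := h :* y) refl (half * h) (Q + P) ⟩
    half * h * (Q + P) ∎
    where open ≡-Reasoning

  i<n-1 : i < suc (suc (double j ℕ.+ i))
  i<n-1 = s≤s (ℕP.m≤n⇒m≤1+n (ℕP.m≤n+m i (double j)))

  target-eq : target (suc (double j ℕ.+ i)) l ≡ half * h * (Q + P)
  target-eq = cong (half * h *_) (trans
    (cong₂ (λ y b → y - (if b then 1ℚ else 0ℚ)) (trans (lucasCoeff-lucas i j) (ℕ→ℚ-+ (suc (j ℕ.+ i) C i) ((j ℕ.+ i) C i)))
      -- The subtracted leading term sits at l = n, beyond the range l < n.
      (dec-false (suc (suc (double j ℕ.+ i)) ℕP.≟ i) (λ eq → ℕP.<⇒≢ i<n-1 (sym eq))))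
    (+-identityʳ (Q + P)))

-- With equal remainders n - l is twice the difference `d` of the quotients, and `l < n` excludes
-- `d = 0`.
parity : ∀ n l → l < n → n % 2 ≡ l % 2 → ∃[ j ] n ≡ suc (suc (double j ℕ.+ l))
parity n l l<n eq = go (ℕP.m≤n⇒∃[o]m+o≡n (DM./-monoˡ-≤ 2 (ℕP.<⇒≤ l<n)))
  where
  open ≡-Reasoning
  decompose : ∀ d → l DM./ 2 ℕ.+ d ≡ n DM./ 2 → n ≡ double d ℕ.+ l
  decompose d e = begin
    n                                        ≡⟨ DM.m≡m%n+[m/n]*n n 2 ⟩
    n % 2 ℕ.+ n DM./ 2 ℕ.* 2                 ≡⟨ cong₂ (λ x y → x ℕ.+ y ℕ.* 2) eq (sym e) ⟩
    l % 2 ℕ.+ (l DM./ 2 ℕ.+ d) ℕ.* 2         ≡⟨ cong (l % 2 ℕ.+_) (ℕP.*-distribʳ-+ 2 (l DM./ 2) d) ⟩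
    l % 2 ℕ.+ (l DM./ 2 ℕ.* 2 ℕ.+ d ℕ.* 2)   ≡⟨ ℕP.+-assoc (l % 2) (l DM./ 2 ℕ.* 2) (d ℕ.* 2) ⟨
    l % 2 ℕ.+ l DM./ 2 ℕ.* 2 ℕ.+ d ℕ.* 2     ≡⟨ cong₂ ℕ._+_ (sym (DM.m≡m%n+[m/n]*n l 2)) (*2 d) ⟩
    l ℕ.+ double d                           ≡⟨ ℕP.+-comm l (double d) ⟩
    double d ℕ.+ l ∎
    where
    *2 : ∀ d → d ℕ.* 2 ≡ double d
    *2 zero    = refl
    *2 (suc d) = cong (λ m → suc (suc m)) (*2 d)
  go : (∃[ d ] l DM./ 2 ℕ.+ d ≡ n DM./ 2) → ∃[ j ] n ≡ suc (suc (double j ℕ.+ l))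
  go (zero , e)  = ⊥-elim (ℕP.<⇒≢ l<n (sym (decompose 0 e)))
  go (suc j , e) = j , decompose (suc j) e

theorem9 : (n l : ℕ) → 2 < n → 1 ≤ l → l < n → n % 2 ≡ l % 2 →
    coeff1 n l ≡ coeff2 n l ×
    ((ε : ℚ) → 0ℚ <ℚ ε → ∃[ N₀ ] ((N : ℕ) → N₀ ≤ N →
    ∣ lhsTr n l N - coeff1 n l * ζtr N [ n ] ∣ <ℚ ε))
theorem9 n (suc i) _ _ l<n par = go (parity n (suc i) l<n par)
  where
  Statement : ℕ → Set
  Statement n = coeff1 n (suc i) ≡ coeff2 n (suc i) × Small (λ N → lhsTr n (suc i) N - coeff1 n (suc i) * ζtr N [ n ])
  go : (∃[ j ] n ≡ suc (suc (double j ℕ.+ suc i))) → Statement n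
  go (j , eq) = subst Statement (sym (trans eq (cong (λ m → suc (suc m)) (ℕP.+-suc (double j) i))))
    ( trans coeff1-eq (sym coeff2-eq)
    , Small-cong (λ N → cong (λ c → lhsTr m l N - c * ζtr N [ m ]) (trans target-eq (sym coeff1-eq)))
        (lhsTr-Small (suc (double j ℕ.+ i)) l (s≤s (ℕP.m≤n⇒m≤1+n i<n-1))))
    where open Coefficients i j renaming (n to m)
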